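{- Let $k>1$ be an integer, consider an admissible figure (for this $k$) consisting of $n$ tiles, and let $G\le S_n$ be its puzzle group. Then: 1. If $k$ is even and $n\neq 6$, then $G=A_n$ if $k\equiv 0 \pmod 4$, and $G=S_n$ if $k\equiv 2\pmod 4$. 2. If $k$ is odd and $n\neq 12$, color the figure as a checkerboard in black and white, and suppose there are $m$ black tiles and $n-m$ white tiles (so $G$ may be regarded as a subgroup of $S_m\times S_{n-m}$, permuting the black tiles among themselves and the white tiles among themselves). Then $G=A_m\times A_{n-m}$ if $k\equiv 1,7\pmod 8$, and $G=\mathrm{Even}(S_m\times S_{n-m})$ if $k\equiv 3,5\pmod 8$, where $\mathrm{Even}(S_m\times S_{n-m})=(A_m\times A_{n-m})\cup\big((S_m\setminus A_m)\times(S_{n-m}\setminus A_{n-m})\big)$ is the set of all even permutations in $S_m\times S_{n-m}$. 3. If $n=6$, then under an appropriate labeling of the six tiles by the points of the projective line over $\mathbb{Z}_5$, $G=PGL_2(5)$ (acting by fractional linear transformations $z\mapsto \frac{az+b}{cz+d}$ with $a,b,c,d\in\mathbb{Z}_5$, $ad-bc\neq 0$), and $PGL_2(5)\cong S_5$. If $k=3$ and $n=12$, then $G\cong S_6$, and the restriction (projection) of $G$ to each of its two orbits is the full symmetric group $S_6$ on that orbit.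
   Context: Tiles are unit squares of the integer grid in the plane. For a fixed integer $k\ge 1$, an arrangement (figure) of tiles is called admissible if it can be formed by successively placing grid-aligned $k\times(k+1)$ and/or $(k+1)\times k$ rectangles of tiles such that each new rectangle overlaps the union of the previously placed rectangles in at least one tile when $k$ is even, and in at least two adjacent tiles when $k$ is odd. A move consists of rotating clockwise by $90^\circ$ the tiles in any $k\times k$ square block of tiles that is contained in the figure; each such move is a permutation of the $n$ tiles of the figure. The puzzle group $G$ of the figure is the subgroup of the symmetric group $S_n$ (on the set of tiles) generated by all such moves. $A_n$ denotes the alternating group. -}

module Defs where

open import Data.Nat as ℕ using (ℕ; zero; suc; _<_; _%_; _≡ᵇ_; _<ᵇ_; NonZero)
open import Data.Nat.DivMod using (_mod_)
open import Data.Integer as ℤ using (ℤ; +_; ∣_∣)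
open import Data.Bool using (Bool; true; false; if_then_else_; _∧_; not)
open import Data.Product using (_×_; _,_; ∃; ∃-syntax; Σ)
open import Data.Sum using (_⊎_)
open import Data.List using (List; []; _∷_; map; allFin)
open import Data.Nat.ListAction using (sum)
open import Data.List.Relation.Unary.Any using (Any)
open import Data.List.Relation.Unary.All using (All)
open import Data.Fin using (Fin; toℕ)
open import Data.Fin.Permutation using (Permutation′; _⟨$⟩ʳ_; _∘ₚ_)
open import Data.Maybe using (Maybe; just; nothing)
open import Relation.Nullary using (¬_; does)
open import Relation.Binary.PropositionalEquality using (_≡_; _≢_)
open import Function using (_∘_)

-- Tiles: unit squares of the integer grid, named by their lower-left
-- corner (x , y) ∈ ℤ × ℤ.

Cell : Set
Cell = ℤ × ℤ

record Rect : Set where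
  constructor rect
  field
    corner     : Cell
    horizontal : Bool

width height : ℕ → Rect → ℕ
width  k (rect _ true)  = suc k
width  k (rect _ false) = k
height k (rect _ true)  = k
height k (rect _ false) = suc k

InRect : ℕ → Rect → Cell → Set
InRect k r@(rect (x , y) _) c =
  ∃[ i ] ∃[ j ] (i < width k r × j < height k r × c ≡ (x ℤ.+ + i , y ℤ.+ + j))

InFig : ℕ → List Rect → Cell → Set
InFig k rs c = Any (λ r → InRect k r c) rs

Adjacent : Cell → Cell → Set
Adjacent (x , y) (x' , y') =
  (x' ≡ x ℤ.+ ℤ.1ℤ × y' ≡ y) ⊎ (x ≡ x' ℤ.+ ℤ.1ℤ × y' ≡ y) ⊎
  (x' ≡ x × y' ≡ y ℤ.+ ℤ.1ℤ) ⊎ (x' ≡ x × y ≡ y' ℤ.+ ℤ.1ℤ)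

Overlaps : ℕ → Rect → List Rect → Set
Overlaps k r rs =
  (k % 2 ≡ 0 → ∃[ c ] (InRect k r c × InFig k rs c)) ×
  (k % 2 ≡ 1 → ∃[ c ] ∃[ c' ] (Adjacent c c' × InRect k r c × InFig k rs c ×
                                InRect k r c' × InFig k rs c'))

-- Valid construction sequences (head = most recently placed rectangle).
-- A figure is admissible iff it is InFig k rs for some rs with Admissible k rs.
data Admissible (k : ℕ) : List Rect → Set where
  first : ∀ r → Admissible k (r ∷ [])
  place : ∀ r rs → Admissible k rs → Overlaps k r rs → Admissible k (r ∷ rs)

BlockIn : ℕ → List Rect → Cell → Set
BlockIn k rs (a , b) =
  ∀ i j → i < k → j < k → InFig k rs (a ℤ.+ + i , b ℤ.+ + j)

-- Clockwise 90° rotation of the tiles of the block at (a , b)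
-- (x to the right, y upwards): offset (i , j) ↦ (j , k-1-i);
-- tiles outside the block are fixed.
rotate : ℕ → Cell → Cell → Cell
rotate k (a , b) (x , y) =
  let i = x ℤ.- a ; j = y ℤ.- b in
  if does (ℤ.0ℤ ℤ.≤? i) ∧ does (i ℤ.<? + k) ∧ does (ℤ.0ℤ ℤ.≤? j) ∧ does (j ℤ.<? + k)
  then (a ℤ.+ j , b ℤ.+ (+ (k ℕ.∸ 1) ℤ.- i))
  else (x , y)

-- A generator or its inverse (counter-clockwise = three clockwise turns).
Move : Set
Move = Cell × Bool

MoveIn : ℕ → List Rect → Move → Set
MoveIn k rs (p , _) = BlockIn k rs p

actMove : ℕ → Move → Cell → Cell
actMove k (p , true)  = rotate k p
actMove k (p , false) = rotate k p ∘ rotate k p ∘ rotate k p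

act : ℕ → List Move → Cell → Cell
act k []       = λ c → c
act k (m ∷ w)  = actMove k m ∘ act k w

InG : ℕ → List Rect → {n : ℕ} → (Fin n → Cell) → Permutation′ n → Set
InG k rs e σ =
  ∃[ w ] (All (MoveIn k rs) w × (∀ i → e (σ ⟨$⟩ʳ i) ≡ act k w (e i)))

-- Parity via inversion counts, optionally restricted to a subset S
-- (for a permutation preserving S this is the parity of its restriction
-- to S, with S ordered by index).

count : {n : ℕ} → (Fin n → Fin n → Bool) → ℕ
count {n} p = sum (map (λ i → sum (map (λ j → if p i j then 1 else 0) (allFin n)))
                       (allFin n))

inversionsOn : {n : ℕ} → (Fin n → Bool) → Permutation′ n → ℕ
inversionsOn S σ = count (λ i j → S i ∧ S j ∧ (toℕ i <ᵇ toℕ j) ∧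
                                  (toℕ (σ ⟨$⟩ʳ j) <ᵇ toℕ (σ ⟨$⟩ʳ i)))

EvenOn : {n : ℕ} → (Fin n → Bool) → Permutation′ n → Set
EvenOn S σ = inversionsOn S σ % 2 ≡ 0

IsEven : {n : ℕ} → Permutation′ n → Set
IsEven = EvenOn (λ _ → true)

black : Cell → Bool
black (x , y) = ∣ x ℤ.+ y ∣ % 2 ≡ᵇ 0

-- Projective line over ℤ₅: nothing = ∞, just z = z ∈ ℤ₅.

P¹₅ : Set
P¹₅ = Maybe (Fin 5)

inv₅ : ℕ → ℕ
inv₅ 1 = 1
inv₅ 2 = 3
inv₅ 3 = 2
inv₅ 4 = 4
inv₅ _ = 0

mobius : Fin 5 → Fin 5 → Fin 5 → Fin 5 → P¹₅ → P¹₅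
mobius a b c d (just z) =
  let den = (toℕ c ℕ.* toℕ z ℕ.+ toℕ d) % 5 in
  if den ≡ᵇ 0 then nothing
  else just (((toℕ a ℕ.* toℕ z ℕ.+ toℕ b) ℕ.* inv₅ den) mod 5)
mobius a b c d nothing =
  if toℕ c ≡ᵇ 0 then nothing else just ((toℕ a ℕ.* inv₅ (toℕ c)) mod 5)

-- a d - b c ≠ 0 in ℤ₅
det≢0 : Fin 5 → Fin 5 → Fin 5 → Fin 5 → Set
det≢0 a b c d = (toℕ a ℕ.* toℕ d ℕ.+ 4 ℕ.* toℕ b ℕ.* toℕ c) % 5 ≢ 0

_≈ₚ_ : {n : ℕ} → Permutation′ n → Permutation′ n → Set
σ ≈ₚ τ = ∀ i → σ ⟨$⟩ʳ i ≡ τ ⟨$⟩ʳ i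

record IsoToSym {n : ℕ} (P : Permutation′ n → Set) (m : ℕ) : Set where
  field
    φ       : (σ : Permutation′ n) → P σ → Permutation′ m
    φ-cong  : ∀ σ τ (p : P σ) (q : P τ) → σ ≈ₚ τ → φ σ p ≈ₚ φ τ q
    φ-inj   : ∀ σ τ (p : P σ) (q : P τ) → φ σ p ≈ₚ φ τ q → σ ≈ₚ τ
    φ-surj  : ∀ ρ → ∃[ σ ] Σ (P σ) (λ p → φ σ p ≈ₚ ρ)
    φ-hom   : ∀ σ τ (p : P σ) (q : P τ) (r : P (σ ∘ₚ τ)) →
              φ (σ ∘ₚ τ) r ≈ₚ (φ σ p ∘ₚ φ τ q)

PreservesColour : {n : ℕ} → (Fin n → Cell) → Permutation′ n → Set
PreservesColour e σ = ∀ i → black (e (σ ⟨$⟩ʳ i)) ≡ black (e i)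

{-# OPTIONS --safe #-}

-- Call two cells linked if they are equal or if some 3-cycle of the puzzle
-- group moves one to the other.  This is an equivalence relation invariant
-- under the group, so the class of a cell is closed under a rotation as soon
-- as it contains a point fixed by that rotation.  Inside one k × (k+1)
-- rectangle the two rotations L and R act transitively on the tiles (on each
-- colour class, if k is odd); hence one 3-cycle with points outside both
-- blocks links all tiles, or all tiles of one colour.  A further rectangle is
-- then absorbed, because an old rectangle sticks out of both its blocks.
--
-- For k ≥ 5 the permutation g = (L R)² moves exactly the tiles on three sides
-- of the rectangle, and the supports of g and of its conjugate by
-- L⁻¹ R⁻¹ L R² L meet in a single tile, so their commutator is a 3-cycle; its
-- mirror image serves the other colour.  For k = 4, and for every position of
-- two overlapping rectangles with k = 2 or k = 3, an explicit word is checked.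
--
-- When equally coloured tiles are linked, the group contains every permutation
-- that is even on each colour, and the sign of a rotation decides the rest: it
-- consists of 4-cycles, one for each tile (i , j) with i < ⌈k/2⌉, j < ⌊k/2⌋.
--
-- A single 2 × 3 rectangle acts on the projective line, and compatibly on five
-- synthematic totals of its tiles; these five objects in turn recover the six
-- tiles as the partitions of the edges of K₅ into two pentagons.  For a single
-- 3 × 4 rectangle the white tiles correspond to the six synthematic totals of
-- the black ones, so that the action on the black tiles is faithful.
module Submission where

open import Defs
open import Data.Nat as ℕ using (ℕ; zero; suc; _<_; _∸_; s≤s; z≤n; _%_; _≡ᵇ_; _/_; _<ᵇ_; _≤_; NonZero)
import Data.Nat.Properties as ℕₚ
open import Data.Integer as ℤ using (ℤ; +_; 0ℤ; -[1+_]; 1ℤ; ∣_∣)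
import Data.Integer.Properties as ℤₚ
open import Data.Bool using (Bool; true; false; not; if_then_else_; _∧_; _xor_; _∨_; T)
open import Data.Bool.Properties as Boolₚ using (not-involutive)
open import Data.Product using (_×_; _,_; ∃-syntax; proj₁; proj₂; swap; Σ-syntax)
open import Data.Product.Properties using (≡-dec)
open import Data.Sum as Sum using (_⊎_; inj₁; inj₂)
open import Data.List using (List; []; _∷_; map; _++_; allFin; tabulate; cartesianProduct; length)
open import Data.List.Relation.Unary.All as All using (All; []; _∷_)
import Data.List.Relation.Unary.All.Properties as Allₚ
open import Data.Empty using (⊥; ⊥-elim)
open import Relation.Nullary using (¬_; does; yes; no; Dec)
open import Relation.Nullary.Decidable using (dec-true; dec-false; _⊎-dec_)
open import Relation.Binary.PropositionalEquality
open import Function using (_∘_; case_of_; id; Injective)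
open import Data.Nat.DivMod using ([m+n]%n≡m%n; m≡m%n+[m/n]*n; _mod_)
open import Data.List.Relation.Unary.Any as Any using (here; there; Any)
open import Data.Unit using (tt)
open import Data.Bool.ListAction using (any; all)
open import Data.Nat.ListAction renaming (sum to listSum)
open import Data.Fin using (Fin; zero; suc; toℕ; fromℕ<; remQuot; combine)
import Data.Fin.Properties as Finₚ
open import Data.Fin.Permutation as Perm using (Permutation′; _⟨$⟩ʳ_; _⟨$⟩ˡ_; _∘ₚ_; transpose; permutation)
import Data.Fin.Permutation.Components as Comp
import Data.List.Properties as Listₚ
open import Data.Nat.Solver using (module +-*-Solver)
open +-*-Solver using (solve; _:+_; _:*_; _:=_; con)
open import Algebra.Properties.Semiring.Sum ℕₚ.+-*-semiring using (sum; sum-cong-≗; ∑-distrib-+; ∑-comm; sum-permute; *-distribˡ-sum; *-distribʳ-sum)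
open import Data.List.Relation.Unary.AllPairs as AllPairs using (AllPairs; []; _∷_)
import Data.List.Relation.Unary.Any.Properties as Anyₚ
import Data.List.Relation.Unary.AllPairs.Properties as AllPairsₚ
open import Data.List.Relation.Unary.Unique.Propositional.Properties using (cartesianProduct⁺; allFin⁺)
open import Data.List.Membership.Propositional using (lose)
open import Data.List.Membership.Propositional.Properties using (∈-cartesianProduct⁺; ∈-allFin)
open import Function.Bundles using (_⇔_; mk⇔; _↔_; mk↔ₛ′; Inverse)
open import Data.Fin.Permutation.Transposition.List using (eval; decompose; eval-decompose)
open import Data.Maybe using (just; nothing)

-- Rotations and motions of the grid

-- A single 2 × 3 or 3 × 4 rectangle yields no 3-cycle at all: a nonidentity element of PGL₂(5)
-- fixes at most two of the six points, and a 3-cycle of the black tiles of the 3 × 4 rectangle acts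
-- on their synthematic totals, hence on the white tiles, as a product of two 3-cycles. For k = 2
-- and k = 3 the induction can therefore start only with the first rectangle that differs from the
-- initial one. A motion of the plane brings the initial one to a fixed place, which leaves finitely
-- many positions of the other; for odd k those with a single common tile cannot arise. Linkage
-- rests on conjugation: a word carries 3-cycles to 3-cycles, hence classes to classes. If a
-- rotation ρ fixes q and p is linked to q, then ρ p is linked to ρ q = q. For odd k a rotation has
-- the same sign on the black and on the white tiles, the parity of (k² - 1) / 8. If this is odd,
-- the length of a word determines both signs at once, which couples the two colours. For even k the
-- sign is the parity of k² / 4.

infixl 6 _⊹_ _⊕_

_⊹_ : Cell → ℕ × ℕ → Cell
(a , b) ⊹ (i , j) = a ℤ.+ + i , b ℤ.+ + j

_⊕_ : Cell → Cell → Cell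
(a , b) ⊕ (u , v) = a ℤ.+ u , b ℤ.+ v

_≟ᶜ_ : (c d : Cell) → Dec (c ≡ d)
_≟ᶜ_ = ≡-dec ℤ._≟_ ℤ._≟_

InBox : ℕ → ℕ → Cell → Cell → Set
InBox w h p c = ∃[ i ] ∃[ j ] (i < w × j < h × c ≡ p ⊹ (i , j))

InBlock : ℕ → Cell → Cell → Set
InBlock k = InBox k k

x+i-x : ∀ x i → (x ℤ.+ i) ℤ.- x ≡ i
x+i-x x i = begin
  (x ℤ.+ i) ℤ.- x     ≡⟨ cong (ℤ._- x) (ℤₚ.+-comm x i) ⟩
  (i ℤ.+ x) ℤ.- x     ≡⟨ ℤₚ.+-assoc i x (ℤ.- x) ⟩
  i ℤ.+ (x ℤ.- x)     ≡⟨ cong (λ z → i ℤ.+ z) (ℤₚ.+-inverseʳ x) ⟩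
  i ℤ.+ 0ℤ            ≡⟨ ℤₚ.+-identityʳ i ⟩
  i                   ∎
  where open ≡-Reasoning

x+[y-x] : ∀ x y → x ℤ.+ (y ℤ.- x) ≡ y
x+[y-x] x y = begin
  x ℤ.+ (y ℤ.- x)     ≡⟨ ℤₚ.+-assoc x y (ℤ.- x) ⟨
  (x ℤ.+ y) ℤ.- x     ≡⟨ x+i-x x y ⟩
  y                   ∎
  where open ≡-Reasoning

-- The differences enter as variables with equations, so that the lower bounds allow them to be
-- matched as naturals.
offsets : ∀ {w h a b i j} x y → i ≡ x ℤ.- a → j ≡ y ℤ.- b → 0ℤ ℤ.≤ i → i ℤ.< + w → 0ℤ ℤ.≤ j → j ℤ.< + h →
          InBox w h (a , b) (x , y)
offsets {a = a} {b} {+ i} {+ j} x y u v _ (ℤ.+<+ i<k) _ (ℤ.+<+ j<k) =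
  i , j , i<k , j<k ,
  cong₂ _,_ (trans (sym (x+[y-x] a x)) (cong (λ z → a ℤ.+ z) (sym u)))
            (trans (sym (x+[y-x] b y)) (cong (λ z → b ℤ.+ z) (sym v)))

inBox? : ∀ w h p c → Dec (InBox w h p c)
inBox? w h (a , b) (x , y)
  with 0ℤ ℤ.≤? (x ℤ.- a) | (x ℤ.- a) ℤ.<? + w | 0ℤ ℤ.≤? (y ℤ.- b) | (y ℤ.- b) ℤ.<? + h
... | yes p | yes q | yes r | yes s = yes (offsets x y refl refl p q r s)

... | no n  | _     | _     | _    = no λ { (i , j , i<k , j<k , refl) →
  n (subst (0ℤ ℤ.≤_) (sym (x+i-x a (+ i))) (ℤ.+≤+ z≤n)) }
... | yes _ | no n  | _     | _    = no λ { (i , j , i<k , j<k , refl) →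
  n (subst (ℤ._< + w) (sym (x+i-x a (+ i))) (ℤ.+<+ i<k)) }
... | yes _ | yes _ | no n  | _    = no λ { (i , j , i<k , j<k , refl) →
  n (subst (0ℤ ℤ.≤_) (sym (x+i-x b (+ j))) (ℤ.+≤+ z≤n)) }
... | yes _ | yes _ | yes _ | no n = no λ { (i , j , i<k , j<k , refl) →
  n (subst (ℤ._< + h) (sym (x+i-x b (+ j))) (ℤ.+<+ j<k)) }

inBlock? : ∀ k p c → Dec (InBlock k p c)
inBlock? k = inBox? k k

inRect? : ∀ k r c → Dec (InRect k r c)
inRect? k r c = inBox? (width k r) (height k r) (Rect.corner r) c

-- Opaque, because conversion checking of iterated rotations explodes if they unfold.
opaque
  rot : ℕ → Cell → Cell → Cell
  rot = rotate

  -- The complement `i'` of `i` is an argument, which keeps truncated and integer subtraction out of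
  -- all later uses.
  rot-in : ∀ k p {i i' j} → i ℕ.+ i' ≡ k ∸ 1 → i < k → j < k →
              rot k p (p ⊹ (i , j)) ≡ p ⊹ (j , i')
  rot-in k (a , b) {i} {i'} {j} e i<k j<k
    rewrite x+i-x a (+ i) | x+i-x b (+ j)
          | dec-true (i ℕ.<? k) i<k | dec-true (j ℕ.<? k) j<k
          | sym e | ℤₚ.pos-+ i i' | x+i-x (+ i) (+ i') = refl

  rot-out : ∀ k p c → ¬ InBlock k p c → rot k p c ≡ c
  rot-out k (a , b) (x , y) ¬in
    with 0ℤ ℤ.≤? (x ℤ.- a) | (x ℤ.- a) ℤ.<? + k | 0ℤ ℤ.≤? (y ℤ.- b) | (y ℤ.- b) ℤ.<? + k
  ... | yes p | yes q | yes r | yes s = ⊥-elim (¬in (offsets x y refl refl p q r s))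

  ... | no _  | _     | _     | _    = refl
  ... | yes _ | no _  | _     | _    = refl
  ... | yes _ | yes _ | no _  | _    = refl
  ... | yes _ | yes _ | yes _ | no _ = refl

-- `move` and `run` repeat `actMove` and `act` over the opaque `rot`; `run≡act` leads back to the
-- statement.
move : ℕ → Move → Cell → Cell
move k (p , true)  c = rot k p c
move k (p , false) c = rot k p (rot k p (rot k p c))

run : ℕ → List Move → Cell → Cell
run k []      c = c
run k (m ∷ w) c = move k m (run k w c)

opaque
  unfolding rot
  move≡actMove : ∀ k m c → move k m c ≡ actMove k m c
  move≡actMove k (p , true)  c = refl
  move≡actMove k (p , false) c = refl

run≡act : ∀ k w c → run k w c ≡ act k w c
run≡act k []      c = refl
run≡act k (m ∷ w) c = trans (cong (move k m) (run≡act k w c)) (move≡actMove k m (act k w c))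

complement : ∀ {i k} → i < k → ∃[ i' ] (i ℕ.+ i' ≡ k ∸ 1 × i' < k)
complement {i} {suc k} (s≤s i≤k) = k ∸ i , ℕₚ.m+[n∸m]≡n i≤k , s≤s (ℕₚ.m∸n≤m k i)

rot⁴ : ∀ k p c → rot k p (rot k p (rot k p (rot k p c))) ≡ c
rot⁴ k p c with inBlock? k p c
... | no c∉ rewrite rot-out k p c c∉ | rot-out k p c c∉ | rot-out k p c c∉ = rot-out k p c c∉
... | yes (i , j , i<k , j<k , refl) with complement i<k | complement j<k
... | i' , ei , i'<k | j' , ej , j'<k
  rewrite rot-in k p ei i<k j<k | rot-in k p ej j<k i'<k
        | rot-in k p (trans (ℕₚ.+-comm i' i) ei) i'<k j'<k
        | rot-in k p (trans (ℕₚ.+-comm j' j) ej) j'<k i<k = refl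

rot³ : ∀ k p {i j i' j'} → i ℕ.+ i' ≡ k ∸ 1 → j ℕ.+ j' ≡ k ∸ 1 → i < k → j < k → i' < k → j' < k →
       rot k p (rot k p (rot k p (p ⊹ (i , j)))) ≡ p ⊹ (j' , i)
rot³ k p {i} {j} {i'} {j'} ei ej i<k j<k i'<k j'<k =
  trans (cong (λ d → rot k p (rot k p d)) (rot-in k p ei i<k j<k))
  (trans (cong (rot k p) (rot-in k p ej j<k i'<k))
  (rot-in k p (trans (ℕₚ.+-comm i' i) ei) i'<k j'<k))

move-inverse : ∀ k p b c → move k (p , not b) (move k (p , b) c) ≡ c
move-inverse k p true  c = rot⁴ k p c
move-inverse k p false c = rot⁴ k p c

run-++ : ∀ k w v c → run k (w ++ v) c ≡ run k w (run k v c)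
run-++ k []      v c = refl
run-++ k (m ∷ w) v c = cong (move k m) (run-++ k w v c)

flipMove : Move → Move
flipMove (p , b) = p , not b

inverse : List Move → List Move
inverse []      = []
inverse (m ∷ w) = inverse w ++ (flipMove m ∷ [])

inverseˡ : ∀ k w c → run k (inverse w) (run k w c) ≡ c
inverseˡ k []      c = refl
inverseˡ k ((p , b) ∷ w) c = begin
  run k (inverse w ++ _) (move k (p , b) (run k w c))
    ≡⟨ run-++ k (inverse w) _ _ ⟩
  run k (inverse w) (move k (p , not b) (move k (p , b) (run k w c)))
    ≡⟨ cong (run k (inverse w)) (move-inverse k p b _) ⟩
  run k (inverse w) (run k w c)
    ≡⟨ inverseˡ k w c ⟩
  c ∎
  where open ≡-Reasoning

run-injective : ∀ k w {c d} → run k w c ≡ run k w d → c ≡ d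
run-injective k w {c} {d} e =
  trans (sym (inverseˡ k w c)) (trans (cong (run k (inverse w)) e) (inverseˡ k w d))

inverseʳ : ∀ k w c → run k w (run k (inverse w) c) ≡ c
inverseʳ k []      c = refl
inverseʳ k ((p , b) ∷ w) c = begin
  move k (p , b) (run k w (run k (inverse w ++ _) c))
    ≡⟨ cong (move k (p , b) ∘ run k w) (run-++ k (inverse w) _ c) ⟩
  move k (p , b) (run k w (run k (inverse w) (move k (p , not b) c)))
    ≡⟨ cong (move k (p , b)) (inverseʳ k w _) ⟩
  move k (p , b) (move k (p , not b) c)
    ≡⟨ cong (λ b' → move k (p , b') (move k (p , not b) c)) (not-involutive b) ⟨
  move k (p , not (not b)) (move k (p , not b) c)
    ≡⟨ move-inverse k p (not b) c ⟩
  c ∎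
  where open ≡-Reasoning

-- An arbitrary set `F` of cells takes the place of a figure, so that a word found in one rectangle
-- can be used in every figure containing it. For `F = InFig k rs` this is `MoveIn k rs` by
-- computation.
MoveOk : ℕ → (Cell → Set) → Move → Set
MoveOk k F (p , _) = ∀ i j → i < k → j < k → F (p ⊹ (i , j))

Ok : ℕ → (Cell → Set) → List Move → Set
Ok k F = All (MoveOk k F)

Ok-inverse : ∀ {k F} w → Ok k F w → Ok k F (inverse w)
Ok-inverse []            []       = []
Ok-inverse {k} {F} (m ∷ w) (o ∷ os) = Allₚ.++⁺ (Ok-inverse {k} {F} w os) (o ∷ [])

Ok-mono : ∀ {k F F'} → (∀ c → F c → F' c) → ∀ {w} → Ok k F w → Ok k F' w
Ok-mono f = All.map (λ {m} o i j i<k j<k → f (proj₁ m ⊹ (i , j)) (o i j i<k j<k))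

move-fixes : ∀ k p b c → rot k p c ≡ c → move k (p , b) c ≡ c
move-fixes k p true  c eq = eq
move-fixes k p false c eq rewrite eq | eq = eq

run-fixes : ∀ k w c → All (λ m → ¬ InBlock k (proj₁ m) c) w → run k w c ≡ c
run-fixes k []            c []       = refl
run-fixes k ((p , b) ∷ w) c (n ∷ ns) =
  trans (cong (move k (p , b)) (run-fixes k w c ns)) (move-fixes k p b c (rot-out k p c n))

run-outside : ∀ k F w c → Ok k F w → ¬ F c → run k w c ≡ c
run-outside k F w c ok ¬Fc = run-fixes k w c (All.map (λ {m} → out m) ok)
  where
  out : ∀ m → MoveOk k F m → ¬ InBlock k (proj₁ m) c
  out m o (i , j , i<k , j<k , refl) = ¬Fc (o i j i<k j<k)

-- The motions of the plane used to bring a rectangle to standard position: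
-- translations, possibly preceded by the reflection in the diagonal, which
-- turns clockwise rotations into counter-clockwise ones.
Frame : Set
Frame = Cell × Bool

reflect : Bool → Cell → Cell
reflect true  c = c
reflect false c = swap c

put : Frame → Cell → Cell
put (v , o) c = reflect o c ⊕ v

unput : Frame → Cell → Cell
unput ((u , v) , o) (x , y) = reflect o (x ℤ.- u , y ℤ.- v)

reflectBool : Bool → Bool → Bool
reflectBool true  b = b
reflectBool false b = not b

putMove : Frame → Move → Move
putMove f (p , b) = put f p , reflectBool (proj₂ f) b

unput-put : ∀ f c → unput f (put f c) ≡ c
unput-put ((u , v) , true)  (x , y) = cong₂ _,_
  (trans (cong (ℤ._- u) (ℤₚ.+-comm x u)) (x+i-x u x)) (trans (cong (ℤ._- v) (ℤₚ.+-comm y v)) (x+i-x v y))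
unput-put ((u , v) , false) (x , y) = cong₂ _,_
  (trans (cong (ℤ._- v) (ℤₚ.+-comm x v)) (x+i-x v x)) (trans (cong (ℤ._- u) (ℤₚ.+-comm y u)) (x+i-x u y))

put-unput : ∀ f c → put f (unput f c) ≡ c
put-unput ((u , v) , true)  (x , y) = cong₂ _,_
  (trans (ℤₚ.+-comm (x ℤ.- u) u) (x+[y-x] u x)) (trans (ℤₚ.+-comm (y ℤ.- v) v) (x+[y-x] v y))
put-unput ((u , v) , false) (x , y) = cong₂ _,_
  (trans (ℤₚ.+-comm (x ℤ.- u) u) (x+[y-x] u x)) (trans (ℤₚ.+-comm (y ℤ.- v) v) (x+[y-x] v y))

put-injective : ∀ f {c d} → put f c ≡ put f d → c ≡ d
put-injective f {c} {d} e = trans (sym (unput-put f c)) (trans (cong (unput f) e) (unput-put f d))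

+-swapʳ : ∀ x y z → (x ℤ.+ y) ℤ.+ z ≡ (x ℤ.+ z) ℤ.+ y
+-swapʳ x y z = trans (ℤₚ.+-assoc x y z) (trans (cong (λ z → x ℤ.+ z) (ℤₚ.+-comm y z)) (sym (ℤₚ.+-assoc x z y)))

reflectℕ : Bool → ℕ × ℕ → ℕ × ℕ
reflectℕ true  ij = ij
reflectℕ false ij = swap ij

put-⊹ : ∀ f p ij → put f (p ⊹ ij) ≡ put f p ⊹ reflectℕ (proj₂ f) ij
put-⊹ ((u , v) , true)  (a , b) (i , j) = cong₂ _,_ (+-swapʳ a (+ i) u) (+-swapʳ b (+ j) v)
put-⊹ ((u , v) , false) (a , b) (i , j) = cong₂ _,_ (+-swapʳ b (+ j) u) (+-swapʳ a (+ i) v)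

InBlock-put : ∀ {k} f p c → InBlock k (put f p) (put f c) → InBlock k p c
InBlock-put (v , true)  p c (i , j , i<k , j<k , e) =
  i , j , i<k , j<k , put-injective (v , true) (trans e (sym (put-⊹ (v , true) p (i , j))))
InBlock-put (v , false) p c (i , j , i<k , j<k , e) =
  j , i , j<k , i<k , put-injective (v , false) (trans e (sym (put-⊹ (v , false) p (j , i))))

rot-put : ∀ k v p c → rot k (put (v , true) p) (put (v , true) c) ≡ put (v , true) (rot k p c)
rot-put k v p c with inBlock? k p c
... | no c∉ = trans (rot-out k (p ⊕ v) (c ⊕ v) (λ c∈ → c∉ (InBlock-put (v , true) p c c∈)))
                    (cong (_⊕ v) (sym (rot-out k p c c∉)))
... | yes (i , j , i<k , j<k , refl) with complement i<k
... | i' , ei , i'<k =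
  trans (cong (rot k (p ⊕ v)) (put-⊹ (v , true) p (i , j)))
  (trans (rot-in k (p ⊕ v) ei i<k j<k)
  (sym (trans (cong (_⊕ v) (rot-in k p ei i<k j<k)) (put-⊹ (v , true) p (j , i')))))

rot-reflect : ∀ k v p c → rot k (put (v , false) p) (put (v , false) c) ≡
                 put (v , false) (rot k p (rot k p (rot k p c)))
rot-reflect k v p c with inBlock? k p c
... | no c∉ = trans (rot-out k (swap p ⊕ v) (swap c ⊕ v) (λ c∈ → c∉ (InBlock-put (v , false) p c c∈)))
                    (cong (λ d → swap d ⊕ v) (sym (move-fixes k p false c (rot-out k p c c∉))))
... | yes (i , j , i<k , j<k , refl) with complement i<k | complement j<k
... | i' , ei , i'<k | j' , ej , j'<k =
  trans (cong (rot k (swap p ⊕ v)) (put-⊹ (v , false) p (i , j)))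
  (trans (rot-in k (swap p ⊕ v) ej j<k i<k)
  (sym (trans (cong (put (v , false)) (rot³ k p ei ej i<k j<k i'<k j'<k)) (put-⊹ (v , false) p (j' , i)))))

intertwine³ : ∀ {A B : Set} (ρ : B → B) (ρ' : A → A) (f : A → B) → (∀ c → ρ (f c) ≡ f (ρ' c)) →
              ∀ c → ρ (ρ (ρ (f c))) ≡ f (ρ' (ρ' (ρ' c)))
intertwine³ ρ ρ' f e c = trans (cong (λ d → ρ (ρ d)) (e c)) (trans (cong ρ (e (ρ' c))) (e (ρ' (ρ' c))))

-- A clockwise move becomes three turns in a reflected frame, and each of these is three turns in
-- the original one.
nineFold : ∀ {A : Set} (ρ : A → A) → (∀ c → ρ (ρ (ρ (ρ c))) ≡ c) →
           ∀ c → ρ (ρ (ρ (ρ (ρ (ρ (ρ (ρ (ρ c)))))))) ≡ ρ c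
nineFold ρ e c = trans (e _) (e (ρ c))

move-put : ∀ k f m c → move k (putMove f m) (put f c) ≡ put f (move k m c)
move-put k (v , true)  (p , true)  c = rot-put k v p c
move-put k (v , true)  (p , false) c =
  intertwine³ (rot k (put (v , true) p)) (rot k p) (put (v , true)) (rot-put k v p) c
move-put k (v , false) (p , true)  c =
  trans (intertwine³ (rot k (put (v , false) p)) (λ d → rot k p (rot k p (rot k p d)))
           (put (v , false)) (rot-reflect k v p) c)
        (cong (put (v , false)) (nineFold (rot k p) (rot⁴ k p) c))
move-put k (v , false) (p , false) c = rot-reflect k v p c

run-put : ∀ k f w c → run k (map (putMove f) w) (put f c) ≡ put f (run k w c)
run-put k f []      c = refl
run-put k f (m ∷ w) c =
  trans (cong (move k (putMove f m)) (run-put k f w c)) (move-put k f m (run k w c))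

Ok-put : ∀ {k F F'} f → (∀ c → F' c → F (put f c)) → ∀ {w} → Ok k F' w → Ok k F (map (putMove f) w)
Ok-put {k} {F} {F'} f sub ok = Allₚ.map⁺ (All.map (λ {m} → one {k} {F} {F'} f sub m) ok)
  where
  one : ∀ {k F F'} f → (∀ c → F' c → F (put f c)) → ∀ m → MoveOk k F' m → MoveOk k F (putMove f m)
  one {F = F} (v , true)  sub (p , b) o i j i<k j<k =
    subst F (put-⊹ (v , true) p (i , j)) (sub (p ⊹ (i , j)) (o i j i<k j<k))
  one {F = F} (v , false) sub (p , b) o i j i<k j<k =
    subst F (put-⊹ (v , false) p (j , i)) (sub (p ⊹ (j , i)) (o j i j<k i<k))

-- 3-cycles and linked cells

record ThreeCycle (k : ℕ) (F : Cell → Set) (p q r : Cell) : Set where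
  constructor threeCycle
  field
    word : List Move
    ok   : Ok k F word
    p≢q  : p ≢ q
    q≢r  : q ≢ r
    r≢p  : r ≢ p
    p↦q  : run k word p ≡ q
    q↦r  : run k word q ≡ r
    r↦p  : run k word r ≡ p
    fix  : ∀ c → c ≢ p → c ≢ q → c ≢ r → run k word c ≡ c

module _ {k : ℕ} {F : Cell → Set} where

  private
    C = ThreeCycle k F

  cycle-rotate : ∀ {p q r} → C p q r → C q r p
  cycle-rotate (threeCycle w ok a b c d e f g) =
    threeCycle w ok b c a e f d (λ x x≢q x≢r x≢p → g x x≢p x≢q x≢r)

  cycle-inverse : ∀ {p q r} → C p q r → C r q p
  cycle-inverse (threeCycle w ok a b c d e f g) =
    threeCycle (inverse w) (Ok-inverse {k} {F} w ok) (b ∘ sym) (a ∘ sym) (c ∘ sym)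
      (back e) (back d) (back f)
      (λ x x≢r x≢q x≢p → back (g x x≢p x≢q x≢r))
    where
    back : ∀ {x y} → run k w x ≡ y → run k (inverse w) y ≡ x
    back refl = inverseˡ k w _

  cycle-conj : ∀ v → Ok k F v → ∀ {p q r} → C p q r → C (run k v p) (run k v q) (run k v r)
  cycle-conj v okv (threeCycle w ok a b c d e f g) =
    threeCycle (v ++ w ++ inverse v) (Allₚ.++⁺ okv (Allₚ.++⁺ ok (Ok-inverse {k} {F} v okv)))
      (a ∘ run-injective k v) (b ∘ run-injective k v) (c ∘ run-injective k v)
      (step d) (step e) (step f)
      (λ x x≢p x≢q x≢r → trans (unfold x)
        (trans (cong (run k v) (g (run k (inverse v) x) (away x≢p) (away x≢q) (away x≢r)))
               (inverseʳ k v x)))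
    where
    unfold : ∀ x → run k (v ++ w ++ inverse v) x ≡ run k v (run k w (run k (inverse v) x))
    unfold x = trans (run-++ k v _ x) (cong (run k v) (run-++ k w _ x))
    step : ∀ {x y} → run k w x ≡ y → run k (v ++ w ++ inverse v) (run k v x) ≡ run k v y
    step {x} eq = trans (unfold _) (cong (run k v) (trans (cong (run k w) (inverseˡ k v x)) eq))
    away : ∀ {x y} → x ≢ run k v y → run k (inverse v) x ≢ y
    away ne refl = ne (sym (inverseʳ k v _))

  -- `supp` says that the supports of `g` and `h` meet at most in `p`. So `H` fixes `G p` and `G`
  -- fixes `H p`, and the commutator sends `p` to `G p`, to `H p`, to `p`. Any other cell moved by
  -- one of the two stays, on its way back and forth, in the part of that support which the other
  -- fixes.
  commutator-cycle : ∀ g h p → Ok k F g → Ok k F h →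
    (∀ c → c ≢ p → run k g c ≡ c ⊎ run k h c ≡ c) →
    run k g p ≢ p → run k h p ≢ p → C p (run k g p) (run k h p)
  commutator-cycle g h p okg okh supp gp≢p hp≢p =
    threeCycle (g ++ h ++ inverse g ++ inverse h)
      (Allₚ.++⁺ okg (Allₚ.++⁺ okh (Allₚ.++⁺ (Ok-inverse {k} {F} g okg) (Ok-inverse {k} {F} h okh))))
      (gp≢p ∘ sym) gp≢hp hp≢p p↦ gp↦ hp↦ fixed
    where
    G H G⁻ H⁻ : Cell → Cell
    G = run k g
    H = run k h
    G⁻ = run k (inverse g)
    H⁻ = run k (inverse h)
    unfold : ∀ x → run k (g ++ h ++ inverse g ++ inverse h) x ≡ G (H (G⁻ (H⁻ x)))
    unfold x = trans (run-++ k g _ x) (cong G (trans (run-++ k h _ x) (cong H (run-++ k (inverse g) _ x))))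
    chain : ∀ {x a b c d} → H⁻ x ≡ a → G⁻ a ≡ b → H b ≡ c → G c ≡ d →
            run k (g ++ h ++ inverse g ++ inverse h) x ≡ d
    chain {x} refl refl refl refl = unfold x
    G-back : ∀ {x y} → G x ≡ y → G⁻ y ≡ x
    G-back refl = inverseˡ k g _
    H-back : ∀ {x y} → H x ≡ y → H⁻ y ≡ x
    H-back refl = inverseˡ k h _
    gp≢hp : G p ≢ H p
    gp≢hp e with supp (G p) gp≢p
    ... | inj₁ e' = gp≢p (run-injective k g e')
    ... | inj₂ e' = gp≢p (trans e (run-injective k h (trans (cong H (sym e)) (trans e' e))))
    H-fixes : ∀ {c} → c ≢ p → G c ≢ c → H c ≡ c
    H-fixes c≢p Gc≢c with supp _ c≢p
    ... | inj₁ e = ⊥-elim (Gc≢c e)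
    ... | inj₂ e = e
    G-fixes : ∀ {c} → c ≢ p → H c ≢ c → G c ≡ c
    G-fixes c≢p Hc≢c with supp _ c≢p
    ... | inj₁ e = e
    ... | inj₂ e = ⊥-elim (Hc≢c e)
    H⁻p≢p : H⁻ p ≢ p
    H⁻p≢p e = hp≢p (trans (cong H (sym e)) (inverseʳ k h p))
    G⁻p≢p : G⁻ p ≢ p
    G⁻p≢p e = gp≢p (trans (cong G (sym e)) (inverseʳ k g p))
    GH⁻p : G (H⁻ p) ≡ H⁻ p
    GH⁻p = G-fixes H⁻p≢p (λ e → H⁻p≢p (trans (sym e) (inverseʳ k h p)))
    p↦ : run k (g ++ h ++ inverse g ++ inverse h) p ≡ G p
    p↦ = chain refl (G-back GH⁻p) (inverseʳ k h p) refl
    Hgp : H (G p) ≡ G p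
    Hgp = H-fixes gp≢p (λ e → gp≢p (run-injective k g e))
    Ghp : G (H p) ≡ H p
    Ghp = G-fixes hp≢p (λ e → hp≢p (run-injective k h e))
    gp↦ : run k (g ++ h ++ inverse g ++ inverse h) (G p) ≡ H p
    gp↦ = chain (H-back Hgp) (inverseˡ k g p) refl Ghp
    HG⁻p : H (G⁻ p) ≡ G⁻ p
    HG⁻p = H-fixes G⁻p≢p (λ e → G⁻p≢p (trans (sym e) (inverseʳ k g p)))
    hp↦ : run k (g ++ h ++ inverse g ++ inverse h) (H p) ≡ p
    hp↦ = chain (inverseˡ k h p) refl HG⁻p (inverseʳ k g p)
    fixed : ∀ c → c ≢ p → c ≢ G p → c ≢ H p → run k (g ++ h ++ inverse g ++ inverse h) c ≡ c
    fixed c c≢p c≢gp c≢hp with H c ≟ᶜ c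
    ... | no Hc≢c = chain refl (G-back (G-fixes H⁻c≢p H⁻c-moved)) (inverseʳ k h c) (G-fixes c≢p Hc≢c)
      where
      H⁻c≢p : H⁻ c ≢ p
      H⁻c≢p e = c≢hp (trans (sym (inverseʳ k h c)) (cong H e))
      H⁻c-moved : H (H⁻ c) ≢ H⁻ c
      H⁻c-moved e = Hc≢c (trans (cong H (trans (sym (inverseʳ k h c)) e)) (inverseʳ k h c))
    ... | yes Hc≡c with G c ≟ᶜ c
    ... | yes Gc≡c = chain (H-back Hc≡c) (G-back Gc≡c) Hc≡c Gc≡c
    ... | no Gc≢c  = chain (H-back Hc≡c) refl (H-fixes G⁻c≢p G⁻c-moved) (inverseʳ k g c)
      where
      G⁻c≢p : G⁻ c ≢ p
      G⁻c≢p e = c≢gp (trans (sym (inverseʳ k g c)) (cong G e))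
      G⁻c-moved : G (G⁻ c) ≢ G⁻ c
      G⁻c-moved e = Gc≢c (trans (cong G (trans (sym (inverseʳ k g c)) e)) (inverseʳ k g c))

  conj-by : ∀ {p q r p' q' r'} (z : C p q r) → C p' q' r' →
            C (run k (ThreeCycle.word z) p') (run k (ThreeCycle.word z) q') (run k (ThreeCycle.word z) r')
  conj-by z y = cycle-conj (ThreeCycle.word z) (ThreeCycle.ok z) y

  cycle-subst : ∀ {p q r p' q' r'} → p ≡ p' → q ≡ q' → r ≡ r' → C p q r → C p' q' r'
  cycle-subst refl refl refl z = z

Linked : ℕ → (Cell → Set) → Cell → Cell → Set
Linked k F p q = p ≡ q ⊎ ∃[ r ] ThreeCycle k F p q r

module _ {k : ℕ} {F : Cell → Set} where

  private
    C = ThreeCycle k F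
    _~_ = Linked k F

  linked-refl : ∀ {p} → p ~ p
  linked-refl = inj₁ refl

  linked-sym : ∀ {p q} → p ~ q → q ~ p
  linked-sym (inj₁ refl)    = inj₁ refl
  linked-sym (inj₂ (r , z)) = inj₂ (r , cycle-rotate (cycle-inverse z))

  -- Conjugating the cycle through `p` and `q` by the one through `q` and `s` keeps `p` and replaces
  -- `q` by `s`, unless `p` is the third point of the latter, whose inverse then links `p` and `s`
  -- directly.
  linked-trans : ∀ {p q s} → p ~ q → q ~ s → p ~ s
  linked-trans (inj₁ refl) y = y
  linked-trans x (inj₁ refl) = x
  linked-trans {p} {q} {s} (inj₂ (r , z)) (inj₂ (t , y)) with p ≟ᶜ s
  ... | yes refl = inj₁ refl
  ... | no p≢s with p ≟ᶜ t
  ... | yes refl = inj₂ (q , cycle-inverse y')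
    where
    y' : C q s p
    y' = y
  ... | no p≢t = inj₂ (_ , cycle-subst (ThreeCycle.fix y p (ThreeCycle.p≢q z) p≢s p≢t)
                             (ThreeCycle.p↦q y) refl (conj-by y z))

  linked-run : ∀ {p q} w → Ok k F w → p ~ q → run k w p ~ run k w q
  linked-run w ok (inj₁ refl)    = inj₁ refl
  linked-run w ok (inj₂ (r , z)) = inj₂ (_ , cycle-conj w ok z)

  -- The third points `r` and `s` of the two given cycles are uncontrolled and have to be removed by
  -- conjugation. If neither helps, `β` turns `α = (x y r)` into `γ = (x z r)`, and `γ` turns `α`
  -- into `(z y x)`, the inverse of the cycle wanted.
  linked⇒cycle : ∀ {x y z} → x ≢ y → y ≢ z → z ≢ x → x ~ y → y ~ z → C x y z
  linked⇒cycle x≢y y≢z z≢x (inj₁ e) _ = ⊥-elim (x≢y e)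
  linked⇒cycle x≢y y≢z z≢x _ (inj₁ e) = ⊥-elim (y≢z e)
  linked⇒cycle {x} {y} {z} x≢y y≢z z≢x (inj₂ (r , α)) (inj₂ (s , β)) with r ≟ᶜ z
  ... | yes refl = α
  ... | no r≢z with s ≟ᶜ x
  ... | yes refl = cycle-rotate (cycle-rotate β)
  ... | no s≢x with s ≟ᶜ r
  ... | yes refl = cycle-rotate (cycle-rotate (cycle-inverse (cycle-subst
                     (ThreeCycle.fix β x x≢y (z≢x ∘ sym) (s≢x ∘ sym))
                     (ThreeCycle.p↦q β) (ThreeCycle.r↦p β) (conj-by β α))))
  ... | no s≢r = cycle-inverse γ''
    where
    open ThreeCycle
    γ : C x z r
    γ = cycle-subst (fix β x x≢y (z≢x ∘ sym) (s≢x ∘ sym)) (p↦q β)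
          (fix β r (q≢r α ∘ sym) r≢z (s≢r ∘ sym)) (conj-by β α)
    γ'' : C z y x
    γ'' = cycle-subst (p↦q γ) (fix γ y (x≢y ∘ sym) y≢z (q≢r α)) (r↦p γ) (conj-by γ α)

linked-mono : ∀ {k F F'} → (∀ c → F c → F' c) → ∀ {p q} → Linked k F p q → Linked k F' p q
linked-mono sub (inj₁ e) = inj₁ e
linked-mono {k} {F} {F'} sub (inj₂ (r , threeCycle w ok a b c d e f g)) =
  inj₂ (r , threeCycle w (Ok-mono {k} {F} {F'} sub ok) a b c d e f g)

linked-put : ∀ {k F F'} f → (∀ c → F' c → F (put f c)) → ∀ {p q} → Linked k F' p q → Linked k F (put f p) (put f q)
linked-put f sub (inj₁ refl) = inj₁ refl
linked-put {k} {F} {F'} f sub (inj₂ (r , threeCycle w ok a b c d e g h)) =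
  inj₂ (put f r , threeCycle (map (putMove f) w) (Ok-put {k} {F} {F'} f sub ok)
    (a ∘ put-injective f) (b ∘ put-injective f) (c ∘ put-injective f)
    (trans (run-put k f w _) (cong (put f) d)) (trans (run-put k f w _) (cong (put f) e))
    (trans (run-put k f w _) (cong (put f) g)) fixed)
  where
  fixed : ∀ x → _ → _ → _ → run k (map (putMove f) w) x ≡ x
  fixed x x≢p x≢q x≢r = begin
    run k (map (putMove f) w) x                    ≡⟨ cong (run k (map (putMove f) w)) (put-unput f x) ⟨
    run k (map (putMove f) w) (put f (unput f x))  ≡⟨ run-put k f w _ ⟩
    put f (run k w (unput f x))                    ≡⟨ cong (put f) (h _ (away x≢p) (away x≢q) (away x≢r)) ⟩
    put f (unput f x)                              ≡⟨ put-unput f x ⟩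
    x                                              ∎
    where
    open ≡-Reasoning
    away : ∀ {y} → x ≢ put f y → unput f x ≢ y
    away ne refl = ne (sym (put-unput f x))

-- The rectangle at the origin

-- The tiles of the horizontal k × (k+1) rectangle at the origin.  Storing the
-- distances x, x', y, y' to all four sides makes both rotations free of arithmetic.
record Tile : Set where
  constructor tile
  field x x' y y' : ℕ

data Letter : Set where
  L L⁻ R R⁻ : Letter

step : Letter → Tile → Tile
step L  (tile x (suc x') y y') = tile y (suc y') x' x
step L⁻ (tile x (suc x') y y') = tile y' (suc y) x x'
step R  (tile (suc x) x' y y') = tile (suc y) y' x' x
step R⁻ (tile (suc x) x' y y') = tile (suc y') y x x'
step L  (tile x zero y y')     = tile x zero y y'
step L⁻ (tile x zero y y')     = tile x zero y y'
step R  (tile zero x' y y')    = tile zero x' y y'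
step R⁻ (tile zero x' y y')    = tile zero x' y y'

inv : Letter → Letter
inv L  = L⁻
inv L⁻ = L
inv R  = R⁻
inv R⁻ = R

step-inverse : ∀ l t → step (inv l) (step l t) ≡ t
step-inverse L  (tile x (suc x') y y') = refl
step-inverse L⁻ (tile x (suc x') y y') = refl
step-inverse R  (tile (suc x) x' y y') = refl
step-inverse R⁻ (tile (suc x) x' y y') = refl
step-inverse L  (tile x zero y y')     = refl
step-inverse L⁻ (tile x zero y y')     = refl
step-inverse R  (tile zero x' y y')    = refl
step-inverse R⁻ (tile zero x' y y')    = refl

-- With width `k + 1` and height `k`, opposite distances add up to `k` horizontally and to `k - 1`
-- vertically.
Valid : ℕ → Tile → Set
Valid k (tile x x' y y') = x ℕ.+ x' ≡ k × y ℕ.+ suc y' ≡ k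

step-valid : ∀ {k} l t → Valid k t → Valid k (step l t)
step-valid L  (tile x (suc x') y y') (e , f) = f , trans (ℕₚ.+-suc x' x) (trans (ℕₚ.+-comm (suc x') x) e)
step-valid L⁻ (tile x (suc x') y y') (e , f) = trans (ℕₚ.+-suc y' y) (trans (ℕₚ.+-comm (suc y') y) f) , e
step-valid R  (tile (suc x) x' y y') (e , f) = trans (sym (ℕₚ.+-suc y y')) f , trans (ℕₚ.+-comm x' (suc x)) e
step-valid R⁻ (tile (suc x) x' y y') (e , f) = trans (ℕₚ.+-comm (suc y') y) f , trans (ℕₚ.+-suc x x') e
step-valid L  (tile x zero y y')     v = v
step-valid L⁻ (tile x zero y y')     v = v
step-valid R  (tile zero x' y y')    v = v
step-valid R⁻ (tile zero x' y y')    v = v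

embed : Tile → Cell
embed (tile x x' y y') = + x , + y

letterMove : Letter → Move
letterMove L  = (0ℤ , 0ℤ) , true
letterMove L⁻ = (0ℤ , 0ℤ) , false
letterMove R  = (+ 1 , 0ℤ) , true
letterMove R⁻ = (+ 1 , 0ℤ) , false

x<k : ∀ {k} x x' → x ℕ.+ suc x' ≡ k → x < k
x<k x x' refl = ℕₚ.m<m+n x (s≤s z≤n)

+suc-pred : ∀ {k} x x' → x ℕ.+ suc x' ≡ k → x ℕ.+ x' ≡ k ∸ 1
+suc-pred {k} x x' e = cong (_∸ 1) (trans (sym (ℕₚ.+-suc x x')) e)

private
  embed-L : ∀ {k} t → Valid k t → move k (letterMove L) (embed t) ≡ embed (step L t)
  embed-L {k} (tile x (suc x') y y') (e , f) =
    rot-in k (0ℤ , 0ℤ) {x} {x'} {y} (+suc-pred x x' e) (x<k x x' e) (x<k y y' f)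
  embed-L {k} (tile x zero y y') (e , f) = rot-out k _ _
    λ { (i , j , i<k , j<k , eq) → ℕₚ.<-irrefl
          (trans (sym (ℤₚ.+-injective (cong proj₁ eq))) (trans (sym (ℕₚ.+-identityʳ x)) e)) i<k }

  embed-R : ∀ {k} t → Valid k t → move k (letterMove R) (embed t) ≡ embed (step R t)
  embed-R {k} (tile (suc x) x' y y') (e , f) =
    rot-in k (+ 1 , 0ℤ) {x} {x'} {y} (cong (_∸ 1) e)
      (x<k x x' (trans (ℕₚ.+-suc x x') e)) (x<k y y' f)
  embed-R {k} (tile zero x' y y') (e , f) = rot-out k _ _
    λ { (i , j , i<k , j<k , eq) → case ℤₚ.+-injective (cong proj₁ eq) of λ () }

  embed-undo : ∀ {k} p l t → move k (p , true) (embed (step (inv l) t)) ≡ embed (step l (step (inv l) t)) →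
               step l (step (inv l) t) ≡ t → move k (p , false) (embed t) ≡ embed (step (inv l) t)
  embed-undo {k} p l t e f =
    trans (cong (move k (p , false)) (sym (trans e (cong embed f)))) (move-inverse k p true _)

embed-step : ∀ {k} l t → Valid k t → move k (letterMove l) (embed t) ≡ embed (step l t)
embed-step L  t v = embed-L t v
embed-step R  t v = embed-R t v
embed-step L⁻ t v = embed-undo _ L t (embed-L (step L⁻ t) (step-valid L⁻ t v)) (step-inverse L⁻ t)
embed-step R⁻ t v = embed-undo _ R t (embed-R (step R⁻ t) (step-valid R⁻ t v)) (step-inverse R⁻ t)

steps : List Letter → Tile → Tile
steps []      t = t
steps (l ∷ w) t = step l (steps w t)

steps-valid : ∀ {k} w t → Valid k t → Valid k (steps w t)
steps-valid []      t v = v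
steps-valid (l ∷ w) t v = step-valid l _ (steps-valid w t v)

letters : List Letter → List Move
letters = map letterMove

embed-steps : ∀ {k} w t → Valid k t → run k (letters w) (embed t) ≡ embed (steps w t)
embed-steps     []      t v = refl
embed-steps {k} (l ∷ w) t v =
  trans (cong (move k (letterMove l)) (embed-steps w t v)) (embed-step l _ (steps-valid w t v))

origin : Rect
origin = rect (0ℤ , 0ℤ) true

embed-in : ∀ {k} t → Valid k t → InRect k origin (embed t)
embed-in (tile x x' y y') (e , f) = x , y , s≤s (subst (x ℕ.≤_) e (ℕₚ.m≤m+n x x')) , x<k y y' f , refl

in-embed : ∀ {k c} → InRect k origin c → ∃[ t ] (Valid k t × embed t ≡ c)
in-embed {k} (i , j , s≤s i≤k , j<k , refl) with ℕₚ.m≤n⇒∃[o]m+o≡n i≤k | ℕₚ.m≤n⇒∃[o]m+o≡n j<k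
... | i' , ei | j' , ej = tile i i' j j' , (ei , trans (ℕₚ.+-suc j j') ej) , refl

embed-injective : ∀ {k} t u → Valid k t → Valid k u → embed t ≡ embed u → t ≡ u
embed-injective (tile x x' y y') (tile a a' b b') (e , f) (e' , f') eq
  with ℤₚ.+-injective (cong proj₁ eq) | ℤₚ.+-injective (cong proj₂ eq)
... | refl | refl with ℕₚ.+-cancelˡ-≡ x _ _ (trans e (sym e'))
                     | ℕₚ.suc-injective (ℕₚ.+-cancelˡ-≡ y _ _ (trans f (sym f')))
... | refl | refl = refl

letterMove-ok : ∀ {k} l → MoveOk k (InRect k origin) (letterMove l)
letterMove-ok L  i j i<k j<k = i , j , ℕₚ.m<n⇒m<1+n i<k , j<k , refl
letterMove-ok L⁻ i j i<k j<k = i , j , ℕₚ.m<n⇒m<1+n i<k , j<k , refl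
letterMove-ok R  i j i<k j<k = suc i , j , s≤s i<k , j<k , refl
letterMove-ok R⁻ i j i<k j<k = suc i , j , s≤s i<k , j<k , refl

letters-ok : ∀ {k} w → Ok k (InRect k origin) (letters w)
letters-ok []          = []
letters-ok {k} (l ∷ w) = letterMove-ok {k} l ∷ letters-ok {k} w

data Connected : Tile → Tile → Set where
  by    : ∀ l {t} → Connected t (step l t)
  done  : ∀ {t} → Connected t t
  undo  : ∀ {t u} → Connected t u → Connected u t
  _then_ : ∀ {t u v} → Connected t u → Connected u v → Connected t v

infixr 5 _then_

module _ {k : ℕ} {Q : Tile → Set} (closed : ∀ l t → Valid k t → Q t → Q (step l t)) where
  private
    along  : ∀ {t u} → Connected t u → Valid k t × Q t → Valid k u × Q u
    back   : ∀ {t u} → Connected t u → Valid k u × Q u → Valid k t × Q t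
    along (by l {t})  (v , q) = step-valid l t v , closed l t v q
    along done        vq      = vq
    along (undo c)    vq      = back c vq
    along (c then d)  vq      = along d (along c vq)
    back (by l {t})   (v , q) = subst (λ s → Valid k s × Q s) (step-inverse l t)
                                  (step-valid (inv l) _ v , closed (inv l) _ v q)
    back done         vq      = vq
    back (undo c)     vq      = along c vq
    back (c then d)   vq      = back c (back d vq)

  -- Closure under forward steps suffices for `undo` as well, because the inverse of a letter is a
  -- letter.
  along-connected : ∀ {t u} → Connected t u → Valid k t → Q t → Q u
  along-connected c v q = proj₂ (along c (v , q))

odd : ℕ → Bool
odd zero    = false
odd (suc n) = not (odd n)

odd-+ : ∀ m n → odd (m ℕ.+ n) ≡ odd m xor odd n
odd-+ zero    n = refl
odd-+ (suc m) n = trans (cong not (odd-+ m n)) (Boolₚ.not-distribˡ-xor (odd m) (odd n))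

tileColour : Tile → Bool
tileColour (tile x x' y y') = odd (x ℕ.+ y)

xor-cancel : ∀ {a b} → a xor b ≡ false → a ≡ b
xor-cancel {true}  {true}  _ = refl
xor-cancel {false} {false} _ = refl

odd-swap : ∀ {k} a a' → a ℕ.+ suc a' ≡ k → odd k ≡ true → odd a ≡ odd a'
odd-swap a a' refl o = xor-cancel {odd a} {odd a'} (trans (sym (odd-+ a a'))
  (Boolₚ.not-injective (trans (cong odd (sym (ℕₚ.+-suc a a'))) o)))

colour-step : ∀ {k} → odd k ≡ true → ∀ l t → Valid k t → tileColour (step l t) ≡ tileColour t
colour-step o L  (tile x (suc x') y y') (e , f) =
  trans (odd-+ y x') (trans (cong (odd y xor_) (sym (odd-swap x x' e o)))
    (trans (Boolₚ.xor-comm (odd y) (odd x)) (sym (odd-+ x y))))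
colour-step o L⁻ (tile x (suc x') y y') (e , f) =
  trans (odd-+ y' x) (trans (cong (_xor odd x) (sym (odd-swap y y' f o)))
    (trans (Boolₚ.xor-comm (odd y) (odd x)) (sym (odd-+ x y))))
colour-step o R  (tile (suc x) x' y y') (e , f) = cong not
  (trans (odd-+ y x') (trans (cong (odd y xor_) (sym (odd-swap x x' (trans (ℕₚ.+-suc x x') e) o)))
    (trans (Boolₚ.xor-comm (odd y) (odd x)) (sym (odd-+ x y)))))
colour-step o R⁻ (tile (suc x) x' y y') (e , f) = cong not
  (trans (odd-+ y' x) (trans (cong (_xor odd x) (sym (odd-swap y y' f o)))
    (trans (Boolₚ.xor-comm (odd y) (odd x)) (sym (odd-+ x y)))))
colour-step o L  (tile x zero y y')  v = refl
colour-step o L⁻ (tile x zero y y')  v = refl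
colour-step o R  (tile zero x' y y') v = refl
colour-step o R⁻ (tile zero x' y y') v = refl

-- Every tile can be moved to one of the two lowest tiles of the rightmost column.
module Transitivity (h : ℕ) where

  K k : ℕ
  K = suc h
  k = suc K

  end : Bool → Tile
  end false = tile k 0 0 K
  end true  = tile k 0 1 h

  to-right : ∀ x x' y y' → Valid k (tile x x' y y') →
             ∃[ a ] ∃[ a' ] (a ℕ.+ a' ≡ K × Connected (tile x x' y y') (tile k 0 a a'))
  to-right (suc x) x' (suc y) y' (e , f)
    with to-right x (suc x') y (suc y') (trans (ℕₚ.+-suc x x') e , trans (ℕₚ.+-suc y (suc y')) f)
  ... | a , a' , g , c = a , a' , g , (by R⁻ then by L then c)
  to-right (suc x) x' zero .K (e , refl) = x , x' , ℕₚ.suc-injective e , by R⁻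
  to-right zero .k (suc y) y' (refl , f) =
    suc y' , y , trans (ℕₚ.+-comm (suc y') y) (ℕₚ.suc-injective f) , (by L then by R)
  to-right zero .k zero .K (refl , refl) = 1 , h , refl , (by L then by L then by R)

  down : ∀ y y' → y ℕ.+ y' ≡ K → Connected (tile k 0 y y') (end (odd y))
  down zero .K refl = done
  down (suc zero) .h refl = done
  down (suc (suc y)) y' e =
    -- Applying `R`, `L`, `L`, `R` in this order raises a tile of the last column by two.
    undo (by R then by L then by L then by R)
    then subst (λ b → Connected (tile k 0 y (suc (suc y'))) (end b)) (sym (Boolₚ.not-involutive (odd y)))
           (down y (suc (suc y')) (trans (ℕₚ.+-suc y (suc y')) (trans (cong suc (ℕₚ.+-suc y y')) e)))

  to-end : ∀ t → Valid k t → ∃[ b ] Connected t (end b)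
  to-end t v with to-right (Tile.x t) (Tile.x' t) (Tile.y t) (Tile.y' t) v
  ... | y , y' , e , c = odd y , (c then down y y' e)

  -- The tile at height `h` of the last column descends in steps of two to `end (odd h)`, but
  -- another route takes it to height 1. For even `k` this joins the two ends.
  ends : Connected (end (odd h)) (end true)
  ends = undo (down h 1 (ℕₚ.+-comm h 1)) then by R then by L then by L then by L then by R

  -- For odd `k` the two ends differ in colour, and colour is invariant, so tiles of equal colour
  -- arrive at the same end. For even `k` the two ends are connected by `ends`.
  connected : ∀ t u → Valid k t → Valid k u → (odd k ≡ true → tileColour t ≡ tileColour u) → Connected t u
  connected t u v w same = go (to-end t v) (to-end u w) (odd h) refl
    where
    go : ∃[ b ] Connected t (end b) → ∃[ b ] Connected u (end b) → ∀ o → odd h ≡ o → Connected t u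
    go (b , c) (b' , d) true o = c then subst (λ b → Connected (end b) u) (sym b≡b') (undo d)
      where
      ok : odd k ≡ true
      ok = trans (Boolₚ.not-involutive (odd h)) o
      end-colour : ∀ b → tileColour (end b) ≡ not b
      end-colour false = trans (cong odd (ℕₚ.+-identityʳ k)) ok
      end-colour true  = trans (cong odd (ℕₚ.+-comm k 1)) (cong not ok)
      keeps : ∀ {t u} → Connected t u → Valid k t → tileColour t ≡ tileColour u
      keeps {t} c v = along-connected {Q = λ s → tileColour t ≡ tileColour s}
        (λ l s vs e → trans e (sym (colour-step ok l s vs))) c v refl
      b≡b' : b ≡ b'
      b≡b' = Boolₚ.not-injective (trans (sym (end-colour b)) (trans (sym (keeps c v))
               (trans (same ok) (trans (keeps d w) (end-colour b')))))
    go (b , c) (b' , d) false o = c then bridge b b' then undo d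
      where
      ends' : Connected (end false) (end true)
      ends' = subst (λ b → Connected (end b) (end true)) o ends
      bridge : ∀ b b' → Connected (end b) (end b')
      bridge false false = done
      bridge false true  = ends'
      bridge true  false = undo ends'
      bridge true  true  = done

-- Words in the two rotations, and 3-cycles in one rectangle for k ≥ 5

invs : List Letter → List Letter
invs []      = []
invs (l ∷ w) = invs w ++ (inv l ∷ [])

steps-++ : ∀ w v t → steps (w ++ v) t ≡ steps w (steps v t)
steps-++ []      v t = refl
steps-++ (l ∷ w) v t = cong (step l) (steps-++ w v t)

inv-inv : ∀ l → inv (inv l) ≡ l
inv-inv L  = refl
inv-inv L⁻ = refl
inv-inv R  = refl
inv-inv R⁻ = refl

steps-invs : ∀ w t → steps w (steps (invs w) t) ≡ t
steps-invs []      t = refl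
steps-invs (l ∷ w) t = begin
  step l (steps w (steps (invs w ++ (inv l ∷ [])) t))  ≡⟨ cong (step l ∘ steps w) (steps-++ (invs w) _ t) ⟩
  step l (steps w (steps (invs w) (step (inv l) t)))   ≡⟨ cong (step l) (steps-invs w _) ⟩
  step l (step (inv l) t)                              ≡⟨ cong (λ l' → step l' (step (inv l) t)) (inv-inv l) ⟨
  step (inv (inv l)) (step (inv l) t)                  ≡⟨ step-inverse (inv l) t ⟩
  t                                                    ∎
  where open ≡-Reasoning

invs-steps : ∀ w t → steps (invs w) (steps w t) ≡ t
invs-steps []      t = refl
invs-steps (l ∷ w) t = trans (steps-++ (invs w) _ _) (trans (cong (steps (invs w)) (step-inverse l _)) (invs-steps w t))

mirror : Tile → Tile
mirror (tile x x' y y') = tile x' x y y'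

-- Exchanging left and right exchanges the two blocks and also reverses the sense of rotation.
mirrorLetter : Letter → Letter
mirrorLetter L  = R⁻
mirrorLetter L⁻ = R
mirrorLetter R  = L⁻
mirrorLetter R⁻ = L

mirror-step : ∀ l t → mirror (step l t) ≡ step (mirrorLetter l) (mirror t)
mirror-step L  (tile x (suc x') y y') = refl
mirror-step L⁻ (tile x (suc x') y y') = refl
mirror-step R  (tile (suc x) x' y y') = refl
mirror-step R⁻ (tile (suc x) x' y y') = refl
mirror-step L  (tile x zero y y')     = refl
mirror-step L⁻ (tile x zero y y')     = refl
mirror-step R  (tile zero x' y y')    = refl
mirror-step R⁻ (tile zero x' y y')    = refl

mirror-steps : ∀ w t → mirror (steps w t) ≡ steps (map mirrorLetter w) (mirror t)
mirror-steps []      t = refl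
mirror-steps (l ∷ w) t = trans (mirror-step l _) (cong (step (mirrorLetter l)) (mirror-steps w t))

mirror-valid : ∀ {k} t → Valid k t → Valid k (mirror t)
mirror-valid (tile x x' y y') (e , f) = trans (ℕₚ.+-comm x' x) e , f

-- A 3-cycle arises as the commutator of g and its conjugate by V.
local-link : ∀ k g V p → Valid k p →
  (∀ t → Valid k t → steps V t ≡ p ⊎ steps g (steps V t) ≡ steps V t ⊎ steps g t ≡ t) →
  steps g p ≢ p → steps g (steps (invs V) p) ≢ steps (invs V) p →
  Linked k (InRect k origin) (embed p) (embed (steps g p))
local-link k g V p vp supports gp≢p gu≢u =
  inj₂ (_ , cycle-subst refl (embed-steps g p vp) refl
    (commutator-cycle (letters g) (letters h) (embed p) (letters-ok {k} g) (letters-ok {k} h) supp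
      (λ e → gp≢p (embed-injective _ _ (steps-valid g p vp) vp (trans (sym (embed-steps g p vp)) e)))
      (λ e → gu≢u (sym (pull (embed-injective _ _ (steps-valid h p vp) vp (trans (sym (embed-steps h p vp)) e)))))))
  where
  h : List Letter
  h = V ++ g ++ invs V
  h-steps : ∀ t → steps h t ≡ steps V (steps g (steps (invs V) t))
  h-steps t = trans (steps-++ V _ t) (cong (steps V) (steps-++ g _ t))
  pull : steps h p ≡ p → steps (invs V) p ≡ steps g (steps (invs V) p)
  pull e = trans (cong (steps (invs V)) (trans (sym e) (h-steps p))) (invs-steps V _)
  supp : ∀ c → c ≢ embed p → run k (letters g) c ≡ c ⊎ run k (letters h) c ≡ c
  supp c c≢p with inRect? k origin c
  ... | no c∉ = inj₁ (run-outside k (InRect k origin) (letters g) c (letters-ok {k} g) c∉)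
  ... | yes c∈ with in-embed c∈
  ... | s , vs , refl with supports (steps (invs V) s) (steps-valid (invs V) s vs)
  ... | inj₁ e = ⊥-elim (c≢p (cong embed (trans (sym (steps-invs V s)) e)))
  ... | inj₂ (inj₁ e) = inj₁ (trans (embed-steps g s vs)
          (cong embed (subst (λ u → steps g u ≡ u) (steps-invs V s) e)))
  ... | inj₂ (inj₂ e) = inj₂ (trans (embed-steps h s vs)
          (cong embed (trans (h-steps s) (trans (cong (steps V) e) (steps-invs V s)))))

module Large (m : ℕ) where

  k : ℕ
  k = 5 ℕ.+ m

  g V : List Letter
  g = L ∷ R ∷ L ∷ R ∷ []
  V = L⁻ ∷ R⁻ ∷ L ∷ R ∷ R ∷ L ∷ []

  corner : Tile
  corner = tile k 0 (4 ℕ.+ m) 0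

  -- g moves precisely the tiles of three sides of the rectangle, and its
  -- conjugate by V moves only one of these, the corner.
  supports : ∀ t → Valid k t → steps V t ≡ corner ⊎ steps g (steps V t) ≡ steps V t ⊎ steps g t ≡ t
  supports (tile x x' y y') (e , f) =
    cases x x' y y' e (trans (ℕₚ.+-comm x' x) e)
      (ℕₚ.suc-injective (trans (sym (ℕₚ.+-suc y y')) f))
      (ℕₚ.suc-injective (trans (cong suc (ℕₚ.+-comm y' y)) (trans (sym (ℕₚ.+-suc y y')) f)))
    where
    -- Each sum is given in both orders: addition computes on its left summand, so whichever
    -- coordinate has been matched as a numeral, one of the two equations solves for the opposite
    -- one. Once the outer layers are split off, both words compute on symbolic coordinates.
    cases : ∀ x x' y y' → x ℕ.+ x' ≡ k → x' ℕ.+ x ≡ k → y ℕ.+ y' ≡ 4 ℕ.+ m → y' ℕ.+ y ≡ 4 ℕ.+ m →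
            steps V (tile x x' y y') ≡ corner ⊎ steps g (steps V (tile x x' y y')) ≡ steps V (tile x x' y y') ⊎
            steps g (tile x x' y y') ≡ tile x x' y y'
    cases _ zero _ zero _ refl _ refl = inj₂ (inj₁ refl)
    cases _ zero y (suc y') _ refl _ _ = inj₂ (inj₁ refl)
    cases _ (suc zero) zero _ _ refl refl _ = inj₂ (inj₂ refl)
    cases zero _ zero _ refl _ refl _ = inj₂ (inj₁ refl)
    cases (suc x) (suc (suc x')) zero _ _ _ refl _ = inj₂ (inj₂ refl)
    cases zero _ (suc zero) _ refl _ refl _ = inj₁ refl
    cases (suc x) (suc x') (suc zero) _ _ _ refl _ = inj₂ (inj₂ refl)
    cases zero _ (suc (suc y)) y' refl _ _ _ = inj₂ (inj₁ refl)
    cases (suc x) (suc x') (suc (suc zero)) _ _ _ refl _ = inj₂ (inj₂ refl)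
    cases (suc zero) _ (suc (suc (suc y))) zero refl _ _ refl = inj₂ (inj₁ refl)
    cases (suc (suc x)) (suc x') (suc (suc (suc y))) zero _ _ _ refl = inj₂ (inj₁ refl)
    cases (suc x) (suc x') (suc (suc (suc y))) (suc y') _ _ _ _ = inj₂ (inj₂ refl)

  corner-valid : Valid k corner
  corner-valid = ℕₚ.+-identityʳ k , ℕₚ.+-comm (4 ℕ.+ m) 1

  link : Linked k (InRect k origin) (+ (5 ℕ.+ m) , + (4 ℕ.+ m)) (0ℤ , + (3 ℕ.+ m))
  link = local-link k g V corner corner-valid supports (λ ()) (λ ())

  mirror-link : Linked k (InRect k origin) (0ℤ , + (4 ℕ.+ m)) (+ (5 ℕ.+ m) , + (3 ℕ.+ m))
  mirror-link = local-link k (map mirrorLetter g) (map mirrorLetter V) (mirror corner)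
    (mirror-valid corner corner-valid) mirror-supports (λ ()) (λ ())
    where
    reflected : ∀ w t → mirror (steps w (mirror t)) ≡ steps (map mirrorLetter w) t
    reflected w t = mirror-steps w (mirror t)
    mirror-supports : ∀ t → Valid k t → _ ≡ mirror corner ⊎ _ ≡ steps (map mirrorLetter V) t ⊎ _ ≡ t
    mirror-supports t v with supports (mirror t) (mirror-valid t v)
    ... | inj₁ e = inj₁ (trans (sym (reflected V t)) (cong mirror e))
    ... | inj₂ (inj₁ e) = inj₂ (inj₁ (trans (cong (steps (map mirrorLetter g)) (sym (reflected V t)))
            (trans (sym (mirror-steps g _)) (trans (cong mirror e) (reflected V t)))))
    ... | inj₂ (inj₂ e) = inj₂ (inj₂ (trans (sym (reflected g t)) (cong mirror e)))

-- Linking the tiles of a figure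

%2-odd : ∀ n → n % 2 ≡ (Data.Bool.if odd n then 1 else 0)
%2-odd zero = refl
%2-odd (suc zero) = refl
%2-odd (suc (suc n)) = trans (cong (_% 2) (ℕₚ.+-comm 2 n)) (trans ([m+n]%n≡m%n n 2)
  (trans (%2-odd n) (cong (Data.Bool.if_then 1 else 0) (sym (Boolₚ.not-involutive (odd n))))))

even-test : ∀ n → (n % 2 ≡ᵇ 0) ≡ not (odd n)
even-test n rewrite %2-odd n with odd n
... | true  = refl
... | false = refl

odd⇒%2 : ∀ {n} → odd n ≡ true → n % 2 ≡ 1
odd⇒%2 {n} o rewrite %2-odd n | o = refl

even⇒%2 : ∀ {n} → odd n ≡ false → n % 2 ≡ 0
even⇒%2 {n} o rewrite %2-odd n | o = refl

%2⇒even : ∀ {n} → n % 2 ≡ 0 → odd n ≡ false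
%2⇒even {n} e with odd n in o
... | false = refl
... | true with trans (sym e) (odd⇒%2 {n} o)
... | ()

oddℤ : ℤ → Bool
oddℤ z = odd ∣ z ∣

oddℤ-suc : ∀ z → oddℤ (z ℤ.+ 1ℤ) ≡ not (oddℤ z)
oddℤ-suc (+ n)          = cong odd (ℕₚ.+-comm n 1)
oddℤ-suc -[1+ zero ]    = refl
oddℤ-suc -[1+ suc n ]   = sym (Boolₚ.not-involutive (not (odd n)))

oddℤ-+ : ∀ z n → oddℤ (z ℤ.+ + n) ≡ oddℤ z xor odd n
oddℤ-+ z zero    = trans (cong oddℤ (ℤₚ.+-identityʳ z)) (sym (Boolₚ.xor-identityʳ (oddℤ z)))
oddℤ-+ z (suc n) = begin
  oddℤ (z ℤ.+ + suc n)           ≡⟨ cong (λ i → oddℤ (z ℤ.+ i)) (ℤₚ.+-comm 1ℤ (+ n)) ⟩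
  oddℤ (z ℤ.+ (+ n ℤ.+ 1ℤ))      ≡⟨ cong oddℤ (ℤₚ.+-assoc z (+ n) 1ℤ) ⟨
  oddℤ (z ℤ.+ + n ℤ.+ 1ℤ)        ≡⟨ oddℤ-suc (z ℤ.+ + n) ⟩
  not (oddℤ (z ℤ.+ + n))         ≡⟨ cong not (oddℤ-+ z n) ⟩
  not (oddℤ z xor odd n)         ≡⟨ Boolₚ.not-distribʳ-xor (oddℤ z) (odd n) ⟩
  oddℤ z xor odd (suc n)         ∎
  where open ≡-Reasoning

black-odd : ∀ x y → black (x , y) ≡ not (oddℤ (x ℤ.+ y))
black-odd x y = even-test ∣ x ℤ.+ y ∣

black-⊹ : ∀ p i j → black (p ⊹ (i , j)) ≡ black p xor odd (i ℕ.+ j)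
black-⊹ (x , y) i j = begin
  black ((x , y) ⊹ (i , j))               ≡⟨ black-odd (x ℤ.+ + i) (y ℤ.+ + j) ⟩
  not (oddℤ (x ℤ.+ + i ℤ.+ (y ℤ.+ + j)))  ≡⟨ cong (not ∘ oddℤ) regroup ⟩
  not (oddℤ (x ℤ.+ y ℤ.+ + (i ℕ.+ j)))    ≡⟨ cong not (oddℤ-+ (x ℤ.+ y) (i ℕ.+ j)) ⟩
  not (oddℤ (x ℤ.+ y) xor odd (i ℕ.+ j))  ≡⟨ Boolₚ.not-distribˡ-xor (oddℤ (x ℤ.+ y)) _ ⟩
  not (oddℤ (x ℤ.+ y)) xor odd (i ℕ.+ j)  ≡⟨ cong (_xor odd (i ℕ.+ j)) (black-odd x y) ⟨
  black (x , y) xor odd (i ℕ.+ j)         ∎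
  where
  open ≡-Reasoning
  regroup : x ℤ.+ + i ℤ.+ (y ℤ.+ + j) ≡ x ℤ.+ y ℤ.+ + (i ℕ.+ j)
  regroup = trans (sym (ℤₚ.+-assoc (x ℤ.+ + i) y (+ j)))
              (trans (cong (ℤ._+ + j) (+-swapʳ x (+ i) y)) (ℤₚ.+-assoc (x ℤ.+ y) (+ i) (+ j)))

frameOf : Rect → Frame
frameOf (rect p o) = p , o

put-origin : ∀ p o → put (p , o) (0ℤ , 0ℤ) ≡ p
put-origin (x , y) true  = cong₂ _,_ (ℤₚ.+-identityˡ x) (ℤₚ.+-identityˡ y)
put-origin (x , y) false = cong₂ _,_ (ℤₚ.+-identityˡ x) (ℤₚ.+-identityˡ y)

put-embed : ∀ r i j → put (frameOf r) (+ i , + j) ≡ Rect.corner r ⊹ reflectℕ (Rect.horizontal r) (i , j)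
put-embed (rect p o) i j =
  trans (put-⊹ (p , o) (0ℤ , 0ℤ) (i , j)) (cong (_⊹ reflectℕ o (i , j)) (put-origin p o))

put-in : ∀ {k} r c → InRect k origin c → InRect k r (put (frameOf r) c)
put-in r@(rect p true)  _ (i , j , i<w , j<h , refl) = i , j , i<w , j<h , put-embed r i j
put-in r@(rect p false) _ (i , j , i<w , j<h , refl) = j , i , j<h , i<w , put-embed r i j

in-put : ∀ {k} r {c} → InRect k r c → ∃[ t ] (Valid k t × put (frameOf r) (embed t) ≡ c)
in-put {k} r@(rect p true) (i , j , i<w , j<h , refl) with in-embed {k} (i , j , i<w , j<h , refl)
... | t , v , e = t , v , trans (cong (put (p , true)) e) (put-embed r i j)
in-put {k} r@(rect p false) (i , j , i<w , j<h , refl) with in-embed {k} (j , i , j<h , i<w , refl)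
... | t , v , e = t , v , trans (cong (put (p , false)) e) (put-embed r j i)

black-tile : ∀ r t → black (put (frameOf r) (embed t)) ≡ black (Rect.corner r) xor tileColour t
black-tile r@(rect p true)  (tile x x' y y') = trans (cong black (put-embed r x y)) (black-⊹ p x y)
black-tile r@(rect p false) (tile x x' y y') =
  trans (cong black (put-embed r x y)) (trans (black-⊹ p y x) (cong (λ n → black p xor odd n) (ℕₚ.+-comm y x)))

SameColour : ℕ → Cell → Cell → Set
SameColour k c d = odd k ≡ true → black c ≡ black d

xor-cancelˡ : ∀ a {b c} → a xor b ≡ a xor c → b ≡ c
xor-cancelˡ true  e = Boolₚ.not-injective e
xor-cancelˡ false e = e

blockL blockR : Rect → Cell
blockL r = put (frameOf r) (0ℤ , 0ℤ)
blockR r = put (frameOf r) (+ 1 , 0ℤ)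

-- The class of p is closed under a rotation as soon as it contains a point
-- fixed by that rotation.
spread : ∀ h F r → let k = suc (suc h) in (∀ c → InRect k r c → F c) →
  ∀ p l ρ → InRect k r p → Linked k F p l → Linked k F p ρ →
  ¬ InBlock k (blockL r) l → ¬ InBlock k (blockR r) ρ →
  ∀ c → InRect k r c → SameColour k p c → Linked k F p c
spread h F r sub p l ρ p∈ p~l p~ρ l∉ ρ∉ c c∈ same with in-put r p∈ | in-put r c∈
... | t , tv , refl | u , uv , refl =
  along-connected {k} {Q} closed (Transitivity.connected h t u tv uv
    (λ o → xor-cancelˡ (black (Rect.corner r)) (trans (sym (black-tile r t)) (trans (same o) (black-tile r u)))))
    tv linked-refl
  where
  k = suc (suc h)
  f = frameOf r
  Q : Tile → Set
  Q s = Linked k F p (put f (embed s))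
  moveOk : ∀ x → MoveOk k F (putMove f (letterMove x))
  moveOk x with Ok-put {k} {F} {InRect k origin} f (λ c c∈ → sub (put f c) (put-in {k} r c c∈)) (letters-ok {k} (x ∷ []))
  ... | o ∷ [] = o
  -- With `m` the move: `m p` is linked to `m q = q`, hence to `p`, and `m p` is linked to the image
  -- of `t`.
  fixes : ∀ x q → Linked k F p q → move k (putMove f (letterMove x)) q ≡ q →
          ∀ t → Valid k t → Q t → Q (step x t)
  fixes x q p~q fix t v p~t =
    subst (Linked k F p) (trans (move-put k f (letterMove x) (embed t)) (cong (put f) (embed-step x t v)))
      (linked-trans p~q (linked-trans (subst (λ s → Linked k F s (m p)) fix (go (linked-sym p~q))) (go p~t)))
    where
    m = move k (putMove f (letterMove x))
    go : ∀ {a b} → Linked k F a b → Linked k F (m a) (m b)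
    go = linked-run (putMove f (letterMove x) ∷ []) (moveOk x ∷ [])
  closed : ∀ x t → Valid k t → Q t → Q (step x t)
  closed L  = fixes L  l p~l (move-fixes k (blockL r) (reflectBool (Rect.horizontal r) true) l (rot-out k (blockL r) l l∉))
  closed L⁻ = fixes L⁻ l p~l (move-fixes k (blockL r) (reflectBool (Rect.horizontal r) false) l (rot-out k (blockL r) l l∉))
  closed R  = fixes R  ρ p~ρ (move-fixes k (blockR r) (reflectBool (Rect.horizontal r) true) ρ (rot-out k (blockR r) ρ ρ∉))
  closed R⁻ = fixes R⁻ ρ p~ρ (move-fixes k (blockR r) (reflectBool (Rect.horizontal r) false) ρ (rot-out k (blockR r) ρ ρ∉))

-- An interval of `k` consecutive integers cannot contain both `x` and `x + k`; comparing `a` with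
-- `x` tells which one it misses.
side-outside : ∀ k a x → (∀ i → i < k → x ≢ a ℤ.+ + i) ⊎ (∀ i → i < k → x ℤ.+ + k ≢ a ℤ.+ + i)
side-outside k a x with a ℤ.≤? x
... | no a≰x  = inj₁ λ { i i<k refl → a≰x (ℤₚ.i≤i+j a (+ i)) }
... | yes a≤x = inj₂ λ i i<k e → ℤₚ.<-irrefl (sym e)
                  (ℤₚ.+-mono-≤-< a≤x (ℤ.+<+ i<k))

pick-parity : ∀ a b → ∃[ j ] (j < 2 × a xor odd j ≡ b)
pick-parity false false = 0 , s≤s z≤n , refl
pick-parity false true  = 1 , s≤s (s≤s z≤n) , refl
pick-parity true  false = 1 , s≤s (s≤s z≤n) , refl
pick-parity true  true  = 0 , s≤s z≤n , refl

colour-in-column : ∀ p i b → ∃[ j ] (j < 2 × black (p ⊹ (i , j)) ≡ b × black (p ⊹ (j , i)) ≡ b)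
colour-in-column p i b with pick-parity (black p xor odd i) b
... | j , j<2 , e = j , j<2 , trans (black-⊹ p i j) e' ,
                    trans (black-⊹ p j i) (trans (cong (λ n → black p xor odd n) (ℕₚ.+-comm j i)) e')
  where
  e' = trans (cong (black p xor_) (odd-+ i j)) (trans (sym (Boolₚ.xor-assoc (black p) (odd i) (odd j))) e)

-- A rectangle is longer than a block.
outside-block : ∀ h r q b → let k = suc (suc h) in
  ∃[ c ] (InRect k r c × ¬ InBlock k q c × black c ≡ b)
outside-block h (rect p@(x , y) true) (a , b) col with side-outside (suc (suc h)) a x
... | inj₁ n with colour-in-column p 0 col
... | j , j<2 , e , _ = p ⊹ (0 , j) , (0 , j , s≤s z≤n , ℕₚ.≤-trans j<2 (s≤s (s≤s z≤n)) , refl) ,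
      (λ { (i , _ , i<k , _ , e') → n i i<k (trans (sym (ℤₚ.+-identityʳ x)) (cong proj₁ e')) }) , e
outside-block h (rect p@(x , y) true) (a , b) col | inj₂ n with colour-in-column p (suc (suc h)) col
... | j , j<2 , e , _ = p ⊹ (suc (suc h) , j) , (suc (suc h) , j , ℕₚ.≤-refl , ℕₚ.≤-trans j<2 (s≤s (s≤s z≤n)) , refl) ,
      (λ { (i , _ , i<k , _ , e') → n i i<k (cong proj₁ e') }) , e
outside-block h (rect p@(x , y) false) (a , b) col with side-outside (suc (suc h)) b y
... | inj₁ n with colour-in-column p 0 col
... | j , j<2 , _ , e = p ⊹ (j , 0) , (j , 0 , ℕₚ.≤-trans j<2 (s≤s (s≤s z≤n)) , s≤s z≤n , refl) ,
      (λ { (_ , i , _ , i<k , e') → n i i<k (trans (sym (ℤₚ.+-identityʳ y)) (cong proj₂ e')) }) , e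
outside-block h (rect p@(x , y) false) (a , b) col | inj₂ n with colour-in-column p (suc (suc h)) col
... | j , j<2 , _ , e = p ⊹ (j , suc (suc h)) , (j , suc (suc h) , ℕₚ.≤-trans j<2 (s≤s (s≤s z≤n)) , ℕₚ.≤-refl , refl) ,
      (λ { (_ , i , _ , i<k , e') → n i i<k (cong proj₂ e') }) , e

AllLinked : ℕ → (Cell → Set) → (Cell → Set) → Set
AllLinked k F S = ∀ c d → S c → S d → SameColour k c d → Linked k F c d

black-step : ∀ x y → black (x ℤ.+ 1ℤ , y) ≡ not (black (x , y)) × black (x , y ℤ.+ 1ℤ) ≡ not (black (x , y))
black-step x y =
  trans (cong black (sym (cong (x ℤ.+ 1ℤ ,_) (ℤₚ.+-identityʳ y)))) (trans (black-⊹ (x , y) 1 0) (xor-true _)) ,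
  trans (cong black (sym (cong (_, y ℤ.+ 1ℤ) (ℤₚ.+-identityʳ x)))) (trans (black-⊹ (x , y) 0 1) (xor-true _))
  where
  xor-true : ∀ b → b xor true ≡ not b
  xor-true true  = refl
  xor-true false = refl

adjacent-colours : ∀ c d → Adjacent c d → black d ≡ not (black c)
adjacent-colours (x , y) _ (inj₁ (refl , refl)) = proj₁ (black-step x y)
adjacent-colours _ (x , y) (inj₂ (inj₁ (refl , refl))) =
  trans (sym (Boolₚ.not-involutive _)) (cong not (sym (proj₁ (black-step x y))))
adjacent-colours (x , y) _ (inj₂ (inj₂ (inj₁ (refl , refl)))) = proj₂ (black-step x y)
adjacent-colours _ (x , y) (inj₂ (inj₂ (inj₂ (refl , refl)))) =
  trans (sym (Boolₚ.not-involutive _)) (cong not (sym (proj₂ (black-step x y))))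

-- For odd `k` the two common tiles are adjacent, so both colours occur among them. This is what the
-- stronger overlap condition provides.
overlap-colour : ∀ k r rs → Overlaps k r rs → ∀ b →
  ∃[ p ] (InRect k r p × InFig k rs p × (odd k ≡ true → black p ≡ b))
overlap-colour k r rs (ev , od) b with odd k in o
... | false = let c , c∈r , c∈rs = ev (even⇒%2 {k} o) in c , c∈r , c∈rs , λ ()
... | true with od (odd⇒%2 {k} o)
... | c , d , adj , c∈r , c∈rs , d∈r , d∈rs with black c Boolₚ.≟ b
... | yes e = c , c∈r , c∈rs , λ _ → e
... | no ne = d , d∈r , d∈rs , λ _ → trans (adjacent-colours c d adj)
                (trans (cong not (Boolₚ.¬-not ne)) (Boolₚ.not-involutive b))

-- Linkage passes from a figure containing a rectangle r₀ to a rectangle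
-- overlapping it, since r₀ sticks out of both blocks of the new rectangle.
grow : ∀ h F r rs r₀ → let k = suc (suc h) in (∀ c → InFig k (r ∷ rs) c → F c) →
  (∀ c → InRect k r₀ c → InFig k rs c) → Overlaps k r rs →
  AllLinked k F (InFig k rs) → AllLinked k F (InFig k (r ∷ rs))
grow h F r rs r₀ sub r₀⊆ ov linked c d c∈ d∈ same with overlap-colour (suc (suc h)) r rs ov (black c)
... | p , p∈r , p∈rs , pc =
  linked-trans (linked-sym (reach c c∈ pc)) (reach d d∈ (λ o → trans (pc o) (same o)))
  where
  k = suc (suc h)
  reach : ∀ c → InFig k (r ∷ rs) c → SameColour k p c → Linked k F p c
  reach c (there c∈rs) pc = linked p c p∈rs c∈rs pc
  reach c (here c∈r)   pc =
    let l , l∈ , l∉ , lc = outside-block h r₀ (blockL r) (black p)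
        ρ , ρ∈ , ρ∉ , ρc = outside-block h r₀ (blockR r) (black p)
    in spread h F r (λ c c∈ → sub c (here c∈)) p l ρ p∈r
         (linked p l p∈rs (r₀⊆ l l∈) (λ _ → sym lc)) (linked p ρ p∈rs (r₀⊆ ρ ρ∈) (λ _ → sym ρc))
         l∉ ρ∉ c c∈r pc

-- Since l and ρ lie outside the two blocks of r, spread applies to p.
record Seed (k : ℕ) (F : Cell → Set) (r : Rect) (b : Bool) : Set where
  field
    p l ρ : Cell
    p∈    : InRect k r p
    p~l   : Linked k F p l
    p~ρ   : Linked k F p ρ
    l∉    : ¬ InBlock k (blockL r) l
    ρ∉    : ¬ InBlock k (blockR r) ρ
    col   : odd k ≡ true → black p ≡ b

seeds-link : ∀ h F r → let k = suc (suc h) in (∀ c → InRect k r c → F c) →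
  (∀ b → Seed k F r b) → AllLinked k F (InRect k r)
seeds-link h F r sub seeds c d c∈ d∈ same =
  linked-trans (linked-sym (reach c c∈ col)) (reach d d∈ (λ o → trans (col o) (same o)))
  where
  open Seed (seeds (black c))
  reach : ∀ c → InRect (suc (suc h)) r c → SameColour (suc (suc h)) p c → Linked (suc (suc h)) F p c
  reach = spread h F r sub p l ρ p∈ p~l p~ρ l∉ ρ∉

oddℤ-+ℤ : ∀ z w → oddℤ (z ℤ.+ w) ≡ oddℤ z xor oddℤ w
oddℤ-+ℤ z (+ n)      = oddℤ-+ z n
oddℤ-+ℤ z -[1+ n ]   = begin
  oddℤ w                    ≡⟨ xor-back (oddℤ w) (odd (suc n)) ⟨
  (oddℤ w xor odd (suc n)) xor odd (suc n) ≡⟨ cong (_xor odd (suc n)) (oddℤ-+ w (suc n)) ⟨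
  oddℤ (w ℤ.+ + suc n) xor odd (suc n)     ≡⟨ cong (λ i → oddℤ i xor odd (suc n)) back ⟩
  oddℤ z xor odd (suc n)    ∎
  where
  open ≡-Reasoning
  w = z ℤ.+ -[1+ n ]
  xor-back : ∀ a b → (a xor b) xor b ≡ a
  xor-back a b = trans (Boolₚ.xor-assoc a b b) (trans (cong (a xor_) (Boolₚ.xor-same b)) (Boolₚ.xor-identityʳ a))
  back : w ℤ.+ + suc n ≡ z
  back = trans (ℤₚ.+-assoc z -[1+ n ] (+ suc n))
           (trans (cong (λ i → z ℤ.+ i) (ℤₚ.+-inverseˡ (+ suc n))) (ℤₚ.+-identityʳ z))

frameParity : Frame → Bool
frameParity ((u , v) , _) = oddℤ (u ℤ.+ v)

black-put : ∀ f c → black (put f c) ≡ black c xor frameParity f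
black-put f@((u , v) , o) c@(x , y) = trans (go o) (cong (_xor oddℤ (u ℤ.+ v)) (sym (black-odd x y)))
  where
  regroup : ∀ x y → x ℤ.+ u ℤ.+ (y ℤ.+ v) ≡ x ℤ.+ y ℤ.+ (u ℤ.+ v)
  regroup x y = trans (sym (ℤₚ.+-assoc (x ℤ.+ u) y v))
                  (trans (cong (ℤ._+ v) (+-swapʳ x u y)) (ℤₚ.+-assoc (x ℤ.+ y) u v))
  split : ∀ x y → not (oddℤ (x ℤ.+ u ℤ.+ (y ℤ.+ v))) ≡ not (oddℤ (x ℤ.+ y)) xor oddℤ (u ℤ.+ v)
  split x y = trans (cong not (trans (cong oddℤ (regroup x y)) (oddℤ-+ℤ (x ℤ.+ y) (u ℤ.+ v))))
                (Boolₚ.not-distribˡ-xor (oddℤ (x ℤ.+ y)) _)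
  go : ∀ o → black (put ((u , v) , o) c) ≡ not (oddℤ (x ℤ.+ y)) xor oddℤ (u ℤ.+ v)
  go true  = trans (black-odd (x ℤ.+ u) (y ℤ.+ v)) (split x y)
  go false = trans (black-odd (y ℤ.+ u) (x ℤ.+ v))
               (trans (split y x) (cong (λ z → not (oddℤ z) xor oddℤ (u ℤ.+ v)) (ℤₚ.+-comm y x)))

putRect : Frame → Rect → Rect
putRect f (rect q h) = rect (put f q) (reflectBool (proj₂ f) h)

InRect-put : ∀ {k} f r c → InRect k r c → InRect k (putRect f r) (put f c)
InRect-put f@(_ , true)  (rect q true)  _ (i , j , i<w , j<h , refl) = i , j , i<w , j<h , put-⊹ f q (i , j)
InRect-put f@(_ , true)  (rect q false) _ (i , j , i<w , j<h , refl) = i , j , i<w , j<h , put-⊹ f q (i , j)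
InRect-put f@(_ , false) (rect q true)  _ (i , j , i<w , j<h , refl) = j , i , j<h , i<w , put-⊹ f q (i , j)
InRect-put f@(_ , false) (rect q false) _ (i , j , i<w , j<h , refl) = j , i , j<h , i<w , put-⊹ f q (i , j)

InRect-unput : ∀ {k} f r c → InRect k (putRect f r) (put f c) → InRect k r c
InRect-unput f@(_ , true)  (rect q true)  c (i , j , i<w , j<h , e) =
  i , j , i<w , j<h , put-injective f (trans e (sym (put-⊹ f q (i , j))))
InRect-unput f@(_ , true)  (rect q false) c (i , j , i<w , j<h , e) =
  i , j , i<w , j<h , put-injective f (trans e (sym (put-⊹ f q (i , j))))
InRect-unput f@(_ , false) (rect q true)  c (i , j , i<w , j<h , e) =
  j , i , j<h , i<w , put-injective f (trans e (sym (put-⊹ f q (j , i))))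
InRect-unput f@(_ , false) (rect q false) c (i , j , i<w , j<h , e) =
  j , i , j<h , i<w , put-injective f (trans e (sym (put-⊹ f q (j , i))))

put-∘ : ∀ f q c → put (put f q , proj₂ f) c ≡ put f (put (q , true) c)
put-∘ ((u , v) , true)  (x , y) (a , b) = sym (cong₂ _,_ (ℤₚ.+-assoc a x u) (ℤₚ.+-assoc b y v))
put-∘ ((u , v) , false) (x , y) (a , b) = sym (cong₂ _,_ (ℤₚ.+-assoc b y u) (ℤₚ.+-assoc a x v))

seed-put : ∀ {k} F F' f q → (∀ c → F' c → F (put f c)) →
           (∀ b → Seed k F' (rect q true) b) → ∀ b → Seed k F (rect (put f q) (proj₂ f)) b
seed-put {k} F F' f q sub seeds b = record
  { p = put f p ; l = put f l ; ρ = put f ρ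
  ; p∈ = subst (λ o → InRect k (rect (put f q) o) (put f p)) (orientation (proj₂ f)) (InRect-put f (rect q true) p p∈)
  ; p~l = linked-put {k} {F} {F'} f sub p~l
  ; p~ρ = linked-put {k} {F} {F'} f sub p~ρ
  ; l∉ = λ e → l∉ (InBlock-put f _ l (subst (λ z → InBlock k z (put f l)) (put-∘ f q _) e))
  ; ρ∉ = λ e → ρ∉ (InBlock-put f _ ρ (subst (λ z → InBlock k z (put f ρ)) (put-∘ f q _) e))
  ; col = λ o → trans (black-put f p) (trans (cong (_xor frameParity f) (col o)) (cancel b (frameParity f))) }
  where
  -- The motion may exchange the two colours; this seed has colour `b` after it.
  open Seed (seeds (b xor frameParity f))
  orientation : ∀ o → reflectBool o true ≡ o
  orientation true  = refl
  orientation false = refl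
  cancel : ∀ a b → (a xor b) xor b ≡ a
  cancel a b = trans (Boolₚ.xor-assoc a b b) (trans (cong (a xor_) (Boolₚ.xor-same b)) (Boolₚ.xor-identityʳ a))

right-edge-outside : ∀ k j → ¬ InBlock k (0ℤ , 0ℤ) (+ k , j)
right-edge-outside k j (i , _ , i<k , _ , e) = ℕₚ.<-irrefl (sym (ℤₚ.+-injective (cong proj₁ e))) i<k

left-edge-outside : ∀ k j → ¬ InBlock k (+ 1 , 0ℤ) (0ℤ , j)
left-edge-outside k j (i , _ , i<k , _ , e) = case ℤₚ.+-injective (cong proj₁ e) of λ ()

-- For odd `k` the upper right corner has an odd coordinate sum `2 k - 1` and the upper left one the
-- even sum `k - 1`. A corner in one end column lies outside the block that misses this column, and
-- it is linked to a tile of the opposite end column, which the other block misses.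
large-seeds : ∀ m b → Seed (5 ℕ.+ m) (InRect (5 ℕ.+ m) origin) origin b
large-seeds m false = record
  { p = + (5 ℕ.+ m) , + (4 ℕ.+ m) ; l = _ ; ρ = _
  ; p∈ = embed-in corner corner-valid
  ; p~l = linked-refl ; p~ρ = link
  ; l∉ = right-edge-outside (5 ℕ.+ m) _ ; ρ∉ = left-edge-outside (5 ℕ.+ m) _
  ; col = λ o → trans (black-odd (+ (5 ℕ.+ m)) (+ (4 ℕ.+ m)))
            (cong not (trans (odd-+ (5 ℕ.+ m) (4 ℕ.+ m)) (split (odd (4 ℕ.+ m))))) }
  where
  open Large m
  split : ∀ b → not b xor b ≡ true
  split true  = refl
  split false = refl
large-seeds m true = record
  { p = 0ℤ , + (4 ℕ.+ m) ; l = _ ; ρ = _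
  ; p∈ = embed-in (mirror corner) (mirror-valid corner corner-valid)
  ; p~l = mirror-link ; p~ρ = linked-refl
  ; l∉ = right-edge-outside (5 ℕ.+ m) _ ; ρ∉ = left-edge-outside (5 ℕ.+ m) _
  ; col = λ o → trans (black-odd 0ℤ (+ (4 ℕ.+ m))) o }
  where open Large m

-- Verifying explicit 3-cycles

allBelow : ℕ → (ℕ → Bool) → Bool
allBelow zero    p = true
allBelow (suc n) p = p n ∧ allBelow n p

∧-true : ∀ {a b} → a ∧ b ≡ true → a ≡ true × b ≡ true
∧-true {true} {true} _ = refl , refl

allBelow-sound : ∀ {n p} → allBelow n p ≡ true → ∀ i → i < n → p i ≡ true
allBelow-sound {suc n} {p} e i (s≤s i≤n) with ∧-true {p n} e | ℕₚ.m≤n⇒m<n∨m≡n i≤n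
... | _ , es | inj₁ i<n  = allBelow-sound {n} {p} es i i<n
... | e₀ , _ | inj₂ refl = e₀

Point : Set
Point = ℕ × ℕ

_≟ᵖ_ : (c d : Point) → Dec (c ≡ d)
_≟ᵖ_ = ≡-dec ℕ._≟_ ℕ._≟_

ι : Point → Cell
ι (x , y) = + x , + y

ι-injective : ∀ {c d} → ι c ≡ ι d → c ≡ d
ι-injective e = cong₂ _,_ (ℤₚ.+-injective (cong proj₁ e)) (ℤₚ.+-injective (cong proj₂ e))

insideᵇ : ℕ → ℕ → Point → Point → Bool
insideᵇ w h (a , b) (x , y) = (a ℕ.≤ᵇ x) ∧ (x <ᵇ a ℕ.+ w) ∧ (b ℕ.≤ᵇ y) ∧ (y <ᵇ b ℕ.+ h)

rotℕ : ℕ → Point → Point → Point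
rotℕ k (a , b) (x , y) =
  if insideᵇ k k (a , b) (x , y) then (a ℕ.+ (y ∸ b) , b ℕ.+ (k ∸ 1 ∸ (x ∸ a))) else (x , y)

<+⇒∸< : ∀ {a x k} → a ℕ.≤ x → x < a ℕ.+ k → x ∸ a < k
<+⇒∸< {a} {x} {k} a≤x x<a+k =
  ℕₚ.+-cancelˡ-< a _ _ (subst (_< a ℕ.+ k) (sym (ℕₚ.m+[n∸m]≡n a≤x)) x<a+k)

≤-true : ∀ {a b} → a ℕ.≤ b → (a ℕ.≤ᵇ b) ≡ true
≤-true {a} {b} p with a ℕ.≤ᵇ b | ℕₚ.≤⇒≤ᵇ p
... | true | _ = refl

<-true : ∀ {a b} → a < b → (a <ᵇ b) ≡ true
<-true {a} {b} p with a <ᵇ b | ℕₚ.<⇒<ᵇ p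
... | true | _ = refl

true-≤ : ∀ {a b} → (a ℕ.≤ᵇ b) ≡ true → a ℕ.≤ b
true-≤ {a} {b} e = ℕₚ.≤ᵇ⇒≤ a b (subst T (sym e) tt)

true-< : ∀ {a b} → (a <ᵇ b) ≡ true → a < b
true-< {a} {b} e = ℕₚ.<ᵇ⇒< a b (subst T (sym e) tt)

insideᵇ-sound : ∀ w h p c → insideᵇ w h p c ≡ true →
  let (a , b) = p ; (x , y) = c in
  a ℕ.≤ x × x ∸ a < w × b ℕ.≤ y × y ∸ b < h
insideᵇ-sound w h (a , b) (x , y) e =
  let e₁ , e = ∧-true {a ℕ.≤ᵇ x} e
      e₂ , e = ∧-true {x <ᵇ a ℕ.+ w} e
      e₃ , e₄ = ∧-true {b ℕ.≤ᵇ y} e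
  in true-≤ e₁ , <+⇒∸< (true-≤ {a} {x} e₁) (true-< e₂) , true-≤ e₃ , <+⇒∸< (true-≤ {b} {y} e₃) (true-< e₄)

inside-box : ∀ w h p c → insideᵇ w h p c ≡ true → InBox w h (ι p) (ι c)
inside-box w h (a , b) (x , y) e with insideᵇ-sound w h (a , b) (x , y) e
... | a≤x , x< , b≤y , y< = x ∸ a , y ∸ b , x< , y< ,
  cong₂ (λ x y → + x , + y) (sym (ℕₚ.m+[n∸m]≡n a≤x)) (sym (ℕₚ.m+[n∸m]≡n b≤y))

insideᵇ-complete : ∀ w h p c → InBox w h (ι p) (ι c) → insideᵇ w h p c ≡ true
insideᵇ-complete w h (a , b) (x , y) (i , j , i<w , j<h , e)
  with ℤₚ.+-injective (cong proj₁ e) | ℤₚ.+-injective (cong proj₂ e)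
... | refl | refl
  rewrite ≤-true (ℕₚ.m≤m+n a i) | <-true (ℕₚ.+-monoʳ-< a i<w)
        | ≤-true (ℕₚ.m≤m+n b j) | <-true (ℕₚ.+-monoʳ-< b j<h) = refl

ι-rot : ∀ k p c → rot k (ι p) (ι c) ≡ ι (rotℕ k p c)
ι-rot k (a , b) (x , y) with insideᵇ k k (a , b) (x , y) in e
... | false = rot-out k _ _ λ c∈ → case trans (sym e) (insideᵇ-complete k k (a , b) (x , y) c∈) of λ ()
... | true with insideᵇ-sound k k (a , b) (x , y) e
... | a≤x , x< , b≤y , y< =
  trans (cong (rot k (+ a , + b)) (cong₂ (λ x y → + x , + y) (sym (ℕₚ.m+[n∸m]≡n a≤x)) (sym (ℕₚ.m+[n∸m]≡n b≤y))))
    (rot-in k (+ a , + b) (ℕₚ.m+[n∸m]≡n {x ∸ a} {k ∸ 1} (ℕₚ.<⇒≤pred x<)) x< y<)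

moveℕ : ℕ → Point × Bool → Point → Point
moveℕ k (p , true)  c = rotℕ k p c
moveℕ k (p , false) c = rotℕ k p (rotℕ k p (rotℕ k p c))

ι-move : ∀ k p b c → move k (ι p , b) (ι c) ≡ ι (moveℕ k (p , b) c)
ι-move k p true  c = ι-rot k p c
ι-move k p false c = trans (cong (λ d → rot k (ι p) (rot k (ι p) d)) (ι-rot k p c))
                       (trans (cong (rot k (ι p)) (ι-rot k p _)) (ι-rot k p _))

runℕ : ℕ → List (Point × Bool) → Point → Point
runℕ k []      c = c
runℕ k (m ∷ w) c = moveℕ k m (runℕ k w c)

ιMove : Point × Bool → Move
ιMove (p , b) = ι p , b

ι-run : ∀ k w c → run k (map ιMove w) (ι c) ≡ ι (runℕ k w c)
ι-run k []            c = refl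
ι-run k ((p , b) ∷ w) c = trans (cong (move k (ι p , b)) (ι-run k w c)) (ι-move k p b _)

-- A seed in the rectangle at (k , k) lying on the 3-cycle power · word, where
-- the decimal digits of code spell word: 1 and 2 turn the first block of that
-- rectangle clockwise and counter-clockwise, 3 and 4 its second block, and
-- 5 to 8 the blocks of the other rectangle of the entry.
record SeedCode : Set where
  constructor seed
  field pₓ pᵧ power code : ℕ

record Entry : Set where
  constructor entry
  field
    a b  : ℕ
    hor  : Bool
    s₀ s₁ : SeedCode

digits : ℕ → ℕ → List ℕ
digits zero       n = []
digits (suc fuel) n = if n ≡ᵇ 0 then [] else digits fuel (n / 10) ++ (n % 10 ∷ [])

repeat : {A : Set} → ℕ → List A → List A
repeat zero    w = []
repeat (suc n) w = w ++ repeat n w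

module Check (k : ℕ) where

  -- Placed at `(k , k)` so that every rectangle meeting it has natural coordinates, on which words
  -- evaluate quickly.
  home : Rect
  home = rect (+ k , + k) true

  other : Entry → Rect
  other (entry a b h _ _) = rect (+ a , + b) h

  Both : Entry → Cell → Set
  Both en c = InRect k home c ⊎ InRect k (other en) c

  second : Entry → Point
  second (entry a b true  _ _) = suc a , b
  second (entry a b false _ _) = a , suc b

  block : Entry → ℕ → Point × Bool
  block en 2 = (k , k) , false
  block en 3 = (suc k , k) , true
  block en 4 = (suc k , k) , false
  block en 5 = (Entry.a en , Entry.b en) , true
  block en 6 = (Entry.a en , Entry.b en) , false
  block en 7 = second en , true
  block en 8 = second en , false
  -- The default clause is the digit 1.
  block en _ = (k , k) , true

  lowerBlock : ∀ p h i j → i < k → j < k → InRect k (rect (ι p) h) (ι p ⊹ (i , j))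
  lowerBlock p true  i j i<k j<k = i , j , ℕₚ.m<n⇒m<1+n i<k , j<k , refl
  lowerBlock p false i j i<k j<k = i , j , i<k , ℕₚ.m<n⇒m<1+n j<k , refl

  rightBlock : ∀ a b i j → i < k → j < k → InRect k (rect (+ a , + b) true) (ι (suc a , b) ⊹ (i , j))
  rightBlock a b i j i<k j<k = suc i , j , s≤s i<k , j<k , cong (λ n → + n , + (b ℕ.+ j)) (sym (ℕₚ.+-suc a i))

  upperBlock : ∀ a b i j → i < k → j < k → InRect k (rect (+ a , + b) false) (ι (a , suc b) ⊹ (i , j))
  upperBlock a b i j i<k j<k = i , suc j , i<k , s≤s j<k , cong (λ n → + (a ℕ.+ i) , + n) (sym (ℕₚ.+-suc b j))

  secondBlock : ∀ en i j → i < k → j < k → InRect k (other en) (ι (second en) ⊹ (i , j))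
  secondBlock (entry a b true  _ _) = rightBlock a b
  secondBlock (entry a b false _ _) = upperBlock a b

  block-ok : ∀ en d → MoveOk k (Both en) (ιMove (block en d))
  block-ok en 0 i j i<k j<k = inj₁ (lowerBlock (k , k) true i j i<k j<k)
  block-ok en 1 i j i<k j<k = inj₁ (lowerBlock (k , k) true i j i<k j<k)
  block-ok en 2 i j i<k j<k = inj₁ (lowerBlock (k , k) true i j i<k j<k)
  block-ok en 3 i j i<k j<k = inj₁ (rightBlock k k i j i<k j<k)
  block-ok en 4 i j i<k j<k = inj₁ (rightBlock k k i j i<k j<k)
  block-ok (entry a b h _ _) 5 i j i<k j<k = inj₂ (lowerBlock (a , b) h i j i<k j<k)
  block-ok (entry a b h _ _) 6 i j i<k j<k = inj₂ (lowerBlock (a , b) h i j i<k j<k)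
  block-ok en 7 i j i<k j<k = inj₂ (secondBlock en i j i<k j<k)
  block-ok en 8 i j i<k j<k = inj₂ (secondBlock en i j i<k j<k)
  block-ok en (suc (suc (suc (suc (suc (suc (suc (suc (suc _))))))))) i j i<k j<k =
    inj₁ (lowerBlock (k , k) true i j i<k j<k)

  -- As `runℕ` composes from the right, the last digit acts first. The fuel 20 exceeds the length of
  -- every code in the tables.
  word : Entry → SeedCode → List (Point × Bool)
  word en (seed _ _ m code) = map (block en) (repeat m (digits 20 code))

  word-ok : ∀ en ds → Ok k (Both en) (map ιMove (map (block en) ds))
  word-ok en []       = []
  word-ok en (d ∷ ds) = block-ok en d ∷ word-ok en ds

  fixesBut : List (Point × Bool) → Point → Point → Point → Point → Bool
  fixesBut w p q r c = does (c ≟ᵖ p) ∨ does (c ≟ᵖ q) ∨ does (c ≟ᵖ r) ∨ does (runℕ k w c ≟ᵖ c)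

  allIn : Rect → (Point → Bool) → Point → Bool
  allIn rc t (a , b) = allBelow (width k rc) (λ i → allBelow (height k rc) (λ j → t (a ℕ.+ i , b ℕ.+ j)))

  outᵇ : Point → Point → Bool
  outᵇ p c = not (insideᵇ k k p c)

  -- It suffices to test the tiles of the two rectangles, since the word fixes everything else. Any
  -- of the three points of the cycle may serve as the point outside a block, because all of them
  -- are linked to `p`; the colour is tested for odd `k` only.
  checkSeed : Entry → Bool → SeedCode → Bool
  checkSeed en col s@(seed pₓ pᵧ _ _) =
    let w = word en s
        p = pₓ , pᵧ
        q = runℕ k w p
        r = runℕ k w q
    in does (runℕ k w r ≟ᵖ p) ∧ not (does (p ≟ᵖ q)) ∧ not (does (q ≟ᵖ r)) ∧ not (does (r ≟ᵖ p)) ∧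
       insideᵇ (suc k) k (k , k) p ∧
       (outᵇ (k , k) p ∨ outᵇ (k , k) q ∨ outᵇ (k , k) r) ∧
       (outᵇ (suc k , k) p ∨ outᵇ (suc k , k) q ∨ outᵇ (suc k , k) r) ∧
       (not (odd k) ∨ not (col xor black (ι p))) ∧
       allIn home (fixesBut w p q r) (k , k) ∧
       allIn (other en) (fixesBut w p q r) (Entry.a en , Entry.b en)

  ∨-true : ∀ {a b} → a ∨ b ≡ true → a ≡ true ⊎ b ≡ true
  ∨-true {true}  _ = inj₁ refl
  ∨-true {false} e = inj₂ e

  does-true : ∀ {P : Set} (d : Dec P) → does d ≡ true → P
  does-true (yes p) _ = p

  does-false : ∀ {P : Set} (d : Dec P) → not (does d) ≡ true → ¬ P
  does-false (no n) _ = n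

  fixesBut-sound : ∀ w p q r c → fixesBut w p q r c ≡ true → c ≢ p → c ≢ q → c ≢ r → runℕ k w c ≡ c
  fixesBut-sound w p q r c e c≢p c≢q c≢r with ∨-true {does (c ≟ᵖ p)} e
  ... | inj₁ e₁ = ⊥-elim (c≢p (does-true (c ≟ᵖ p) e₁))
  ... | inj₂ e₁ with ∨-true {does (c ≟ᵖ q)} e₁
  ... | inj₁ e₂ = ⊥-elim (c≢q (does-true (c ≟ᵖ q) e₂))
  ... | inj₂ e₂ with ∨-true {does (c ≟ᵖ r)} e₂
  ... | inj₁ e₃ = ⊥-elim (c≢r (does-true (c ≟ᵖ r) e₃))
  ... | inj₂ e₃ = does-true (runℕ k w c ≟ᵖ c) e₃

  allIn-sound : ∀ a b h t → allIn (rect (+ a , + b) h) t (a , b) ≡ true →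
                ∀ c → InRect k (rect (+ a , + b) h) c → ∃[ d ] (c ≡ ι d × t d ≡ true)
  allIn-sound a b h t e c (i , j , i<w , j<h , refl) =
    (a ℕ.+ i , b ℕ.+ j) , refl , allBelow-sound (allBelow-sound e i i<w) j j<h

  outᵇ-sound : ∀ p c → outᵇ p c ≡ true → ¬ InBlock k (ι p) (ι c)
  outᵇ-sound p c e c∈ with trans (sym e) (cong not (insideᵇ-complete k k p c c∈))
  ... | ()

  oneOut : ∀ {F} p q r x → Linked k F (ι p) (ι q) → Linked k F (ι p) (ι r) →
           outᵇ x p ∨ outᵇ x q ∨ outᵇ x r ≡ true → ∃[ l ] (Linked k F (ι p) l × ¬ InBlock k (ι x) l)
  oneOut p q r x p~q p~r e with ∨-true {outᵇ x p} e
  ... | inj₁ o = _ , linked-refl , outᵇ-sound x p o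
  ... | inj₂ e' with ∨-true {outᵇ x q} e'
  ... | inj₁ o = _ , p~q , outᵇ-sound x q o
  ... | inj₂ o = _ , p~r , outᵇ-sound x r o

  checkSeed-sound : ∀ en col s → checkSeed en col s ≡ true → Seed k (Both en) home col
  checkSeed-sound en col s@(seed pₓ pᵧ m code) e =
    let w = word en s
        p = pₓ , pᵧ
        q = runℕ k w p
        r = runℕ k w q
        e₁ , e  = ∧-true {does (runℕ k w r ≟ᵖ p)} e
        e₂ , e  = ∧-true {not (does (p ≟ᵖ q))} e
        e₃ , e  = ∧-true {not (does (q ≟ᵖ r))} e
        e₄ , e  = ∧-true {not (does (r ≟ᵖ p))} e
        e₅ , e  = ∧-true {insideᵇ (suc k) k (k , k) p} e
        e₆ , e  = ∧-true {outᵇ (k , k) p ∨ outᵇ (k , k) q ∨ outᵇ (k , k) r} e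
        e₇ , e  = ∧-true {outᵇ (suc k , k) p ∨ outᵇ (suc k , k) q ∨ outᵇ (suc k , k) r} e
        e₈ , e  = ∧-true {not (odd k) ∨ not (col xor black (ι p))} e
        e₉ , e' = ∧-true {allIn home (fixesBut w p q r) (k , k)} e
        W = map ιMove w
        ok = word-ok en (repeat m (digits 20 code))
        lift : ∀ c → (∃[ d ] (c ≡ ι d × fixesBut w p q r d ≡ true)) →
               c ≢ ι p → c ≢ ι q → c ≢ ι r → run k W c ≡ c
        lift = λ { c (d , refl , t) n₁ n₂ n₃ → trans (ι-run k w d)
                   (cong ι (fixesBut-sound w p q r d t (n₁ ∘ cong ι) (n₂ ∘ cong ι) (n₃ ∘ cong ι))) }
        fix : ∀ c → c ≢ ι p → c ≢ ι q → c ≢ ι r → run k W c ≡ c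
        fix c = case inRect? k home c of λ
          { (yes c∈) → lift c (allIn-sound k k true _ e₉ c c∈)
          ; (no c∉)  → case inRect? k (other en) c of λ
            { (yes c∈) → lift c (allIn-sound (Entry.a en) (Entry.b en) (Entry.hor en) _ e' c c∈)
            ; (no c∉') → λ _ _ _ → run-outside k (Both en) W c ok λ { (inj₁ c∈) → c∉ c∈ ; (inj₂ c∈) → c∉' c∈ } } }
        z : ThreeCycle k (Both en) (ι p) (ι q) (ι r)
        z = threeCycle W ok (does-false (p ≟ᵖ q) e₂ ∘ ι-injective) (does-false (q ≟ᵖ r) e₃ ∘ ι-injective)
              (does-false (r ≟ᵖ p) e₄ ∘ ι-injective) (ι-run k w p) (ι-run k w q)
              (trans (ι-run k w r) (cong ι (does-true (runℕ k w r ≟ᵖ p) e₁))) fix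
        p~q = inj₂ (_ , z)
        p~r = linked-sym (inj₂ (_ , cycle-rotate (cycle-rotate z)))
        l , p~l , l∉ = oneOut p q r (k , k) p~q p~r e₆
        ρ , p~ρ , ρ∉ = oneOut p q r (suc k , k) p~q p~r e₇
    in record
      { p = ι p ; l = l ; ρ = ρ
      ; p∈ = inside-box (suc k) k (k , k) p e₅
      ; p~l = p~l ; p~ρ = p~ρ ; l∉ = l∉ ; ρ∉ = ρ∉
      ; col = λ o → case ∨-true {not (odd k)} e₈ of λ
          { (inj₁ x) → case trans (sym x) (cong not o) of λ ()
          ; (inj₂ x) → sym (xor-cancel {col} (Boolₚ.not-injective x)) } }

  checkEntry : Entry → Bool
  checkEntry en = checkSeed en false (Entry.s₀ en) ∧ checkSeed en true (Entry.s₁ en)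

  checkEntry-sound : ∀ en → checkEntry en ≡ true → ∀ b → Seed k (Both en) home b
  checkEntry-sound en e false = checkSeed-sound en false (Entry.s₀ en) (proj₁ (∧-true e))
  checkEntry-sound en e true  = checkSeed-sound en true  (Entry.s₁ en)
    (proj₂ (∧-true {checkSeed en false (Entry.s₀ en)} e))

-- Seeds for k = 2, 3, 4 and the positions of two overlapping rectangles

table2 : List Entry
table2 =
    entry 0 1 true (seed 2 2 1 1728) (seed 2 2 1 1728)
  ∷ entry 0 2 true (seed 2 2 4 813) (seed 2 2 4 813)
  ∷ entry 0 3 true (seed 2 2 1 7281) (seed 2 2 1 7281)
  ∷ entry 1 1 true (seed 3 2 1 3748) (seed 3 2 1 3748)
  ∷ entry 1 2 true (seed 4 3 2 416624) (seed 4 3 2 416624)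
  ∷ entry 1 3 true (seed 2 2 1 2615) (seed 2 2 1 2615)
  ∷ entry 2 1 true (seed 2 2 1 7182) (seed 2 2 1 7182)
  ∷ entry 2 3 true (seed 2 3 1 2718) (seed 2 3 1 2718)
  ∷ entry 3 1 true (seed 3 3 1 6251) (seed 3 3 1 6251)
  ∷ entry 3 2 true (seed 2 2 2 138284) (seed 2 2 2 138284)
  ∷ entry 3 3 true (seed 4 2 1 7384) (seed 4 2 1 7384)
  ∷ entry 4 1 true (seed 4 3 1 6453) (seed 4 3 1 6453)
  ∷ entry 4 2 true (seed 2 3 1 51452245) (seed 2 3 1 51452245)
  ∷ entry 4 3 true (seed 3 3 1 6453) (seed 3 3 1 6453)
  ∷ entry 1 0 false (seed 2 2 1 2718) (seed 2 2 1 2718)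
  ∷ entry 1 1 false (seed 2 2 1 1526) (seed 2 2 1 1526)
  ∷ entry 1 2 false (seed 2 3 1 1827) (seed 2 3 1 1827)
  ∷ entry 1 3 false (seed 2 3 1 2516) (seed 2 3 1 2516)
  ∷ entry 2 0 false (seed 2 2 1 8473) (seed 2 2 1 8473)
  ∷ entry 2 1 false (seed 2 2 1 4635) (seed 2 2 1 4635)
  ∷ entry 2 2 false (seed 2 3 1 7384) (seed 2 3 1 7384)
  ∷ entry 2 3 false (seed 3 2 1 4635) (seed 3 2 1 4635)
  ∷ entry 3 0 false (seed 2 2 1 1728) (seed 2 2 1 1728)
  ∷ entry 3 1 false (seed 3 3 1 6251) (seed 3 3 1 6251)
  ∷ entry 3 2 false (seed 3 2 1 7182) (seed 3 2 1 7182)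
  ∷ entry 3 3 false (seed 2 3 1 5261) (seed 2 3 1 5261)
  ∷ entry 4 0 false (seed 4 2 1 4738) (seed 4 2 1 4738)
  ∷ entry 4 1 false (seed 4 2 1 846357) (seed 4 2 1 846357)
  ∷ entry 4 2 false (seed 3 3 1 8473) (seed 3 3 1 8473)
  ∷ entry 4 3 false (seed 3 3 1 6453) (seed 3 3 1 6453)
  ∷ []

-- The eight positions touching the home rectangle in one corner tile are absent. As in the other
-- tables, the three points of a seed form one cycle of its word, and the lengths of all other
-- cycles divide `power`.
table3 : List Entry
table3 =
    entry 0 2 true (seed 4 5 2 528582) (seed 5 5 2 771414)
  ∷ entry 0 3 true (seed 3 4 2 7182) (seed 4 4 2 2857583823)
  ∷ entry 0 4 true (seed 4 5 2 427714) (seed 4 4 2 773232)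
  ∷ entry 1 1 true (seed 4 3 1 3748) (seed 3 5 1 6152)
  ∷ entry 1 2 true (seed 6 5 2 814472) (seed 3 5 2 325352)
  ∷ entry 1 3 true (seed 3 4 2 6152) (seed 3 3 2 84723)
  ∷ entry 1 4 true (seed 4 3 2 266718) (seed 5 3 2 554141)
  ∷ entry 1 5 true (seed 4 5 1 8374) (seed 3 5 1 1625)
  ∷ entry 2 1 true (seed 6 3 1 6453) (seed 5 5 2 668337)
  ∷ entry 2 2 true (seed 4 3 2 371372) (seed 5 5 2 686833)
  ∷ entry 2 3 true (seed 6 3 2 3548523) (seed 4 4 2 36145)
  ∷ entry 2 4 true (seed 5 4 2 682618) (seed 3 3 2 811473)
  ∷ entry 2 5 true (seed 6 5 1 5364) (seed 5 3 2 573357)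
  ∷ entry 3 1 true (seed 4 3 2 2516) (seed 5 3 2 8374)
  ∷ entry 3 2 true (seed 3 4 2 67352) (seed 4 4 2 82514)
  ∷ entry 3 4 true (seed 3 4 2 75324) (seed 3 3 2 351485)
  ∷ entry 3 5 true (seed 3 4 2 2615) (seed 4 4 2 7483)
  ∷ entry 4 1 true (seed 6 5 2 673386) (seed 5 3 1 2718)
  ∷ entry 4 2 true (seed 3 4 2 713726) (seed 6 4 2 845853)
  ∷ entry 4 3 true (seed 3 4 2 71852) (seed 3 3 2 7718614)
  ∷ entry 4 4 true (seed 4 3 2 622868) (seed 3 3 2 824248)
  ∷ entry 4 5 true (seed 4 3 2 711676) (seed 3 5 1 2817)
  ∷ entry 5 1 true (seed 4 3 1 3847) (seed 5 3 1 5261)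
  ∷ entry 5 2 true (seed 4 3 2 167671) (seed 3 5 2 226354)
  ∷ entry 5 3 true (seed 4 3 2 26145) (seed 5 5 2 4738)
  ∷ entry 5 4 true (seed 6 5 2 523235) (seed 3 3 2 463115)
  ∷ entry 5 5 true (seed 4 5 1 7483) (seed 3 5 1 5261)
  ∷ entry 6 2 true (seed 5 4 2 515414) (seed 4 4 2 676733)
  ∷ entry 6 3 true (seed 4 5 2 54466868) (seed 5 5 2 5463)
  ∷ entry 6 4 true (seed 5 4 2 253235) (seed 4 4 2 335858)
  ∷ entry 1 1 false (seed 4 5 2 331882) (seed 3 5 1 6152)
  ∷ entry 1 2 false (seed 3 4 2 8271) (seed 5 3 2 686228)
  ∷ entry 1 3 false (seed 4 5 2 1625) (seed 5 5 2 581175)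
  ∷ entry 1 4 false (seed 5 4 2 622577) (seed 3 3 1 2817)
  ∷ entry 2 0 false (seed 4 3 1 4738) (seed 3 3 2 322477)
  ∷ entry 2 1 false (seed 4 3 1 3645) (seed 5 3 2 368853)
  ∷ entry 2 2 false (seed 3 4 2 632352) (seed 3 3 2 84723)
  ∷ entry 2 3 false (seed 4 5 2 457574) (seed 4 4 2 36145)
  ∷ entry 2 4 false (seed 4 3 1 4837) (seed 3 3 2 424882)
  ∷ entry 2 5 false (seed 4 3 1 5463) (seed 5 3 2 155233)
  ∷ entry 3 0 false (seed 4 3 2 8271) (seed 3 3 2 488311)
  ∷ entry 3 1 false (seed 4 3 2 6251) (seed 3 3 2 763746)
  ∷ entry 3 2 false (seed 6 5 2 648647) (seed 3 5 2 326246)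
  ∷ entry 3 3 false (seed 4 5 2 2447442) (seed 3 3 2 322748)
  ∷ entry 3 4 false (seed 3 4 2 8271) (seed 6 4 2 388645)
  ∷ entry 3 5 false (seed 4 5 2 1625) (seed 5 3 2 585383)
  ∷ entry 4 0 false (seed 3 4 2 7137472) (seed 5 3 2 7483)
  ∷ entry 4 1 false (seed 3 4 2 681168) (seed 4 4 2 3645)
  ∷ entry 4 2 false (seed 4 3 2 633251) (seed 5 5 2 8116224)
  ∷ entry 4 3 false (seed 4 5 2 172468) (seed 6 4 2 5311811)
  ∷ entry 4 4 false (seed 3 4 2 582518) (seed 5 5 2 3847)
  ∷ entry 4 5 false (seed 4 3 2 663131) (seed 5 5 2 5364)
  ∷ entry 5 0 false (seed 4 3 2 147714) (seed 3 3 1 1728)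
  ∷ entry 5 1 false (seed 6 3 2 864573) (seed 3 3 1 1526)
  ∷ entry 5 2 false (seed 4 3 2 83271) (seed 4 4 2 674754)
  ∷ entry 5 3 false (seed 3 4 2 52361) (seed 3 3 2 831318)
  ∷ entry 5 4 false (seed 4 5 1 86728571) (seed 3 5 1 8271)
  ∷ entry 5 5 false (seed 4 5 2 663114) (seed 5 3 1 6152)
  ∷ entry 6 1 false (seed 6 3 1 4536) (seed 4 4 2 633588)
  ∷ entry 6 2 false (seed 4 3 2 683368) (seed 5 3 2 3847)
  ∷ entry 6 3 false (seed 4 5 2 477141) (seed 5 5 2 4635)
  ∷ entry 6 4 false (seed 6 3 1 3847) (seed 3 5 2 113664)
  ∷ []

-- Both rectangles of this entry are the home rectangle: for `k = 4` a 3-cycle already exists within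
-- one rectangle.
entry4 : Entry
entry4 = entry 4 4 true (seed 4 7 4 2314233224) (seed 4 7 4 2314233224)

opaque
  table2-checked : all (Check.checkEntry 2) table2 ≡ true
  table2-checked = refl

  table3-checked : all (Check.checkEntry 3) table3 ≡ true
  table3-checked = refl

  entry4-checked : Check.checkEntry 4 entry4 ≡ true
  entry4-checked = refl

matches : ℕ → ℕ → Bool → Entry → Bool
matches a b h (entry a' b' h' _ _) = (a ≡ᵇ a') ∧ (b ≡ᵇ b') ∧ not (h xor h')

same : ℕ → ℕ → ℕ → Bool → Bool
same k a b h = (a ≡ᵇ k) ∧ (b ≡ᵇ k) ∧ h

apart : ℕ → ℕ → ℕ → Bool → ℕ → ℕ → ℕ → ℕ → Bool
apart k a b h i j u v = ((i ≡ᵇ u) ∧ (j ≡ᵇ v)) ∨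
  not (insideᵇ (width k (rect (0ℤ , 0ℤ) h)) (height k (rect (0ℤ , 0ℤ) h)) (a , b) (k ℕ.+ u , k ℕ.+ v))

unique : ℕ → ℕ → ℕ → Bool → ℕ → ℕ → Bool
unique k a b h i j = odd k ∧ allBelow (suc k) (λ u → allBelow k (apart k a b h i j u))

-- Putting the tile `(i' , j')` of the second rectangle on the tile `(i , j)` of the first runs
-- through all positions with a common tile; as `i' ≤ k` and `j' ≤ k`, the subtractions do not
-- truncate. The alternative `unique` exempts, for odd `k`, positions whose only common tile is this
-- one.
covered : ℕ → List Entry → Bool → ℕ → ℕ → ℕ → ℕ → Bool
covered k table h i j i' j' = let a = k ℕ.+ i ∸ i' ; b = k ℕ.+ j ∸ j' in
  same k a b h ∨ any (matches a b h) table ∨ unique k a b h i j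

coverage : ℕ → List Entry → Bool → Bool
coverage k table h = let r = rect (0ℤ , 0ℤ) h in
  allBelow (suc k) λ i → allBelow k λ j → allBelow (width k r) λ i' → allBelow (height k r) λ j' →
  covered k table h i j i' j'

opaque
  table2-covers : ∀ h → coverage 2 table2 h ≡ true
  table2-covers true  = refl
  table2-covers false = refl

  table3-covers : ∀ h → coverage 3 table3 h ≡ true
  table3-covers true  = refl
  table3-covers false = refl

any-all : ∀ {A : Set} (p q : A → Bool) xs → any p xs ≡ true → all q xs ≡ true → ∃[ x ] (p x ≡ true × q x ≡ true)
any-all p q (x ∷ xs) e f with p x in px
... | true  = x , px , proj₁ (∧-true f)
... | false = any-all p q xs e (proj₂ (∧-true {q x} f))

≡ᵇ-true : ∀ {m n} → (m ≡ᵇ n) ≡ true → m ≡ n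
≡ᵇ-true {m} {n} e = ℕₚ.≡ᵇ⇒≡ m n (subst T (sym e) tt)

matches-sound : ∀ {a b h} en → matches a b h en ≡ true → Entry.a en ≡ a × Entry.b en ≡ b × Entry.hor en ≡ h
matches-sound {a} {b} {h} (entry a' b' h' _ _) e with ∧-true {a ≡ᵇ a'} e
... | e₁ , e' with ∧-true {b ≡ᵇ b'} e'
... | e₂ , e₃ = sym (≡ᵇ-true {a} e₁) , sym (≡ᵇ-true {b} e₂) , sym (xor-cancel {h} (Boolₚ.not-injective e₃))

difference : ∀ {x} m n → n ≤ m → + m ≡ x ℤ.+ + n → x ≡ + (m ∸ n)
difference {x} m n n≤m e = begin
  x                           ≡⟨ x+i-x (+ n) x ⟨
  (+ n ℤ.+ x) ℤ.- + n         ≡⟨ cong (ℤ._- + n) (trans (ℤₚ.+-comm (+ n) x) (sym e)) ⟩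
  + m ℤ.- + n                 ≡⟨ cong (λ l → + l ℤ.- + n) (ℕₚ.m+[n∸m]≡n n≤m) ⟨
  + (n ℕ.+ (m ∸ n)) ℤ.- + n   ≡⟨ x+i-x (+ n) (+ (m ∸ n)) ⟩
  + (m ∸ n)                   ∎
  where open ≡-Reasoning

width≤ : ∀ k p h → width k (rect p h) ≤ suc k × height k (rect p h) ≤ suc k
width≤ k p true  = ℕₚ.≤-refl , ℕₚ.n≤1+n k
width≤ k p false = ℕₚ.n≤1+n k , ℕₚ.≤-refl

homeFrame : ℕ → Rect → Frame
homeFrame k (rect (x , y) o) = (x ℤ.- + k , y ℤ.- + k) , o

putRect-home : ∀ k r → putRect (homeFrame k r) (Check.home k) ≡ r
putRect-home k (rect (x , y) true)  = cong (λ p → rect p true) (cong₂ _,_ (x+[y-x] (+ k) x) (x+[y-x] (+ k) y))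
putRect-home k (rect (x , y) false) = cong (λ p → rect p false) (cong₂ _,_ (x+[y-x] (+ k) x) (x+[y-x] (+ k) y))

unputRect : Frame → Rect → Rect
unputRect f (rect q h) = rect (unput f q) (reflectBool (proj₂ f) h)

putRect-unput : ∀ f r → putRect f (unputRect f r) ≡ r
putRect-unput f@(_ , true)  (rect q h) = cong (λ p → rect p h) (put-unput f q)
putRect-unput f@(_ , false) (rect q h) = cong₂ rect (put-unput f q) (Boolₚ.not-involutive h)

InRect-unputRect : ∀ {k} f r c → InRect k r c → InRect k (unputRect f r) (unput f c)
InRect-unputRect {k} f r c c∈ = InRect-unput f (unputRect f r) (unput f c)
  (subst₂ (InRect k) (sym (putRect-unput f r)) (sym (put-unput f c)) c∈)

InRect-home : ∀ {k} r c → InRect k r c → InRect k (Check.home k) (unput (homeFrame k r) c)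
InRect-home {k} r c c∈ = InRect-unput (homeFrame k r) (Check.home k) (unput (homeFrame k r) c)
  (subst₂ (InRect k) (sym (putRect-home k r)) (sym (put-unput (homeFrame k r) c)) c∈)

entry-seeds : ∀ {k} F r₀ en → (∀ c → InRect k r₀ c → F c) →
  (∀ c → InRect k (putRect (homeFrame k r₀) (Check.other k en)) c → F c) →
  Check.checkEntry k en ≡ true → ∀ b → Seed k F r₀ b
entry-seeds {k} F r₀ en sub₀ sub₁ e b =
  subst (λ r → Seed k F r b) (trans (sym (shape f)) (putRect-home k r₀))
    (seed-put {k} F (Check.Both k en) f (+ k , + k) sub (Check.checkEntry-sound k en e) b)
  where
  f = homeFrame k r₀
  shape : ∀ f → putRect f (Check.home k) ≡ rect (put f (+ k , + k)) (proj₂ f)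
  shape (_ , true)  = refl
  shape (_ , false) = refl
  sub : ∀ c → Check.Both k en c → F (put f c)
  sub c (inj₁ c∈) = sub₀ _ (subst (λ r → InRect k r (put f c)) (putRect-home k r₀) (InRect-put f (Check.home k) c c∈))
  sub c (inj₂ c∈) = sub₁ _ (InRect-put f (Check.other k en) c c∈)

module Pairs (k : ℕ) (table : List Entry)
             (checked : all (Check.checkEntry k) table ≡ true)
             (covers : ∀ h → coverage k table h ≡ true) where

  at-offset : ∀ h i i' j j' → i < suc k → j < k → i' < width k (rect (0ℤ , 0ℤ) h) → j' < height k (rect (0ℤ , 0ℤ) h) →
              covered k table h i j i' j' ≡ true
  at-offset h i i' j j' i< j< i'< j'< =
    allBelow-sound {p = covered k table h i j i'} (allBelow-sound {p = p₂} (allBelow-sound {p = p₁}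
      (allBelow-sound {p = p₀} (covers h) i i<) j j<) i' i'<) j' j'<
    where
    w = width k (rect (0ℤ , 0ℤ) h)
    h' = height k (rect (0ℤ , 0ℤ) h)
    p₂ p₁ p₀ : ℕ → Bool
    p₂ i' = allBelow h' (covered k table h i j i')
    p₁ j  = allBelow w λ i' → allBelow h' (covered k table h i j i')
    p₀ i  = allBelow k λ j → allBelow w λ i' → allBelow h' (covered k table h i j i')

  Result : Rect → Set
  Result r = r ≡ Check.home k ⊎ ∃[ en ] (Check.other k en ≡ r × Check.checkEntry k en ≡ true)

  from-same : ∀ a b h → same k a b h ≡ true → Result (rect (+ a , + b) h)
  from-same a b h e =
    let a≡ , e' = ∧-true {a ≡ᵇ k} e
        b≡ , h≡ = ∧-true {b ≡ᵇ k} e'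
    in inj₁ (trans (cong (rect _) h≡)
         (cong₂ (λ a b → rect (+ a , + b) true) (≡ᵇ-true {a} a≡) (≡ᵇ-true {b} b≡)))

  from-table : ∀ a b h → any (matches a b h) table ≡ true → Result (rect (+ a , + b) h)
  from-table a b h found =
    let en , m , ch = any-all (matches a b h) (Check.checkEntry k) table found checked
        e₁ , e₂ , e₃ = matches-sound {a} {b} {h} en m
    in inj₂ (en , trans (cong (λ p → rect p (Entry.hor en)) (cong₂ (λ x y → + x , + y) e₁ e₂)) (cong (rect _) e₃) , ch)

  InRect-size : ∀ p h c → InRect k (rect p h) c →
                InBox (width k (rect (0ℤ , 0ℤ) h)) (height k (rect (0ℤ , 0ℤ) h)) p c
  InRect-size p true  c c∈ = c∈
  InRect-size p false c c∈ = c∈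

  not-unique : ∀ a b h i j d → unique k a b h i j ≡ true → InRect k (Check.home k) d → InRect k (rect (+ a , + b) h) d →
               (odd k ≡ true → (+ (k ℕ.+ i) , + (k ℕ.+ j)) ≢ d) → ⊥
  not-unique a b h i j d t (u , v , u< , v< , refl) d∈ c≢d = conclude (Check.∨-true k {(i ≡ᵇ u) ∧ (j ≡ᵇ v)} ap)
    where
    o : odd k ≡ true
    o = proj₁ (∧-true t)
    ap : apart k a b h i j u v ≡ true
    ap = allBelow-sound {p = apart k a b h i j u}
           (allBelow-sound {p = λ u → allBelow k (apart k a b h i j u)} (proj₂ (∧-true {odd k} t)) u u<) v v<
    conclude : (i ≡ᵇ u) ∧ (j ≡ᵇ v) ≡ true ⊎
               not (insideᵇ (width k (rect (0ℤ , 0ℤ) h)) (height k (rect (0ℤ , 0ℤ) h)) (a , b) (k ℕ.+ u , k ℕ.+ v)) ≡ true → ⊥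
    conclude (inj₁ eq) = c≢d o (cong₂ (λ i j → + (k ℕ.+ i) , + (k ℕ.+ j))
      (≡ᵇ-true {i} (proj₁ (∧-true eq))) (≡ᵇ-true {j} (proj₂ (∧-true {i ≡ᵇ u} eq))))
    conclude (inj₂ out) = case trans (sym out) (cong not
      (insideᵇ-complete _ _ (a , b) (k ℕ.+ u , k ℕ.+ v) (InRect-size (+ a , + b) h _ d∈))) of λ ()

  local-at : ∀ h i i' j j' d → i < suc k → j < k → i' < width k (rect (0ℤ , 0ℤ) h) → j' < height k (rect (0ℤ , 0ℤ) h) →
             InRect k (Check.home k) d → InRect k (rect (ι (k ℕ.+ i ∸ i' , k ℕ.+ j ∸ j')) h) d →
             (odd k ≡ true → ι (k ℕ.+ i , k ℕ.+ j) ≢ d) → Result (rect (ι (k ℕ.+ i ∸ i' , k ℕ.+ j ∸ j')) h)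
  local-at h i i' j j' d i< j< i'< j'< d∈₀ d∈₁ c≢d =
    Sum.[ from-same a b h
        , (λ t → Sum.[ from-table a b h , (λ u → ⊥-elim (not-unique a b h i j d u d∈₀ d∈₁ c≢d)) ]
                   (Check.∨-true k {any (matches a b h) table} {unique k a b h i j} t)) ]
      (Check.∨-true k {same k a b h} {any (matches a b h) table ∨ unique k a b h i j} (at-offset h i i' j j' i< j< i'< j'<))
    where
    a b : ℕ
    a = k ℕ.+ i ∸ i'
    b = k ℕ.+ j ∸ j'

  local : ∀ q h c d → InRect k (Check.home k) c → InRect k (rect q h) c →
          InRect k (Check.home k) d → InRect k (rect q h) d → (odd k ≡ true → c ≢ d) → Result (rect q h)
  local q h c d (i , j , i< , j< , c≡) c∈₁ d∈₀ d∈₁ c≢d =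
    subst (λ q → Result (rect q h)) (sym q≡)
      (local-at h i i' j j' d i< j< i'< j'< d∈₀ (subst (λ q → InRect k (rect q h) d) q≡ d∈₁) (λ o e' → c≢d o (trans c≡ e')))
    where
    c∈ = InRect-size q h c c∈₁
    i' = proj₁ c∈
    j' = proj₁ (proj₂ c∈)
    i'< = proj₁ (proj₂ (proj₂ c∈))
    j'< = proj₁ (proj₂ (proj₂ (proj₂ c∈)))
    e : (+ (k ℕ.+ i) , + (k ℕ.+ j)) ≡ q ⊹ (i' , j')
    e = trans (sym c≡) (proj₂ (proj₂ (proj₂ (proj₂ c∈))))
    bound : ∀ {m} i' i → i' < m → m ≤ suc k → i' ≤ k ℕ.+ i
    bound i' i i'<m m≤ = ℕₚ.≤-trans (ℕₚ.≤-pred (ℕₚ.≤-trans i'<m m≤)) (ℕₚ.m≤m+n k i)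
    q≡ : q ≡ ι (k ℕ.+ i ∸ i' , k ℕ.+ j ∸ j')
    q≡ = cong₂ _,_ (difference (k ℕ.+ i) i' (bound i' i i'< (proj₁ (width≤ k (0ℤ , 0ℤ) h))) (cong proj₁ e))
                   (difference (k ℕ.+ j) j' (bound j' j j'< (proj₂ (width≤ k (0ℤ , 0ℤ) h))) (cong proj₂ e))

  -- The tile `c` locates `r₁` relative to `r₀`. For odd `k` the second common tile `d` excludes the
  -- positions that the table omits; for even `k` it may coincide with `c`.
  seeds : ∀ F r₀ r₁ c d → (∀ c → InRect k r₀ c → F c) → (∀ c → InRect k r₁ c → F c) →
          InRect k r₀ c → InRect k r₁ c → InRect k r₀ d → InRect k r₁ d → (odd k ≡ true → c ≢ d) →
          r₁ ≡ r₀ ⊎ (∀ b → Seed k F r₀ b)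
  seeds F r₀ r₁ c d sub₀ sub₁ c∈₀ c∈₁ d∈₀ d∈₁ c≢d = conclude
    (local (unput f (Rect.corner r₁)) (reflectBool (proj₂ f) (Rect.horizontal r₁)) (unput f c) (unput f d)
      (InRect-home r₀ c c∈₀) (InRect-unputRect f r₁ c c∈₁) (InRect-home r₀ d d∈₀) (InRect-unputRect f r₁ d d∈₁)
      (λ o e → c≢d o (trans (sym (put-unput f c)) (trans (cong (put f) e) (put-unput f d)))))
    where
    f : Frame
    f = homeFrame k r₀
    conclude : Result (unputRect f r₁) → r₁ ≡ r₀ ⊎ (∀ b → Seed k F r₀ b)
    conclude (inj₁ e) = inj₁ (trans (sym (putRect-unput f r₁)) (trans (cong (putRect f) e) (putRect-home k r₀)))
    conclude (inj₂ (en , e , ch)) = inj₂ (entry-seeds F r₀ en sub₀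
      (subst (λ r → ∀ c → InRect k r c → F c) (trans (sym (putRect-unput f r₁)) (cong (putRect f) (sym e))) sub₁) ch)

-- Linkage in admissible figures

LinkedFigure : ℕ → List Rect → Set
LinkedFigure k rs = AllLinked k (InFig k rs) (InFig k rs)

linked-weaken : ∀ {k F F'} S → (∀ c → F c → F' c) → AllLinked k F S → AllLinked k F' S
linked-weaken {k} {F} {F'} S sub l c d c∈ d∈ same = linked-mono {k} {F} {F'} sub (l c d c∈ d∈ same)

oldest : ∀ k rs → Admissible k rs → ∃[ r ] (∀ c → InRect k r c → InFig k rs c)
oldest k _ (first r)           = r , λ c → here
oldest k _ (place r rs adm ov) = let r₀ , sub = oldest k rs adm in r₀ , λ c c∈ → there (sub c c∈)

add-rect : ∀ h r rs → let k = suc (suc h) in Admissible k rs → Overlaps k r rs →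
           LinkedFigure k rs → LinkedFigure k (r ∷ rs)
add-rect h r rs adm ov l = let r₀ , sub = oldest (suc (suc h)) rs adm in
  grow h (InFig (suc (suc h)) (r ∷ rs)) r rs r₀ (λ c c∈ → c∈) sub ov
    (linked-weaken {suc (suc h)} {InFig _ rs} {InFig _ (r ∷ rs)} (InFig _ rs) (λ c → there) l)

linked-from-first : ∀ h → let k = suc (suc h) in (∀ r b → Seed k (InRect k r) r b) →
                    ∀ rs → Admissible k rs → LinkedFigure k rs
linked-from-first h seeds _ (first r) c d (here c∈) (here d∈) same =
  linked-mono {suc (suc h)} {InRect _ r} {InFig _ (r ∷ [])} (λ c → here)
    (seeds-link h (InRect _ r) r (λ c c∈ → c∈) (seeds r) c d c∈ d∈ same)
linked-from-first h seeds _ (place r rs adm ov) =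
  add-rect h r rs adm ov (linked-from-first h seeds rs adm)

linked-large : ∀ m rs → Admissible (5 ℕ.+ m) rs → LinkedFigure (5 ℕ.+ m) rs
linked-large m = linked-from-first (3 ℕ.+ m) λ r@(rect p o) b →
  subst (λ q → Seed (5 ℕ.+ m) (InRect (5 ℕ.+ m) r) (rect q o) b) (put-origin p o)
    (seed-put {5 ℕ.+ m} (InRect (5 ℕ.+ m) r) (InRect (5 ℕ.+ m) origin) (p , o) (0ℤ , 0ℤ)
      (put-in r) (large-seeds m) b)

linked-4 : ∀ rs → Admissible 4 rs → LinkedFigure 4 rs
linked-4 = linked-from-first 2 λ r → entry-seeds (InRect 4 r) r entry4 (λ c c∈ → c∈)
  (subst (λ r' → ∀ c → InRect 4 r' c → InRect 4 r c) (sym (putRect-home 4 r)) (λ c c∈ → c∈)) entry4-checked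

Covers : ℕ → Rect → List Rect → Set
Covers k r rs = (∀ c → InFig k rs c → InRect k r c) × (∀ c → InRect k r c → InFig k rs c)

common : ∀ k r rs → Overlaps k r rs →
  ∃[ c ] ∃[ d ] (InRect k r c × InFig k rs c × InRect k r d × InFig k rs d × (odd k ≡ true → c ≢ d))
common k r rs (ev , od) with odd k in o
... | false = let c , c∈r , c∈rs = ev (even⇒%2 {k} o) in c , c , c∈r , c∈rs , c∈r , c∈rs , λ ()
... | true  = let c , d , adj , c∈r , c∈rs , d∈r , d∈rs = od (odd⇒%2 {k} o) in
  c , d , c∈r , c∈rs , d∈r , d∈rs ,
  λ _ e → Boolₚ.not-¬ {black c} refl (trans (cong black e) (adjacent-colours c d adj))

-- While every rectangle coincides with the first, the figure remains that rectangle. The first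
-- different one yields seeds for `r₀`, which link the tiles of `r₀` inside the enlarged figure;
-- from then on `add-rect` applies.
linked-or-single : ∀ h → let k = suc (suc h) in
  (∀ F r₀ r₁ c d → (∀ c → InRect k r₀ c → F c) → (∀ c → InRect k r₁ c → F c) →
   InRect k r₀ c → InRect k r₁ c → InRect k r₀ d → InRect k r₁ d → (odd k ≡ true → c ≢ d) →
   r₁ ≡ r₀ ⊎ (∀ b → Seed k F r₀ b)) →
  ∀ rs → Admissible k rs → LinkedFigure k rs ⊎ ∃[ r₀ ] Covers k r₀ rs
linked-or-single h seeds _ (first r) = inj₂ (r , (λ { c (here c∈) → c∈ }) , λ c → here)
linked-or-single h seeds _ (place r rs adm ov) with linked-or-single h seeds rs adm
... | inj₁ l = inj₁ (add-rect h r rs adm ov l)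
... | inj₂ (r₀ , ⊆r₀ , r₀⊆) with common (suc (suc h)) r rs ov
... | c , d , c∈r , c∈rs , d∈r , d∈rs , c≢d
  with seeds (InFig (suc (suc h)) (r ∷ rs)) r₀ r c d (λ c c∈ → there (r₀⊆ c c∈)) (λ c → here)
         (⊆r₀ c c∈rs) c∈r (⊆r₀ d d∈rs) d∈r c≢d
... | inj₁ refl = inj₂ (r₀ , (λ { c (here c∈) → c∈ ; c (there c∈) → ⊆r₀ c c∈ }) , λ c → here)
... | inj₂ sd = inj₁ (grow h (InFig _ (r ∷ rs)) r rs r₀ (λ c c∈ → c∈) r₀⊆ ov
    λ c d c∈ d∈ → seeds-link h (InFig _ (r ∷ rs)) r₀ (λ c c∈ → there (r₀⊆ c c∈)) sd c d (⊆r₀ c c∈) (⊆r₀ d d∈))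

linked-figure : ∀ k → 1 < k → ∀ rs → Admissible k rs →
                LinkedFigure k rs ⊎ ((k ≡ 2 ⊎ k ≡ 3) × ∃[ r₀ ] Covers k r₀ rs)
linked-figure 1 (s≤s ()) rs adm
linked-figure 2 _ rs adm = Sum.map₂ (inj₁ refl ,_) (linked-or-single 0 seeds2 rs adm)
  where open Pairs 2 table2 table2-checked table2-covers renaming (seeds to seeds2)
linked-figure 3 _ rs adm = Sum.map₂ (inj₂ refl ,_) (linked-or-single 1 seeds3 rs adm)
  where open Pairs 3 table3 table3-checked table3-covers renaming (seeds to seeds3)
linked-figure 4 _ rs adm = inj₁ (linked-4 rs adm)
linked-figure (suc (suc (suc (suc (suc m))))) _ rs adm = inj₁ (linked-large m rs adm)

-- Signs of permutations

odd-double : ∀ m → odd (m ℕ.+ m) ≡ false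
odd-double m = trans (odd-+ m m) (Boolₚ.xor-same (odd m))

bit : Bool → ℕ
bit b = if b then 1 else 0

listSum-tabulate : ∀ {n} (f : Fin n → ℕ) → listSum (tabulate f) ≡ sum f
listSum-tabulate {zero}  f = refl
listSum-tabulate {suc n} f = cong (f zero ℕ.+_) (listSum-tabulate (f ∘ suc))

listSum-allFin : ∀ {n} (f : Fin n → ℕ) → listSum (map f (allFin n)) ≡ sum f
listSum-allFin f = trans (cong listSum (Listₚ.map-tabulate id f)) (listSum-tabulate f)

∑∑ : ∀ {n} → (Fin n → Fin n → ℕ) → ℕ
∑∑ g = sum (λ i → sum (g i))

∑∑-cong : ∀ {n} {f g : Fin n → Fin n → ℕ} → (∀ i j → f i j ≡ g i j) → ∑∑ f ≡ ∑∑ g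
∑∑-cong e = sum-cong-≗ (λ i → sum-cong-≗ (e i))

∑∑-+ : ∀ {n} (f g : Fin n → Fin n → ℕ) → ∑∑ (λ i j → f i j ℕ.+ g i j) ≡ ∑∑ f ℕ.+ ∑∑ g
∑∑-+ f g = trans (sum-cong-≗ (λ i → ∑-distrib-+ (f i) (g i))) (∑-distrib-+ (sum ∘ f) (sum ∘ g))

∑∑-* : ∀ {n} (f g : Fin n → ℕ) → ∑∑ (λ i j → f i ℕ.* g j) ≡ sum f ℕ.* sum g
∑∑-* f g = trans (sum-cong-≗ (λ i → sym (*-distribˡ-sum (f i) g))) (sym (*-distribʳ-sum (sum g) f))

count-∑∑ : ∀ {n} (p : Fin n → Fin n → Bool) → count p ≡ ∑∑ (λ i j → bit (p i j))
count-∑∑ {n} p = trans (listSum-allFin (λ i → listSum (map (λ j → bit (p i j)) (allFin n))))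
                       (sum-cong-≗ (λ i → listSum-allFin (λ j → bit (p i j))))

lt : ∀ {n} → Fin n → Fin n → Bool
lt i j = toℕ i <ᵇ toℕ j

<ᵇ-irrefl : ∀ m → (m <ᵇ m) ≡ false
<ᵇ-irrefl zero    = refl
<ᵇ-irrefl (suc m) = <ᵇ-irrefl m

<ᵇ-flip : ∀ m n → m ≢ n → (n <ᵇ m) ≡ not (m <ᵇ n)
<ᵇ-flip zero    zero    ne = ⊥-elim (ne refl)
<ᵇ-flip zero    (suc n) ne = refl
<ᵇ-flip (suc m) zero    ne = refl
<ᵇ-flip (suc m) (suc n) ne = <ᵇ-flip m n (ne ∘ cong suc)

lt-flip : ∀ {n} {i j : Fin n} → i ≢ j → lt j i ≡ not (lt i j)
lt-flip ne = <ᵇ-flip _ _ (ne ∘ Finₚ.toℕ-injective)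

below : ∀ {n} → (Fin n → Fin n → ℕ) → Fin n → Fin n → ℕ
below g i j = bit (lt i j) ℕ.* g i j

∑< : ∀ {n} → (Fin n → Fin n → ℕ) → ℕ
∑< g = ∑∑ (below g)

Symmetric₀ : ∀ {n} → (Fin n → Fin n → ℕ) → Set
Symmetric₀ g = (∀ i j → g i j ≡ g j i) × (∀ i → g i i ≡ 0)

∑<-double : ∀ {n} (g : Fin n → Fin n → ℕ) → Symmetric₀ g → ∑< g ℕ.+ ∑< g ≡ ∑∑ g
∑<-double g (symm , diag) = begin
  ∑< g ℕ.+ ∑< g                                                        ≡⟨ cong (∑< g ℕ.+_) (∑-comm (below g)) ⟩
  ∑< g ℕ.+ ∑∑ (λ i j → bit (lt j i) ℕ.* g j i)                         ≡⟨ ∑∑-+ (below g) (λ i j → below g j i) ⟨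
  ∑∑ (λ i j → bit (lt i j) ℕ.* g i j ℕ.+ bit (lt j i) ℕ.* g j i)       ≡⟨ ∑∑-cong pointwise ⟩
  ∑∑ g                                                                 ∎
  where
  open ≡-Reasoning
  pointwise : ∀ i j → bit (lt i j) ℕ.* g i j ℕ.+ bit (lt j i) ℕ.* g j i ≡ g i j
  pointwise i j with i Finₚ.≟ j
  ... | yes refl rewrite diag i | ℕₚ.*-zeroʳ (bit (lt i i)) = refl
  ... | no i≢j rewrite lt-flip i≢j | symm j i with lt i j
  ... | true  = trans (ℕₚ.+-identityʳ _) (ℕₚ.*-identityˡ (g i j))
  ... | false = ℕₚ.*-identityˡ (g i j)

double-injective : ∀ {a b} → a ℕ.+ a ≡ b ℕ.+ b → a ≡ b
double-injective {zero}  {zero}  e = refl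
double-injective {suc a} {suc b} e =
  cong suc (double-injective (ℕₚ.suc-injective (trans (sym (ℕₚ.+-suc a a))
    (trans (ℕₚ.suc-injective e) (ℕₚ.+-suc b b)))))

-- A permutation does not respect the condition `i < j`, but for a symmetric `g` vanishing on the
-- diagonal the restricted sum is half of the full one, which can be reindexed freely.
∑<-permute : ∀ {n} (g : Fin n → Fin n → ℕ) (τ : Permutation′ n) → Symmetric₀ g →
             ∑< (λ i j → g (τ ⟨$⟩ʳ i) (τ ⟨$⟩ʳ j)) ≡ ∑< g
∑<-permute g τ s@(symm , diag) = double-injective (begin
  ∑< g' ℕ.+ ∑< g'    ≡⟨ ∑<-double g' ((λ i j → symm _ _) , (λ i → diag _)) ⟩
  ∑∑ g'              ≡⟨ sum-cong-≗ (λ i → sum-permute (g (τ ⟨$⟩ʳ i)) τ) ⟨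
  sum (λ i → sum (g (τ ⟨$⟩ʳ i)))  ≡⟨ sum-permute (sum ∘ g) τ ⟨
  ∑∑ g               ≡⟨ ∑<-double g s ⟨
  ∑< g ℕ.+ ∑< g      ∎)
  where
  open ≡-Reasoning
  g' = λ i j → g (τ ⟨$⟩ʳ i) (τ ⟨$⟩ʳ j)

perm-injective : ∀ {n} (σ : Permutation′ n) {i j} → σ ⟨$⟩ʳ i ≡ σ ⟨$⟩ʳ j → i ≡ j
perm-injective σ e = trans (sym (Perm.inverseˡ σ)) (trans (cong (σ ⟨$⟩ˡ_) e) (Perm.inverseˡ σ))

module _ {n : ℕ} (S : Fin n → Bool) where

  -- The indicator of an inversion, made symmetric by `xor`: it asks whether `σ` reverses the order
  -- of the pair, whichever of the two comes first.
  flipped : Permutation′ n → Fin n → Fin n → ℕ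
  flipped σ i j = bit (S i ∧ S j ∧ (lt i j xor lt (σ ⟨$⟩ʳ i) (σ ⟨$⟩ʳ j)))

  flipped-diag : ∀ σ i → flipped σ i i ≡ 0
  flipped-diag σ i rewrite <ᵇ-irrefl (toℕ i) | <ᵇ-irrefl (toℕ (σ ⟨$⟩ʳ i)) with S i
  ... | true  = refl
  ... | false = refl

  flipped-sym : ∀ σ i j → flipped σ i j ≡ flipped σ j i
  flipped-sym σ i j with i Finₚ.≟ j
  ... | yes refl = refl
  ... | no i≢j rewrite lt-flip i≢j | lt-flip (i≢j ∘ perm-injective σ) =
    cong bit (go (S i) (S j) (lt i j) (lt (σ ⟨$⟩ʳ i) (σ ⟨$⟩ʳ j)))
    where
    go : ∀ a b c d → a ∧ b ∧ (c xor d) ≡ b ∧ a ∧ (not c xor not d)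
    go true  true  true  true  = refl
    go true  true  true  false = refl
    go true  true  false true  = refl
    go true  true  false false = refl
    go true  false c d = refl
    go false true  c d = refl
    go false false c d = refl

  flipped-sym₀ : ∀ σ → Symmetric₀ (flipped σ)
  flipped-sym₀ σ = flipped-sym σ , flipped-diag σ

  inversions-∑< : ∀ σ → inversionsOn S σ ≡ ∑< (flipped σ)
  inversions-∑< σ = trans (count-∑∑ (λ i j → S i ∧ S j ∧ lt i j ∧ lt (σ ⟨$⟩ʳ j) (σ ⟨$⟩ʳ i))) (∑∑-cong pointwise)
    where
    pointwise : ∀ i j → bit (S i ∧ S j ∧ lt i j ∧ lt (σ ⟨$⟩ʳ j) (σ ⟨$⟩ʳ i)) ≡ bit (lt i j) ℕ.* flipped σ i j
    pointwise i j with i Finₚ.≟ j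
    ... | yes refl rewrite <ᵇ-irrefl (toℕ i) with S i
    ... | true  = refl
    ... | false = refl
    pointwise i j | no i≢j rewrite lt-flip (i≢j ∘ perm-injective σ) =
      go (S i) (S j) (lt i j) (lt (σ ⟨$⟩ʳ i) (σ ⟨$⟩ʳ j))
      where
      go : ∀ a b c d → bit (a ∧ b ∧ c ∧ not d) ≡ bit c ℕ.* bit (a ∧ b ∧ (c xor d))
      go true  true  true  true  = refl
      go true  true  true  false = refl
      go true  true  false d     = refl
      go true  false true  d     = refl
      go true  false false d     = refl
      go false b     true  d     = refl
      go false b     false d     = refl

  sgn : Permutation′ n → Bool
  sgn σ = odd (inversionsOn S σ)

  sgn-cong : ∀ {σ τ} → σ ≈ₚ τ → sgn σ ≡ sgn τ
  sgn-cong {σ} {τ} e = cong odd (trans (inversions-∑< σ)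
    (trans (∑∑-cong (λ i j → cong₂ (λ x y → bit (lt i j) ℕ.* bit (S i ∧ S j ∧ (lt i j xor lt x y))) (e i) (e j)))
           (sym (inversions-∑< τ))))

  -- The composite reverses a pair exactly when one but not both of `τ` on the pair and `σ` on its
  -- image does. With `z` marking the pairs reversed twice, the inversions of the factors exceed
  -- those of the composite by twice the sum of `z`; `pres` makes the image pair lie in `S` as well.
  sgn-∘ : ∀ τ σ → (∀ i → S (τ ⟨$⟩ʳ i) ≡ S i) → sgn (τ ∘ₚ σ) ≡ sgn τ xor sgn σ
  sgn-∘ τ σ pres = begin
    odd (inversionsOn S (τ ∘ₚ σ))                        ≡⟨ Boolₚ.xor-identityʳ _ ⟨
    odd (inversionsOn S (τ ∘ₚ σ)) xor false              ≡⟨ cong (odd (inversionsOn S (τ ∘ₚ σ)) xor_) (odd-double (∑< z)) ⟨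
    odd (inversionsOn S (τ ∘ₚ σ)) xor odd (∑< z ℕ.+ ∑< z) ≡⟨ odd-+ (inversionsOn S (τ ∘ₚ σ)) _ ⟨
    odd (inversionsOn S (τ ∘ₚ σ) ℕ.+ (∑< z ℕ.+ ∑< z))    ≡⟨ cong odd total ⟨
    odd (inversionsOn S τ ℕ.+ inversionsOn S σ)          ≡⟨ odd-+ (inversionsOn S τ) _ ⟩
    sgn τ xor sgn σ                                      ∎
    where
    open ≡-Reasoning
    z : Fin n → Fin n → ℕ
    z i j = bit (S i ∧ S j ∧ (lt i j xor lt (τ ⟨$⟩ʳ i) (τ ⟨$⟩ʳ j)) ∧
              (lt (τ ⟨$⟩ʳ i) (τ ⟨$⟩ʳ j) xor lt (σ ⟨$⟩ʳ (τ ⟨$⟩ʳ i)) (σ ⟨$⟩ʳ (τ ⟨$⟩ʳ j))))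
    go : ∀ s t a b c → bit (s ∧ t ∧ (a xor b)) ℕ.+ bit (s ∧ t ∧ (b xor c)) ≡
         bit (s ∧ t ∧ (a xor c)) ℕ.+ (bit (s ∧ t ∧ (a xor b) ∧ (b xor c)) ℕ.+ bit (s ∧ t ∧ (a xor b) ∧ (b xor c)))
    go true  true  true  true  true  = refl
    go true  true  true  true  false = refl
    go true  true  true  false true  = refl
    go true  true  true  false false = refl
    go true  true  false true  true  = refl
    go true  true  false true  false = refl
    go true  true  false false true  = refl
    go true  true  false false false = refl
    go true  false a b c = refl
    go false t     a b c = refl
    pair : ∀ i j → flipped τ i j ℕ.+ flipped σ (τ ⟨$⟩ʳ i) (τ ⟨$⟩ʳ j) ≡ flipped (τ ∘ₚ σ) i j ℕ.+ (z i j ℕ.+ z i j)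
    pair i j rewrite pres i | pres j = go (S i) (S j) (lt i j) _ _
    split : ∀ l i j → bit l ℕ.* flipped τ i j ℕ.+ bit l ℕ.* flipped σ (τ ⟨$⟩ʳ i) (τ ⟨$⟩ʳ j) ≡
            bit l ℕ.* flipped (τ ∘ₚ σ) i j ℕ.+ (bit l ℕ.* z i j ℕ.+ bit l ℕ.* z i j)
    split l i j = begin
      bit l ℕ.* flipped τ i j ℕ.+ bit l ℕ.* flipped σ (τ ⟨$⟩ʳ i) (τ ⟨$⟩ʳ j) ≡⟨ ℕₚ.*-distribˡ-+ (bit l) (flipped τ i j) _ ⟨
      bit l ℕ.* (flipped τ i j ℕ.+ flipped σ (τ ⟨$⟩ʳ i) (τ ⟨$⟩ʳ j))        ≡⟨ cong (bit l ℕ.*_) (pair i j) ⟩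
      bit l ℕ.* (flipped (τ ∘ₚ σ) i j ℕ.+ (z i j ℕ.+ z i j)) ≡⟨ ℕₚ.*-distribˡ-+ (bit l) (flipped (τ ∘ₚ σ) i j) _ ⟩
      bit l ℕ.* flipped (τ ∘ₚ σ) i j ℕ.+ bit l ℕ.* (z i j ℕ.+ z i j)
        ≡⟨ cong (bit l ℕ.* flipped (τ ∘ₚ σ) i j ℕ.+_) (ℕₚ.*-distribˡ-+ (bit l) (z i j) (z i j)) ⟩
      bit l ℕ.* flipped (τ ∘ₚ σ) i j ℕ.+ (bit l ℕ.* z i j ℕ.+ bit l ℕ.* z i j) ∎
    total : inversionsOn S τ ℕ.+ inversionsOn S σ ≡ inversionsOn S (τ ∘ₚ σ) ℕ.+ (∑< z ℕ.+ ∑< z)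
    total = begin
      inversionsOn S τ ℕ.+ inversionsOn S σ
        ≡⟨ cong₂ ℕ._+_ (inversions-∑< τ) (trans (inversions-∑< σ) (sym (∑<-permute (flipped σ) τ (flipped-sym₀ σ)))) ⟩
      ∑< (flipped τ) ℕ.+ ∑< (λ i j → flipped σ (τ ⟨$⟩ʳ i) (τ ⟨$⟩ʳ j))
        ≡⟨ ∑∑-+ (below (flipped τ)) (below (λ i j → flipped σ (τ ⟨$⟩ʳ i) (τ ⟨$⟩ʳ j))) ⟨
      ∑∑ (λ i j → bit (lt i j) ℕ.* flipped τ i j ℕ.+ bit (lt i j) ℕ.* flipped σ (τ ⟨$⟩ʳ i) (τ ⟨$⟩ʳ j))
        ≡⟨ ∑∑-cong (λ i j → split (lt i j) i j) ⟩
      ∑∑ (λ i j → bit (lt i j) ℕ.* flipped (τ ∘ₚ σ) i j ℕ.+ (bit (lt i j) ℕ.* z i j ℕ.+ bit (lt i j) ℕ.* z i j))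
        ≡⟨ trans (∑∑-+ (below (flipped (τ ∘ₚ σ))) (λ i j → below z i j ℕ.+ below z i j))
             (cong (∑< (flipped (τ ∘ₚ σ)) ℕ.+_) (∑∑-+ (below z) (below z))) ⟩
      ∑< (flipped (τ ∘ₚ σ)) ℕ.+ (∑< z ℕ.+ ∑< z)
        ≡⟨ cong (ℕ._+ (∑< z ℕ.+ ∑< z)) (inversions-∑< (τ ∘ₚ σ)) ⟨
      inversionsOn S (τ ∘ₚ σ) ℕ.+ (∑< z ℕ.+ ∑< z) ∎

sum-is : ∀ {n} (x : Fin n) → sum (λ a → bit (does (a Finₚ.≟ x))) ≡ 1
sum-is {suc n} zero    = cong suc (sum-zero n)
  where
  sum-zero : ∀ n → sum {n} (λ _ → 0) ≡ 0
  sum-zero zero    = refl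
  sum-zero (suc n) = sum-zero n
sum-is {suc n} (suc x) = trans (sum-cong-≗ (λ a → cong bit (does-suc a x))) (sum-is x)
  where
  does-suc : ∀ {n} (a b : Fin n) → does (suc a Finₚ.≟ suc b) ≡ does (a Finₚ.≟ b)
  does-suc a b with a Finₚ.≟ b
  ... | yes _ = refl
  ... | no _  = refl

is : ∀ {n} → Fin n → Fin n → ℕ
is x a = bit (does (a Finₚ.≟ x))

is-self : ∀ {n} (x : Fin n) → is x x ≡ 1
is-self x rewrite dec-true (x Finₚ.≟ x) refl = refl

is-other : ∀ {n} {x a : Fin n} → a ≢ x → is x a ≡ 0
is-other {x = x} {a} ne rewrite dec-false (a Finₚ.≟ x) ne = refl

transpose-left : ∀ {n} (x y : Fin n) → transpose x y ⟨$⟩ʳ x ≡ y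
transpose-left x y rewrite dec-true (x Finₚ.≟ x) refl = refl

transpose-right : ∀ {n} (x y : Fin n) → transpose x y ⟨$⟩ʳ y ≡ x
transpose-right x y with y Finₚ.≟ x
... | yes refl = refl
... | no _ rewrite dec-true (y Finₚ.≟ y) refl = refl

transpose-other : ∀ {n} {x y c : Fin n} → c ≢ x → c ≢ y → transpose x y ⟨$⟩ʳ c ≡ c
transpose-other {x = x} {y} {c} c≢x c≢y rewrite dec-false (c Finₚ.≟ x) c≢x | dec-false (c Finₚ.≟ y) c≢y = refl

Position : ∀ {n} → Fin n → Fin n → Fin n → Set
Position x y a = a ≡ x ⊎ a ≡ y ⊎ (a ≢ x × a ≢ y)

position : ∀ {n} (x y a : Fin n) → Position x y a
position x y a with a Finₚ.≟ x | a Finₚ.≟ y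
... | yes e | _     = inj₁ e
... | no _  | yes e = inj₂ (inj₁ e)
... | no n  | no m  = inj₂ (inj₂ (n , m))

module _ {n : ℕ} (S : Fin n → Bool) {x y : Fin n} (x≢y : x ≢ y) where

  private
    τ = transpose x y
    d = flipped S τ
    h : Fin n → ℕ
    h a = if does (a Finₚ.≟ x) ∨ does (a Finₚ.≟ y) then 0 else d a x

  sgn-transpose-out : S x ≡ false → S y ≡ false → sgn S τ ≡ false
  sgn-transpose-out Sx Sy = cong odd (trans (inversions-∑< S τ) (trans (∑∑-cong pointwise) zeros))
    where
    zeros : ∑∑ {n} (λ i j → 0) ≡ 0
    zeros = trans (sum-cong-≗ {n} (λ i → zero-sum n)) (zero-sum n)
      where
      zero-sum : ∀ n → sum {n} (λ _ → 0) ≡ 0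
      zero-sum zero    = refl
      zero-sum (suc n) = zero-sum n
    stays : ∀ i → S i ≡ true → τ ⟨$⟩ʳ i ≡ i
    stays i Si = transpose-other (λ { refl → case trans (sym Si) Sx of λ () })
                                 (λ { refl → case trans (sym Si) Sy of λ () })
    pointwise : ∀ i j → below d i j ≡ 0
    pointwise i j with S i in Si | S j in Sj
    ... | false | _     = ℕₚ.*-zeroʳ (bit (lt i j))
    ... | true  | false = ℕₚ.*-zeroʳ (bit (lt i j))
    ... | true  | true rewrite stays i Si | stays j Sj | Boolₚ.xor-same (lt i j) = ℕₚ.*-zeroʳ (bit (lt i j))

  -- Besides the pair of `x` and `y`, a further index `a` is in inversion with both of them or with
  -- neither. With `H` counting the indices of the first kind, there are `suc (H + H)` inversions.
  sgn-transpose-in : S x ≡ true → S y ≡ true → sgn S τ ≡ true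
  sgn-transpose-in Sx Sy = trans (cong odd (trans (inversions-∑< S τ) N≡)) (cong not (odd-double H))
    where
    open ≡-Reasoning
    H = sum h
    dxy : d x y ≡ 1
    dxy rewrite Sx | Sy | transpose-left x y | transpose-right x y | lt-flip x≢y with lt x y
    ... | true  = refl
    ... | false = refl
    d-other : ∀ {a} → a ≢ x → a ≢ y → d a y ≡ d a x
    d-other {a} a≢x a≢y
      rewrite Sx | Sy | transpose-left x y | transpose-right x y | transpose-other a≢x a≢y =
      cong (λ b → bit (S a ∧ b)) (Boolₚ.xor-comm (lt a y) (lt a x))
    d-others : ∀ {a b} → a ≢ x → a ≢ y → b ≢ x → b ≢ y → d a b ≡ 0
    d-others {a} {b} a≢x a≢y b≢x b≢y
      rewrite transpose-other a≢x a≢y | transpose-other b≢x b≢y | Boolₚ.xor-same (lt a b) with S a | S b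
    ... | true  | true  = refl
    ... | true  | false = refl
    ... | false | _     = refl
    h-x : h x ≡ 0
    h-x rewrite dec-true (x Finₚ.≟ x) refl = refl
    h-y : h y ≡ 0
    h-y rewrite dec-true (y Finₚ.≟ y) refl | Boolₚ.∨-zeroʳ (does (y Finₚ.≟ x)) = refl
    h-other : ∀ {a} → a ≢ x → a ≢ y → h a ≡ d a x
    h-other {a} a≢x a≢y rewrite dec-false (a Finₚ.≟ x) a≢x | dec-false (a Finₚ.≟ y) a≢y = refl
    -- The indicators `is x` and `is y` turn the case distinction into a sum of products, whose
    -- double sums factor.
    pointwise : ∀ a b → d a b ≡ (is x a ℕ.* is y b ℕ.+ is y a ℕ.* is x b) ℕ.+
                        ((is x a ℕ.+ is y a) ℕ.* h b ℕ.+ h a ℕ.* (is x b ℕ.+ is y b))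
    pointwise a b = go (position x y a) (position x y b)
      where
      go : Position x y a → Position x y b → d a b ≡ (is x a ℕ.* is y b ℕ.+ is y a ℕ.* is x b) ℕ.+
                                 ((is x a ℕ.+ is y a) ℕ.* h b ℕ.+ h a ℕ.* (is x b ℕ.+ is y b))
      rhs : ∀ p q r s u v → is x a ≡ p → is y a ≡ q → is x b ≡ r → is y b ≡ s → h b ≡ u → h a ≡ v →
            d a b ≡ (p ℕ.* s ℕ.+ q ℕ.* r) ℕ.+ ((p ℕ.+ q) ℕ.* u ℕ.+ v ℕ.* (r ℕ.+ s)) →
            d a b ≡ (is x a ℕ.* is y b ℕ.+ is y a ℕ.* is x b) ℕ.+
                    ((is x a ℕ.+ is y a) ℕ.* h b ℕ.+ h a ℕ.* (is x b ℕ.+ is y b))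
      rhs _ _ _ _ _ _ refl refl refl refl refl refl e = e
      y≢x = x≢y ∘ sym
      go (inj₁ refl) (inj₁ refl) =
        rhs 1 0 1 0 0 0 (is-self x) (is-other x≢y) (is-self x) (is-other x≢y) h-x h-x (flipped-diag S τ x)
      go (inj₁ refl) (inj₂ (inj₁ refl)) =
        rhs 1 0 0 1 0 0 (is-self x) (is-other x≢y) (is-other y≢x) (is-self y) h-y h-x dxy
      go (inj₁ refl) (inj₂ (inj₂ (b≢x , b≢y))) =
        rhs 1 0 0 0 (d b x) 0 (is-self x) (is-other x≢y) (is-other b≢x) (is-other b≢y) (h-other b≢x b≢y) h-x
          (trans (flipped-sym S τ x b) (sym (trans (ℕₚ.+-identityʳ _) (ℕₚ.+-identityʳ _))))
      go (inj₂ (inj₁ refl)) (inj₁ refl) =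
        rhs 0 1 1 0 0 0 (is-other y≢x) (is-self y) (is-self x) (is-other x≢y) h-x h-y (trans (flipped-sym S τ y x) dxy)
      go (inj₂ (inj₁ refl)) (inj₂ (inj₁ refl)) =
        rhs 0 1 0 1 0 0 (is-other y≢x) (is-self y) (is-other y≢x) (is-self y) h-y h-y (flipped-diag S τ y)
      go (inj₂ (inj₁ refl)) (inj₂ (inj₂ (b≢x , b≢y))) =
        rhs 0 1 0 0 (d b x) 0 (is-other y≢x) (is-self y) (is-other b≢x) (is-other b≢y) (h-other b≢x b≢y) h-y
          (trans (flipped-sym S τ y b) (trans (d-other b≢x b≢y) (sym (trans (ℕₚ.+-identityʳ _) (ℕₚ.+-identityʳ _)))))
      go (inj₂ (inj₂ (a≢x , a≢y))) (inj₁ refl) =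
        rhs 0 0 1 0 0 (d a x) (is-other a≢x) (is-other a≢y) (is-self x) (is-other x≢y) h-x (h-other a≢x a≢y)
          (sym (ℕₚ.*-identityʳ (d a x)))
      go (inj₂ (inj₂ (a≢x , a≢y))) (inj₂ (inj₁ refl)) =
        rhs 0 0 0 1 0 (d a x) (is-other a≢x) (is-other a≢y) (is-other y≢x) (is-self y) h-y (h-other a≢x a≢y)
          (trans (d-other a≢x a≢y) (sym (ℕₚ.*-identityʳ (d a x))))
      go (inj₂ (inj₂ (a≢x , a≢y))) (inj₂ (inj₂ (b≢x , b≢y))) =
        rhs 0 0 0 0 (h b) (h a) (is-other a≢x) (is-other a≢y) (is-other b≢x) (is-other b≢y) refl refl
          (trans (d-others a≢x a≢y b≢x b≢y) (sym (ℕₚ.*-zeroʳ (h a))))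
    N≡ : ∑< d ≡ suc (H ℕ.+ H)
    N≡ = double-injective (begin
      ∑< d ℕ.+ ∑< d ≡⟨ ∑<-double d (flipped-sym₀ S τ) ⟩
      ∑∑ d          ≡⟨ ∑∑-cong pointwise ⟩
      ∑∑ (λ a b → (is x a ℕ.* is y b ℕ.+ is y a ℕ.* is x b) ℕ.+
                  ((is x a ℕ.+ is y a) ℕ.* h b ℕ.+ h a ℕ.* (is x b ℕ.+ is y b)))
        ≡⟨ trans (∑∑-+ (λ a b → is x a ℕ.* is y b ℕ.+ is y a ℕ.* is x b)
                       (λ a b → (is x a ℕ.+ is y a) ℕ.* h b ℕ.+ h a ℕ.* (is x b ℕ.+ is y b)))
             (cong₂ ℕ._+_ (∑∑-+ (λ a b → is x a ℕ.* is y b) (λ a b → is y a ℕ.* is x b))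
                          (∑∑-+ (λ a b → (is x a ℕ.+ is y a) ℕ.* h b) (λ a b → h a ℕ.* (is x b ℕ.+ is y b)))) ⟩
      (∑∑ (λ a b → is x a ℕ.* is y b) ℕ.+ ∑∑ (λ a b → is y a ℕ.* is x b)) ℕ.+
      (∑∑ (λ a b → (is x a ℕ.+ is y a) ℕ.* h b) ℕ.+ ∑∑ (λ a b → h a ℕ.* (is x b ℕ.+ is y b)))
        ≡⟨ cong₂ ℕ._+_ (cong₂ ℕ._+_ (∑∑-* (is x) (is y)) (∑∑-* (is y) (is x)))
                       (cong₂ ℕ._+_ (∑∑-* (λ a → is x a ℕ.+ is y a) h) (∑∑-* h (λ a → is x a ℕ.+ is y a))) ⟩
      (sum (is x) ℕ.* sum (is y) ℕ.+ sum (is y) ℕ.* sum (is x)) ℕ.+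
      (sum (λ a → is x a ℕ.+ is y a) ℕ.* H ℕ.+ H ℕ.* sum (λ a → is x a ℕ.+ is y a))
        ≡⟨ cong₂ (λ u v → u ℕ.+ (v ℕ.* H ℕ.+ H ℕ.* v))
             (cong₂ (λ u v → u ℕ.* v ℕ.+ v ℕ.* u) (sum-is x) (sum-is y))
             (trans (∑-distrib-+ (is x) (is y)) (cong₂ ℕ._+_ (sum-is x) (sum-is y))) ⟩
      2 ℕ.+ (2 ℕ.* H ℕ.+ H ℕ.* 2)
        ≡⟨ solve 1 (λ H → con 2 :+ (con 2 :* H :+ H :* con 2) :=
             (con 1 :+ (H :+ H)) :+ (con 1 :+ (H :+ H))) refl H ⟩
      suc (H ℕ.+ H) ℕ.+ suc (H ℕ.+ H) ∎)

-- Permutations that are products of 3-cycles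

module _ {n : ℕ} where

  transpose-comm : ∀ (x y c : Fin n) → transpose x y ⟨$⟩ʳ c ≡ transpose y x ⟨$⟩ʳ c
  transpose-comm x y c with position x y c
  ... | inj₁ refl               = trans (transpose-left c y) (sym (transpose-right y c))
  ... | inj₂ (inj₁ refl)        = trans (transpose-right x c) (sym (transpose-left c x))
  ... | inj₂ (inj₂ (c≢x , c≢y)) = trans (transpose-other c≢x c≢y) (sym (transpose-other c≢y c≢x))

  transpose-twice : ∀ (x y c : Fin n) → transpose x y ⟨$⟩ʳ (transpose x y ⟨$⟩ʳ c) ≡ c
  transpose-twice x y c = trans (transpose-comm x y (transpose x y ⟨$⟩ʳ c)) (Perm.inverseˡ (transpose x y) {c})

  equal-or-not : ∀ (i j : Fin n) → i ≡ j ⊎ i ≢ j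
  equal-or-not i j with i Finₚ.≟ j
  ... | yes e = inj₁ e
  ... | no ne = inj₂ ne

module Alternating {n : ℕ} (κ : Fin n → Bool) where

  -- transpose a b ∘ₚ transpose a c is the 3-cycle a ↦ b ↦ c ↦ a.
  data Alt : Permutation′ n → Set where
    alt-id  : ∀ {σ} → (∀ i → σ ⟨$⟩ʳ i ≡ i) → Alt σ
    alt-gen : ∀ {σ τ} a b c → a ≢ b → b ≢ c → c ≢ a → κ a ≡ κ b → κ b ≡ κ c → Alt τ →
              σ ≈ₚ ((transpose a b ∘ₚ transpose a c) ∘ₚ τ) → Alt σ

  alt-∘ : ∀ {σ τ π} → Alt σ → Alt τ → π ≈ₚ (σ ∘ₚ τ) → Alt π
  alt-∘ {σ} {τ} (alt-id e) (alt-id f) g = alt-id (λ i → trans (g i) (trans (cong (τ ⟨$⟩ʳ_) (e i)) (f i)))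
  alt-∘ {σ} {τ} {π} (alt-id e) (alt-gen a b c p q r s t y f) g =
    alt-gen a b c p q r s t y (λ i → trans (g i) (trans (cong (τ ⟨$⟩ʳ_) (e i)) (f i)))
  alt-∘ {σ} {τ} {π} (alt-gen {τ = ρ} a b c p q r s t x e) y g =
    alt-gen {τ = ρ ∘ₚ τ} a b c p q r s t (alt-∘ x y (λ i → refl)) (λ i → trans (g i) (cong (τ ⟨$⟩ʳ_) (e i)))

  alt-cycle : ∀ {σ} a b c → a ≢ b → b ≢ c → c ≢ a → κ a ≡ κ b → κ b ≡ κ c →
              σ ≈ₚ (transpose a b ∘ₚ transpose a c) → Alt σ
  alt-cycle a b c p q r s t e = alt-gen {τ = Perm.id} a b c p q r s t (alt-id (λ i → refl)) e

  -- Two swaps with a common point compose to a 3-cycle or to the identity. Between disjoint ones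
  -- the swap of `x` and `u` is inserted twice, which gives two 3-cycles.
  alt-two-swaps : ∀ x y u v → x ≢ y → u ≢ v → κ x ≡ κ y → κ x ≡ κ u → κ x ≡ κ v →
                  Alt (transpose x y ∘ₚ transpose u v)
  alt-two-swaps x y u v x≢y u≢v xy xu xv with u Finₚ.≟ x | u Finₚ.≟ y | v Finₚ.≟ x | v Finₚ.≟ y
  ... | yes refl | _ | _ | yes refl = alt-id (transpose-twice x y)
  ... | yes refl | _ | _ | no v≢y = alt-cycle x y v x≢y (v≢y ∘ sym) (u≢v ∘ sym) xy (trans (sym xy) xv) (λ i → refl)
  ... | no _ | yes refl | yes refl | _ = alt-id (λ i → trans (cong (transpose u v ⟨$⟩ʳ_) (transpose-comm v u i)) (transpose-twice u v i))
  ... | no _ | yes refl | no v≢x | _ = alt-cycle y x v (x≢y ∘ sym) (v≢x ∘ sym) (u≢v ∘ sym) (sym xy) xv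
        (λ i → cong (transpose y v ⟨$⟩ʳ_) (transpose-comm x y i))
  ... | no u≢x | no u≢y | yes refl | _ = alt-cycle x y u x≢y (u≢y ∘ sym) u≢x xy (trans (sym xy) xu)
        (λ i → transpose-comm u x (transpose x y ⟨$⟩ʳ i))
  ... | no u≢x | no u≢y | no v≢x | yes refl = alt-cycle y x u (x≢y ∘ sym) (u≢x ∘ sym) u≢y (sym xy) xu
        (λ i → trans (transpose-comm u y (transpose x y ⟨$⟩ʳ i)) (cong (transpose y u ⟨$⟩ʳ_) (transpose-comm x y i)))
  ... | no u≢x | no u≢y | no v≢x | no v≢y =
    alt-gen {τ = transpose u x ∘ₚ transpose u v} x y u x≢y (u≢y ∘ sym) u≢x xy (trans (sym xy) xu)
      (alt-cycle u x v u≢x (v≢x ∘ sym) (u≢v ∘ sym) (sym xu) xv (λ i → refl))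
      (λ i → cong (transpose u v ⟨$⟩ʳ_)
        (sym (trans (cong (transpose u x ⟨$⟩ʳ_) (transpose-comm x u (transpose x y ⟨$⟩ʳ i))) (transpose-twice u x (transpose x y ⟨$⟩ʳ i)))))

  Preserves : Permutation′ n → Set
  Preserves σ = ∀ i → κ (σ ⟨$⟩ʳ i) ≡ κ i

  transpose-preserves : ∀ {x y} → κ x ≡ κ y → Preserves (transpose x y)
  transpose-preserves {x} {y} xy i with position x y i
  ... | inj₁ refl               = trans (cong κ (transpose-left x y)) (sym xy)
  ... | inj₂ (inj₁ refl)        = trans (cong κ (transpose-right x y)) xy
  ... | inj₂ (inj₂ (i≢x , i≢y)) = cong κ (transpose-other i≢x i≢y)

  alt-preserves : ∀ {σ} → Alt σ → Preserves σ
  alt-preserves (alt-id e) i = cong κ (e i)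
  alt-preserves (alt-gen {τ = τ} a b c p q r s t x e) i =
    trans (cong κ (e i)) (trans (alt-preserves x _)
      (trans (transpose-preserves (trans s t) (transpose a b ⟨$⟩ʳ i)) (transpose-preserves s i)))

  SwapOrId : Bool → Permutation′ n → Set
  SwapOrId b p = (∀ i → p ⟨$⟩ʳ i ≡ i) ⊎
                 ∃[ x ] ∃[ y ] (x ≢ y × κ x ≡ b × κ y ≡ b × p ≈ₚ transpose x y)

  -- At most one swap of each colour is left over from a product of swaps. They stand at opposite
  -- ends because `absorbT` multiplies on the one side and `absorbF` on the other: a new swap then
  -- meets its partner directly and nothing has to be moved past `g`.
  record NormalForm (σ : Permutation′ n) : Set where
    constructor normalForm
    field
      pT pF g : Permutation′ n
      isT     : SwapOrId true pT
      isF     : SwapOrId false pF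
      isAlt   : Alt g
      eq      : σ ≈ₚ (pT ∘ₚ (g ∘ₚ pF))

  absorbT : ∀ {σ σ'} x y → x ≢ y → κ x ≡ true → κ y ≡ true → σ ≈ₚ (transpose x y ∘ₚ σ') → NormalForm σ' → NormalForm σ
  absorbT {σ} x y x≢y kx ky e (normalForm pT pF g (inj₁ pid) isF isAlt eq) =
    normalForm (transpose x y) pF g (inj₂ (x , y , x≢y , kx , ky , λ i → refl)) isF isAlt
      (λ i → trans (e i) (trans (eq _) (cong (λ j → pF ⟨$⟩ʳ (g ⟨$⟩ʳ j)) (pid _))))
  absorbT {σ} x y x≢y kx ky e (normalForm pT pF g (inj₂ (u , v , u≢v , ku , kv , f)) isF isAlt eq) =
    normalForm Perm.id pF ((transpose x y ∘ₚ transpose u v) ∘ₚ g) (inj₁ (λ i → refl)) isF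
      (alt-∘ (alt-two-swaps x y u v x≢y u≢v (trans kx (sym ky)) (trans kx (sym ku)) (trans kx (sym kv))) isAlt (λ i → refl))
      (λ i → trans (e i) (trans (eq _) (cong (λ j → pF ⟨$⟩ʳ (g ⟨$⟩ʳ j)) (f _))))

  absorbF : ∀ {σ σ'} x y → x ≢ y → κ x ≡ false → κ y ≡ false → σ ≈ₚ (σ' ∘ₚ transpose x y) → NormalForm σ' → NormalForm σ
  absorbF {σ} x y x≢y kx ky e (normalForm pT pF g isT (inj₁ pid) isAlt eq) =
    normalForm pT (transpose x y) g isT (inj₂ (x , y , x≢y , kx , ky , λ i → refl)) isAlt
      (λ i → trans (e i) (cong (transpose x y ⟨$⟩ʳ_) (trans (eq i) (pid _))))
  absorbF {σ} x y x≢y kx ky e (normalForm pT pF g isT (inj₂ (u , v , u≢v , ku , kv , f)) isAlt eq) =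
    normalForm pT Perm.id (g ∘ₚ (transpose u v ∘ₚ transpose x y)) isT (inj₁ (λ i → refl))
      (alt-∘ isAlt (alt-two-swaps u v x y u≢v x≢y (trans ku (sym kv)) (trans ku (sym kx)) (trans ku (sym ky))) (λ i → refl))
      (λ i → trans (e i) (cong (transpose x y ⟨$⟩ʳ_) (trans (eq i) (f _))))

  -- One swap makes index `m` fixed as well: applied before `σ`, with the preimage of the index, if
  -- its colour is `true`, and after `σ`, with the image, if it is `false`. Both partners share its
  -- colour since `σ` preserves colours.
  normalise-below : ∀ m σ → Preserves σ → (∀ i → m ≤ toℕ i → σ ⟨$⟩ʳ i ≡ i) → NormalForm σ
  normalise-below zero σ pres fix =
    normalForm Perm.id Perm.id Perm.id (inj₁ (λ i → refl)) (inj₁ (λ i → refl)) (alt-id (λ i → refl)) (λ i → fix i z≤n)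
  normalise-below (suc m) σ pres fix with m ℕ.<? n
  ... | no m≮n = normalise-below m σ pres (λ i m≤i → ⊥-elim (m≮n (ℕₚ.≤-<-trans m≤i (Finₚ.toℕ<n i))))
  ... | yes m<n = go (κ i) refl
    where
    i = fromℕ< m<n
    beyond : ∀ j → m ≤ toℕ j → j ≢ i → suc m ≤ toℕ j
    beyond j m≤j j≢i = ℕₚ.≤∧≢⇒< m≤j (λ e → j≢i (Finₚ.toℕ-injective (trans (sym e) (sym (Finₚ.toℕ-fromℕ< m<n)))))
    fixed-rest : σ ⟨$⟩ʳ i ≡ i → ∀ j → m ≤ toℕ j → σ ⟨$⟩ʳ j ≡ j
    fixed-rest e j m≤j with j Finₚ.≟ i
    ... | yes refl = e
    ... | no j≢i   = fix j (beyond j m≤j j≢i)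
    y = σ ⟨$⟩ˡ i
    σy≡i : σ ⟨$⟩ʳ y ≡ i
    σy≡i = Perm.inverseʳ σ
    z = σ ⟨$⟩ʳ i
    go : ∀ b → κ i ≡ b → NormalForm σ
    go true ki with i Finₚ.≟ y
    ... | yes i≡y = normalise-below m σ pres (fixed-rest (trans (cong (σ ⟨$⟩ʳ_) i≡y) σy≡i))
    ... | no i≢y = absorbT i y i≢y ki (trans (sym κi≡κy) ki) (λ j → cong (σ ⟨$⟩ʳ_) (sym (transpose-twice i y j)))
        (normalise-below m (transpose i y ∘ₚ σ) (λ j → trans (pres _) (transpose-preserves κi≡κy j)) fix')
      where
      κi≡κy : κ i ≡ κ y
      κi≡κy = trans (cong κ (sym σy≡i)) (pres y)
      fix' : ∀ j → m ≤ toℕ j → σ ⟨$⟩ʳ (transpose i y ⟨$⟩ʳ j) ≡ j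
      fix' j m≤j with equal-or-not j i
      ... | inj₁ refl = trans (cong (σ ⟨$⟩ʳ_) (transpose-left j y)) σy≡i
      ... | inj₂ j≢i  = trans (cong (σ ⟨$⟩ʳ_) (transpose-other j≢i j≢y)) σj≡j
        where
        σj≡j = fix j (beyond j m≤j j≢i)
        j≢y : j ≢ y
        j≢y e = j≢i (trans (sym σj≡j) (trans (cong (σ ⟨$⟩ʳ_) e) σy≡i))
    go false ki with i Finₚ.≟ z
    ... | yes i≡z = normalise-below m σ pres (fixed-rest (sym i≡z))
    ... | no i≢z = absorbF i z i≢z ki (trans (pres i) ki) (λ j → sym (transpose-twice i z (σ ⟨$⟩ʳ j)))
        (normalise-below m (σ ∘ₚ transpose i z) (λ j → trans (transpose-preserves (sym (pres i)) _) (pres j)) fix')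
      where
      fix' : ∀ j → m ≤ toℕ j → transpose i z ⟨$⟩ʳ (σ ⟨$⟩ʳ j) ≡ j
      fix' j m≤j with equal-or-not j i
      ... | inj₁ refl = trans (transpose-right i (σ ⟨$⟩ʳ i)) refl
      ... | inj₂ j≢i  = trans (cong (transpose i z ⟨$⟩ʳ_) σj≡j) (transpose-other j≢i (λ e → j≢i (perm-injective σ (trans σj≡j e))))
        where
        σj≡j = fix j (beyond j m≤j j≢i)

  normalise : ∀ σ → Preserves σ → NormalForm σ
  normalise σ pres = normalise-below n σ pres (λ i n≤i → ⊥-elim (ℕₚ.<⇒≱ (Finₚ.toℕ<n i) n≤i))

  module _ (S : Fin n → Bool) (compatible : ∀ {i j} → κ i ≡ κ j → S i ≡ S j) where

    sgn-swap : ∀ {x y} → x ≢ y → κ x ≡ κ y → sgn S (transpose x y) ≡ S x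
    sgn-swap {x} {y} x≢y xy with S x in Sx
    ... | true  = sgn-transpose-in S x≢y Sx (trans (sym (compatible xy)) Sx)
    ... | false = sgn-transpose-out S x≢y Sx (trans (sym (compatible xy)) Sx)

    sgn-id : ∀ {σ} → (∀ i → σ ⟨$⟩ʳ i ≡ i) → sgn S σ ≡ false
    -- The identity is its own square, so its sign `b` satisfies `b xor b ≡ b`.
    sgn-id {σ} e = idempotent (sgn S σ)
      (trans (sym (sgn-∘ S σ σ (λ i → cong S (e i)))) (sgn-cong S {σ ∘ₚ σ} {σ} (λ i → cong (σ ⟨$⟩ʳ_) (e i))))
      where
      idempotent : ∀ b → b xor b ≡ b → b ≡ false
      idempotent false _ = refl

    sgn-alt : ∀ {σ} → Alt σ → sgn S σ ≡ false
    sgn-alt {σ} (alt-id e) = sgn-id {σ} e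
    sgn-alt {σ} (alt-gen {τ = τ} a b c p q r s t x e) = begin
      sgn S σ                                                   ≡⟨ sgn-cong S {σ} {(transpose a b ∘ₚ transpose a c) ∘ₚ τ} e ⟩
      sgn S ((transpose a b ∘ₚ transpose a c) ∘ₚ τ)             ≡⟨ sgn-∘ S (transpose a b ∘ₚ transpose a c) τ
                                                                     (λ i → compatible (trans (transpose-preserves (trans s t) _) (transpose-preserves s i))) ⟩
      sgn S (transpose a b ∘ₚ transpose a c) xor sgn S τ        ≡⟨ cong₂ _xor_ (sgn-∘ S (transpose a b) (transpose a c)
                                                                     (λ i → compatible (transpose-preserves s i))) (sgn-alt {τ} x) ⟩
      (sgn S (transpose a b) xor sgn S (transpose a c)) xor false ≡⟨ cong (_xor false) (cong₂ _xor_ (sgn-swap p s) (sgn-swap (r ∘ sym) (trans s t))) ⟩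
      (S a xor S a) xor false                                   ≡⟨ cong (_xor false) (Boolₚ.xor-same (S a)) ⟩
      false                                                     ∎
      where open ≡-Reasoning

    sgn-normal : ∀ {σ} (N : NormalForm σ) → let open NormalForm N in sgn S σ ≡ sgn S pT xor sgn S pF
    sgn-normal {σ} (normalForm pT pF g isT isF isAlt eq) = begin
      sgn S σ                          ≡⟨ sgn-cong S {σ} {pT ∘ₚ (g ∘ₚ pF)} eq ⟩
      sgn S (pT ∘ₚ (g ∘ₚ pF))          ≡⟨ sgn-∘ S pT (g ∘ₚ pF) (λ i → compatible (swap-preserves {true} {pT} isT i)) ⟩
      sgn S pT xor sgn S (g ∘ₚ pF)     ≡⟨ cong (sgn S pT xor_) (sgn-∘ S g pF (λ i → compatible (alt-preserves {g} isAlt i))) ⟩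
      sgn S pT xor (sgn S g xor sgn S pF) ≡⟨ cong (λ b → sgn S pT xor (b xor sgn S pF)) (sgn-alt {g} isAlt) ⟩
      sgn S pT xor sgn S pF            ∎
      where
      open ≡-Reasoning
      swap-preserves : ∀ {b p} → SwapOrId b p → Preserves p
      swap-preserves (inj₁ e) i = cong κ (e i)
      swap-preserves (inj₂ (x , y , x≢y , kx , ky , e)) i = trans (cong κ (e i)) (transpose-preserves (trans kx (sym ky)) i)

    sgn-other : ∀ b {p} → (∀ {i} → κ i ≡ b → S i ≡ false) → SwapOrId b p → sgn S p ≡ false
    sgn-other b {p} out (inj₁ e) = sgn-id {p} e
    sgn-other b {p} out (inj₂ (x , y , x≢y , kx , ky , e)) =
      trans (sgn-cong S {p} {transpose x y} e) (trans (sgn-swap x≢y (trans kx (sym ky))) (out kx))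

    even⇒id : ∀ b {p} → (∀ {i} → κ i ≡ b → S i ≡ true) → SwapOrId b p → sgn S p ≡ false → ∀ i → p ⟨$⟩ʳ i ≡ i
    even⇒id b {p} in' (inj₁ e) _ = e
    even⇒id b {p} in' (inj₂ (x , y , x≢y , kx , ky , e)) even =
      case trans (sym even) (trans (sgn-cong S {p} {transpose x y} e) (trans (sgn-swap x≢y (trans kx (sym ky))) (in' kx))) of λ ()

  -- In the normal form the sign on `κ` sees only `pT` and the sign on `not ∘ κ` sees only `pF`.
  -- Both being even, neither is a swap, and only the product of 3-cycles remains.
  even⇒alt : ∀ σ → Preserves σ → sgn κ σ ≡ false → sgn (not ∘ κ) σ ≡ false → Alt σ
  even⇒alt σ pres evT evF = alt-∘ {σ = pT} {τ = g ∘ₚ pF} (alt-id pT-id) (alt-∘ {τ = pF} isAlt (alt-id pF-id) (λ i → refl)) eq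
    where
    N = normalise σ pres
    open NormalForm N
    cT : ∀ {i j} → κ i ≡ κ j → κ i ≡ κ j
    cT e = e
    cF : ∀ {i j} → κ i ≡ κ j → not (κ i) ≡ not (κ j)
    cF = cong not
    pT-id : ∀ i → pT ⟨$⟩ʳ i ≡ i
    pT-id = even⇒id κ cT true {pT} (λ e → e) isT
      (trans (sym (trans (cong (sgn κ pT xor_) (sgn-other κ cT false {pF} (λ e → e) isF)) (Boolₚ.xor-identityʳ _)))
             (trans (sym (sgn-normal κ cT {σ} N)) evT))
    pF-id : ∀ i → pF ⟨$⟩ʳ i ≡ i
    pF-id = even⇒id (not ∘ κ) cF false {pF} (cong not) isF
      (trans (sym (cong (_xor sgn (not ∘ κ) pF) (sgn-other (not ∘ κ) cF true {pT} (cong not) isT)))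
             (trans (sym (sgn-normal (not ∘ κ) cF {σ} N)) evF))

-- The sign of a permutation with cycles of length four

tally : {A : Set} → (A → Bool) → List A → Bool
tally f []       = false
tally f (x ∷ xs) = f x xor tally f xs

module FourCycles {n : ℕ} (σ : Permutation′ n) (σ⁴ : ∀ i → σ ⟨$⟩ʳ (σ ⟨$⟩ʳ (σ ⟨$⟩ʳ (σ ⟨$⟩ʳ i))) ≡ i)
                  (S : Fin n → Bool) (pres : ∀ i → S (σ ⟨$⟩ʳ i) ≡ S i) where

  private
    s : Fin n → Fin n
    s i = σ ⟨$⟩ʳ i

    s-inj : ∀ {i j} → s i ≡ s j → i ≡ j
    s-inj = perm-injective σ

  Orbit : Fin n → Fin n → Set
  Orbit x i = i ≡ x ⊎ i ≡ s x ⊎ i ≡ s (s x) ⊎ i ≡ s (s (s x))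

  orbit? : ∀ x i → Dec (Orbit x i)
  orbit? x i = (i Finₚ.≟ x) ⊎-dec (i Finₚ.≟ s x) ⊎-dec (i Finₚ.≟ s (s x)) ⊎-dec (i Finₚ.≟ s (s (s x)))

  orbit-step : ∀ x i → Orbit x i → Orbit x (s i)
  orbit-step x i (inj₁ refl)                      = inj₂ (inj₁ refl)
  orbit-step x i (inj₂ (inj₁ refl))               = inj₂ (inj₂ (inj₁ refl))
  orbit-step x i (inj₂ (inj₂ (inj₁ refl)))        = inj₂ (inj₂ (inj₂ refl))
  orbit-step x i (inj₂ (inj₂ (inj₂ refl)))        = inj₁ (σ⁴ x)

  orbit-sym : ∀ x i → Orbit x i → Orbit i x
  orbit-sym x i (inj₁ refl)               = inj₁ refl
  orbit-sym x i (inj₂ (inj₁ refl))        = inj₂ (inj₂ (inj₂ (sym (σ⁴ x))))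
  orbit-sym x i (inj₂ (inj₂ (inj₁ refl))) = inj₂ (inj₂ (inj₁ (sym (σ⁴ x))))
  orbit-sym x i (inj₂ (inj₂ (inj₂ refl))) = inj₂ (inj₁ (sym (σ⁴ x)))

  orbit-trans : ∀ x y i → Orbit x y → Orbit y i → Orbit x i
  orbit-trans x y i o (inj₁ refl)               = o
  orbit-trans x y i o (inj₂ (inj₁ refl))        = orbit-step x y o
  orbit-trans x y i o (inj₂ (inj₂ (inj₁ refl))) = orbit-step x _ (orbit-step x y o)
  orbit-trans x y i o (inj₂ (inj₂ (inj₂ refl))) = orbit-step x _ (orbit-step x _ (orbit-step x y o))

  -- As `s` has order dividing four, this hypothesis alone makes the orbit of `x` have four
  -- elements.
  module _ (x : Fin n) (s²x≢x : s (s x) ≢ x) where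

    private
      x₁ = s x
      x₂ = s (s x)
      x₃ = s (s (s x))
      01≢ : x ≢ x₁
      01≢ e = s²x≢x (trans (cong s (sym e)) (sym e))
      12≢ : x₁ ≢ x₂
      12≢ e = 01≢ (s-inj e)
      23≢ : x₂ ≢ x₃
      23≢ e = 12≢ (s-inj e)
      30≢ : x₃ ≢ x
      30≢ e = 23≢ (s-inj (trans e (sym (σ⁴ x))))
      13≢ : x₁ ≢ x₃
      13≢ e = s²x≢x (sym (s-inj e))

    quad : Permutation′ n
    quad = (transpose x x₁ ∘ₚ transpose x x₂) ∘ₚ transpose x x₃

    quad-in : ∀ i → Orbit x i → quad ⟨$⟩ʳ i ≡ s i
    quad-in i (inj₁ refl)
      rewrite transpose-left i (s i) | transpose-other {x = i} {s (s i)} {s i} (01≢ ∘ sym) 12≢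
            | transpose-other {x = i} {s (s (s i))} {s i} (01≢ ∘ sym) 13≢ = refl
    quad-in i (inj₂ (inj₁ refl))
      rewrite transpose-right x x₁ | transpose-left x x₂ | transpose-other {x = x} {x₃} {x₂} s²x≢x 23≢ = refl
    quad-in i (inj₂ (inj₂ (inj₁ refl)))
      rewrite transpose-other {x = x} {x₁} {x₂} s²x≢x (12≢ ∘ sym) | transpose-right x x₂ | transpose-left x x₃ = refl
    quad-in i (inj₂ (inj₂ (inj₂ refl)))
      rewrite transpose-other {x = x} {x₁} {x₃} 30≢ (13≢ ∘ sym) | transpose-other {x = x} {x₂} {x₃} 30≢ (23≢ ∘ sym)
            | transpose-right x x₃ = sym (σ⁴ x)

    quad-out : ∀ i → ¬ Orbit x i → quad ⟨$⟩ʳ i ≡ i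
    quad-out i ∉
      rewrite transpose-other {x = x} {x₁} {i} (∉ ∘ inj₁) (∉ ∘ inj₂ ∘ inj₁)
            | transpose-other {x = x} {x₂} {i} (∉ ∘ inj₁) (∉ ∘ inj₂ ∘ inj₂ ∘ inj₁)
            | transpose-other {x = x} {x₃} {i} (∉ ∘ inj₁) (∉ ∘ inj₂ ∘ inj₂ ∘ inj₂) = refl

    sgn-quad : sgn S quad ≡ S x
    sgn-quad = begin
      sgn S quad ≡⟨ sgn-∘ S (transpose x x₁ ∘ₚ transpose x x₂) (transpose x x₃)
                      (λ i → trans (tp S02 _) (tp S01 i)) ⟩
      sgn S (transpose x x₁ ∘ₚ transpose x x₂) xor sgn S (transpose x x₃)
                 ≡⟨ cong (_xor sgn S (transpose x x₃)) (sgn-∘ S (transpose x x₁) (transpose x x₂) (tp S01)) ⟩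
      (sgn S (transpose x x₁) xor sgn S (transpose x x₂)) xor sgn S (transpose x x₃)
                 ≡⟨ cong₂ _xor_ (cong₂ _xor_ (sw 01≢ S01) (sw (s²x≢x ∘ sym) S02)) (sw (30≢ ∘ sym) S03) ⟩
      (S x xor S x) xor S x ≡⟨ cong (_xor S x) (Boolₚ.xor-same (S x)) ⟩
      S x ∎
      where
      open ≡-Reasoning
      open Alternating S using (transpose-preserves; sgn-swap)
      S01 : S x ≡ S x₁
      S01 = sym (pres x)
      S02 : S x ≡ S x₂
      S02 = trans S01 (sym (pres x₁))
      S03 : S x ≡ S x₃
      S03 = trans S02 (sym (pres x₂))
      tp : ∀ {y} → S x ≡ S y → ∀ i → S (transpose x y ⟨$⟩ʳ i) ≡ S i
      tp e = transpose-preserves e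
      sw : ∀ {y} → x ≢ y → S x ≡ S y → sgn S (transpose x y) ≡ S x
      sw = sgn-swap S (λ e → e)

  record Partial (xs : List (Fin n)) : Set where
    field
      prod    : Permutation′ n
      inside  : ∀ i → Any (λ x → Orbit x i) xs → prod ⟨$⟩ʳ i ≡ s i
      outside : ∀ i → ¬ Any (λ x → Orbit x i) xs → prod ⟨$⟩ʳ i ≡ i
      sign    : sgn S prod ≡ tally S xs

  partial-product : ∀ xs → All (λ x → s (s x) ≢ x) xs → AllPairs (λ x y → ¬ Orbit x y) xs → Partial xs
  partial-product [] [] [] = record
    { prod = Perm.id ; inside = λ i () ; outside = λ i _ → refl
    ; sign = Alternating.sgn-id S S (λ e → e) {Perm.id} (λ i → refl) }
  partial-product (x ∷ xs) (nx ∷ nxs) (dx ∷ dxs) = record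
    { prod = prod ∘ₚ quad x nx
    ; inside = ins
    ; outside = λ i ∉ → trans (cong (quad x nx ⟨$⟩ʳ_) (outside i (∉ ∘ there))) (quad-out x nx i (∉ ∘ here))
    ; sign = trans (sgn-∘ S prod (quad x nx) keeps)
               (trans (cong₂ _xor_ sign (sgn-quad x nx)) (Boolₚ.xor-comm (tally S xs) (S x))) }
    where
    open Partial (partial-product xs nxs dxs)
    any? : ∀ i → Dec (Any (λ y → Orbit y i) xs)
    any? i = Any.any? (λ y → orbit? y i) xs
    disjoint : ∀ {ys} i → All (λ y → ¬ Orbit x y) ys → Orbit x i → ¬ Any (λ y → Orbit y i) ys
    disjoint i (d ∷ _)  o (here o')  = d (orbit-trans x i _ o (orbit-sym _ i o'))
    disjoint i (_ ∷ ds) o (there o') = disjoint i ds o o'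
    ins : ∀ i → Any (λ y → Orbit y i) (x ∷ xs) → (prod ∘ₚ quad x nx) ⟨$⟩ʳ i ≡ s i
    ins i (here o) = trans (cong (quad x nx ⟨$⟩ʳ_) (outside i (disjoint i dx o))) (quad-in x nx i o)
    ins i (there a) = trans (cong (quad x nx ⟨$⟩ʳ_) (inside i a))
      (quad-out x nx (s i) (λ o → disjoint i dx (back o) a))
      where
      back : Orbit x (s i) → Orbit x i
      back o = orbit-trans x (s i) i o (orbit-sym i (s i) (inj₂ (inj₁ refl)))
    keeps : ∀ i → S (prod ⟨$⟩ʳ i) ≡ S i
    keeps i with any? i
    ... | yes a = trans (cong S (inside i a)) (pres i)
    ... | no ∉  = cong S (outside i ∉)

  -- `xs` holds one representative of each nontrivial cycle. A 4-cycle is a product of three swaps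
  -- and so contributes an odd sign exactly when it lies in `S`, which, `S` being invariant, the
  -- representative decides.
  sgn-four-cycles : ∀ xs → All (λ x → s (s x) ≢ x) xs → AllPairs (λ x y → ¬ Orbit x y) xs →
                    (∀ i → ¬ Any (λ x → Orbit x i) xs → s i ≡ i) → sgn S σ ≡ tally S xs
  sgn-four-cycles xs nx dx rest = trans (sgn-cong S {σ} {prod} agree) sign
    where
    open Partial (partial-product xs nx dx)
    agree : ∀ i → s i ≡ prod ⟨$⟩ʳ i
    agree i with Any.any? (λ y → orbit? y i) xs
    ... | yes a = sym (inside i a)
    ... | no ∉  = trans (rest i ∉) (sym (outside i ∉))

tallyℕ : ℕ → (ℕ → Bool) → Bool
tallyℕ zero    f = false
tallyℕ (suc n) f = f 0 xor tallyℕ n (f ∘ suc)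

tally-cong : {A : Set} {f g : A → Bool} → (∀ x → f x ≡ g x) → ∀ xs → tally f xs ≡ tally g xs
tally-cong e []       = refl
tally-cong e (x ∷ xs) = cong₂ _xor_ (e x) (tally-cong e xs)

tally-map : {A B : Set} (f : B → Bool) (g : A → B) (xs : List A) → tally f (map g xs) ≡ tally (f ∘ g) xs
tally-map f g []       = refl
tally-map f g (x ∷ xs) = cong (f (g x) xor_) (tally-map f g xs)

tally-++ : {A : Set} (f : A → Bool) (xs ys : List A) → tally f (xs ++ ys) ≡ tally f xs xor tally f ys
tally-++ f []       ys = refl
tally-++ f (x ∷ xs) ys = trans (cong (f x xor_) (tally-++ f xs ys)) (sym (Boolₚ.xor-assoc (f x) _ _))

tally-product : {A B : Set} (f : A × B → Bool) (xs : List A) (ys : List B) →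
                tally f (cartesianProduct xs ys) ≡ tally (λ x → tally (λ y → f (x , y)) ys) xs
tally-product f []       ys = refl
tally-product f (x ∷ xs) ys = trans (tally-++ f (map (x ,_) ys) _)
  (cong₂ _xor_ (tally-map f (x ,_) ys) (tally-product f xs ys))

tally-allFin : ∀ n (f : ℕ → Bool) → tally (f ∘ toℕ) (allFin n) ≡ tallyℕ n f
tally-allFin n f = go n (λ i → i) f {f} (λ i → refl)
  where
  go : ∀ {m} n (g : Fin n → Fin m) (f : ℕ → Bool) {h : ℕ → Bool} → (∀ i → h (toℕ (g i)) ≡ f (toℕ i)) →
       tally (h ∘ toℕ) (tabulate g) ≡ tallyℕ n f
  go zero    g f e = refl
  go (suc n) g f {h} e = cong₂ _xor_ (e zero) (go n (λ i → g (suc i)) (λ i → f (suc i)) {h} (λ i → e (suc i)))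

tallyℕ-cong : ∀ n {f g : ℕ → Bool} → (∀ i → f i ≡ g i) → tallyℕ n f ≡ tallyℕ n g
tallyℕ-cong zero    e = refl
tallyℕ-cong (suc n) e = cong₂ _xor_ (e 0) (tallyℕ-cong n (λ i → e (suc i)))

tallyℕ-const : ∀ n b → tallyℕ n (λ _ → b) ≡ odd n ∧ b
tallyℕ-const zero    b = refl
tallyℕ-const (suc n) b = trans (cong (b xor_) (tallyℕ-const n b)) (lemma (odd n) b)
  where
  lemma : ∀ o b → b xor (o ∧ b) ≡ not o ∧ b
  lemma true  true  = refl
  lemma true  false = refl
  lemma false true  = refl
  lemma false false = refl

-- The terms pair up into `n` consecutive pairs, each with exactly one `true`.
tallyℕ-alternating : ∀ n (f : ℕ → Bool) → (∀ i → f (suc i) ≡ not (f i)) → tallyℕ (n ℕ.+ n) f ≡ odd n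
tallyℕ-alternating zero    f alt = refl
tallyℕ-alternating (suc n) f alt rewrite ℕₚ.+-suc n n | alt 0 =
  trans (lemma (f 0) _) (cong not (tallyℕ-alternating n (λ i → f (suc (suc i))) (λ i → alt (suc (suc i)))))
  where
  lemma : ∀ a b → a xor (not a xor b) ≡ not b
  lemma true  b = refl
  lemma false b = refl

-- The puzzle group of a figure

⊹-injective : ∀ p {i j i' j'} → p ⊹ (i , j) ≡ p ⊹ (i' , j') → i ≡ i' × j ≡ j'
⊹-injective (a , b) e = cancel a (cong proj₁ e) , cancel b (cong proj₂ e)
  where
  cancel : ∀ x {i j} → x ℤ.+ + i ≡ x ℤ.+ + j → i ≡ j
  cancel x {i} {j} e' = ℤₚ.+-injective
    (trans (sym (x+i-x x (+ i))) (trans (cong (ℤ._- x) e') (x+i-x x (+ j))))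

-- Since `A + B` exceeds `a + a'` by one, `a < A` and `a' < B` cannot both hold.
complement-≥ : ∀ {a a' A B K} → a ℕ.+ a' ≡ K → A ℕ.+ B ≡ suc K → a < A → B ≤ a'
complement-≥ {a} {a'} {A} {B} refl s a<A = ℕₚ.≮⇒≥ λ a'<B →
  ℕₚ.<-irrefl refl (ℕₚ.≤-trans (s≤s (ℕₚ.≤-reflexive (sym (ℕₚ.+-suc a a'))))
    (subst (suc (a ℕ.+ suc a') ≤_) s (ℕₚ.+-mono-≤ a<A a'<B)))

complement-< : ∀ {a a' A B K} → a ℕ.+ a' ≡ K → A ℕ.+ B ≡ suc K → A ≤ a → a' < B
complement-< {a} {a'} {A} {B} refl s A≤a = ℕₚ.≰⇒> λ B≤a' →
  ℕₚ.<-irrefl refl (subst (_≤ a ℕ.+ a') s (ℕₚ.+-mono-≤ A≤a B≤a'))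

-- Constant for even `k`, so that one notion of colour-preserving 3-cycle serves both parities.
colour : ℕ → Cell → Bool
colour k c = if odd k then black c else true

module Figure (k : ℕ) (rs : List Rect) {n : ℕ} (e : Fin n → Cell) (e-inj : Injective _≡_ _≡_ e)
              (e-in : ∀ i → InFig k rs (e i)) (e-onto : ∀ c → InFig k rs c → ∃[ i ] e i ≡ c) where

  F : Cell → Set
  F = InFig k rs

  rot-stays : ∀ p → (∀ i j → i < k → j < k → F (p ⊹ (i , j))) → ∀ c → F c → F (rot k p c)
  rot-stays p o c Fc with inBlock? k p c
  ... | no c∉ = subst F (sym (rot-out k p c c∉)) Fc
  ... | yes (i , j , i<k , j<k , refl) with complement i<k
  ... | i' , ei , i'<k = subst F (sym (rot-in k p ei i<k j<k)) (o j i' j<k i'<k)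

  move-stays : ∀ m → MoveOk k F m → ∀ c → F c → F (move k m c)
  move-stays (p , true)  o c Fc = rot-stays p o c Fc
  move-stays (p , false) o c Fc = rot-stays p o _ (rot-stays p o _ (rot-stays p o c Fc))

  run-stays : ∀ w → Ok k F w → ∀ c → F c → F (run k w c)
  run-stays []      []       c Fc = Fc
  run-stays (m ∷ w) (o ∷ os) c Fc = move-stays m o _ (run-stays w os c Fc)

  ix : ∀ c → F c → Fin n
  ix c Fc = proj₁ (e-onto c Fc)

  e-ix : ∀ c Fc → e (ix c Fc) ≡ c
  e-ix c Fc = proj₂ (e-onto c Fc)

  opaque
    permOf : ∀ w → Ok k F w → Permutation′ n
    permOf w ok = permutation to from to-from from-to
      where
      ok' : Ok k F (inverse w)
      ok' = Ok-inverse {k} {F} w ok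
      to from : Fin n → Fin n
      to i   = ix (run k w (e i)) (run-stays w ok (e i) (e-in i))
      from i = ix (run k (inverse w) (e i)) (run-stays (inverse w) ok' (e i) (e-in i))
      to-from : ∀ i → to (from i) ≡ i
      to-from i = e-inj (trans (e-ix _ _) (trans (cong (run k w) (e-ix _ _)) (inverseʳ k w (e i))))
      from-to : ∀ i → from (to i) ≡ i
      from-to i = e-inj (trans (e-ix _ _) (trans (cong (run k (inverse w)) (e-ix _ _)) (inverseˡ k w (e i))))

    e-permOf : ∀ w ok i → e (permOf w ok ⟨$⟩ʳ i) ≡ run k w (e i)
    e-permOf w ok i = e-ix _ _

  G : Permutation′ n → Set
  G σ = ∃[ w ] (Ok k F w × (∀ i → e (σ ⟨$⟩ʳ i) ≡ run k w (e i)))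

  G⇒InG : ∀ {σ} → G σ → InG k rs e σ
  G⇒InG (w , ok , eq) = w , ok , λ i → trans (eq i) (run≡act k w (e i))

  InG⇒G : ∀ {σ} → InG k rs e σ → G σ
  InG⇒G (w , ok , eq) = w , ok , λ i → trans (eq i) (sym (run≡act k w (e i)))

  G-∘ : ∀ {σ τ} → G σ → G τ → G (σ ∘ₚ τ)
  G-∘ {σ} (w , ok , eq) (v , ok' , eq') =
    v ++ w , Allₚ.++⁺ ok' ok , λ i → trans (eq' (σ ⟨$⟩ʳ i)) (trans (cong (run k v) (eq i)) (sym (run-++ k v w (e i))))

  G-≈ : ∀ {σ τ} → τ ≈ₚ σ → G σ → G τ
  G-≈ f (w , ok , eq) = w , ok , λ i → trans (cong e (f i)) (eq i)

  κ : Fin n → Bool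
  κ i = colour k (e i)

  κ-same : ∀ {i j} → κ i ≡ κ j → odd k ≡ true → black (e i) ≡ black (e j)
  κ-same e o rewrite o = e

  open Alternating κ

  cycle-in-G : LinkedFigure k rs → ∀ a b c → a ≢ b → b ≢ c → c ≢ a → κ a ≡ κ b → κ b ≡ κ c →
               G (transpose a b ∘ₚ transpose a c)
  cycle-in-G linked a b c a≢b b≢c c≢a ab bc = word , ok , acts
    where
    link : ∀ i j → κ i ≡ κ j → Linked k F (e i) (e j)
    link i j ij = linked (e i) (e j) (e-in i) (e-in j) (κ-same ij)
    open ThreeCycle (linked⇒cycle (a≢b ∘ e-inj) (b≢c ∘ e-inj) (c≢a ∘ e-inj) (link a b ab) (link b c bc))
    acts : ∀ i → e ((transpose a b ∘ₚ transpose a c) ⟨$⟩ʳ i) ≡ run k word (e i)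
    acts i with position a b i
    ... | inj₁ refl = trans (cong e (trans (cong (transpose a c ⟨$⟩ʳ_) (transpose-left a b))
                        (transpose-other (a≢b ∘ sym) b≢c))) (sym p↦q)
    ... | inj₂ (inj₁ refl) = trans (cong e (trans (cong (transpose a c ⟨$⟩ʳ_) (transpose-right a b))
                               (transpose-left a c))) (sym q↦r)
    ... | inj₂ (inj₂ (i≢a , i≢b)) with position a c i
    ... | inj₁ i≡a = ⊥-elim (i≢a i≡a)
    ... | inj₂ (inj₁ refl) = trans (cong e (trans (cong (transpose a c ⟨$⟩ʳ_) (transpose-other i≢a i≢b))
                               (transpose-right a c))) (sym r↦p)
    ... | inj₂ (inj₂ (_ , i≢c)) = trans (cong e (trans (cong (transpose a c ⟨$⟩ʳ_) (transpose-other i≢a i≢b))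
                               (transpose-other i≢a i≢c)))
                               (sym (fix (e i) (i≢a ∘ e-inj) (i≢b ∘ e-inj) (i≢c ∘ e-inj)))

  alt⇒G : LinkedFigure k rs → ∀ {σ} → Alt σ → G σ
  alt⇒G linked (alt-id f) = [] , [] , λ i → cong e (f i)
  alt⇒G linked {σ} (alt-gen {τ = τ} a b c p q r s t x f) =
    G-≈ {(transpose a b ∘ₚ transpose a c) ∘ₚ τ} {σ} f
      (G-∘ {transpose a b ∘ₚ transpose a c} {τ} (cycle-in-G linked a b c p q r s t) (alt⇒G linked x))

  -- The inequalities force `A = ⌈k/2⌉` and `B = ⌊k/2⌋`. The invariant set `s`, given on the block
  -- by `f`, selects the tiles on which the sign is taken.
  module Rotation (K : ℕ) (k≡ : k ≡ suc K) (A B : ℕ) (A+B≡k : A ℕ.+ B ≡ suc K) (B≤A : B ≤ A) (A≤1+B : A ≤ suc B)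
                  (p : Cell) (blockIn : ∀ i j → i < k → j < k → F (p ⊹ (i , j)))
                  (s : Cell → Bool) (f : ℕ → ℕ → Bool) (s-block : ∀ i j → s (p ⊹ (i , j)) ≡ f i j)
                  (s-pres : ∀ c → F c → s (rot k p c) ≡ s c) where

    ρ : Permutation′ n
    ρ = permOf ((p , true) ∷ []) (blockIn ∷ [])

    S : Fin n → Bool
    S i = s (e i)

    e-ρ : ∀ i → e (ρ ⟨$⟩ʳ i) ≡ rot k p (e i)
    e-ρ i = e-permOf ((p , true) ∷ []) (blockIn ∷ []) i

    ρ⁴ : ∀ i → ρ ⟨$⟩ʳ (ρ ⟨$⟩ʳ (ρ ⟨$⟩ʳ (ρ ⟨$⟩ʳ i))) ≡ i
    ρ⁴ i = e-inj (trans (e-ρ _) (trans (cong (rot k p) (trans (e-ρ _) (cong (rot k p) (trans (e-ρ _)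
             (cong (rot k p) (e-ρ i)))))) (rot⁴ k p (e i))))

    ρ-pres : ∀ i → S (ρ ⟨$⟩ʳ i) ≡ S i
    ρ-pres i = trans (cong s (e-ρ i)) (s-pres (e i) (e-in i))

    open FourCycles ρ ρ⁴ S ρ-pres

    record At (i i' j j' : ℕ) (q : Fin n) : Set where
      constructor at
      field
        eq  : e q ≡ p ⊹ (i , j)
        i+i' : i ℕ.+ i' ≡ K
        j+j' : j ℕ.+ j' ≡ K
    open At

    ≤K : ∀ {a a'} → a ℕ.+ a' ≡ K → a < k
    ≤K {a} {a'} refl = subst (a <_) (sym k≡) (s≤s (ℕₚ.m≤m+n a a'))

    at-step : ∀ {i i' j j' q} → At i i' j j' q → At j j' i' i (ρ ⟨$⟩ʳ q)
    at-step {i} {i'} {j} {j'} {q} (at eq ei ej) = at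
      (trans (e-ρ q) (trans (cong (rot k p) eq) (rot-in k p (trans ei (cong (_∸ 1) (sym k≡))) (≤K ei) (≤K ej))))
      ej (trans (ℕₚ.+-comm i' i) ei)

    A≤k : ∀ {i} → i < A → i < k
    A≤k i<A = ℕₚ.<-≤-trans i<A (ℕₚ.≤-trans (ℕₚ.m≤m+n A B) (ℕₚ.≤-reflexive (trans A+B≡k (sym k≡))))

    B≤k : ∀ {j} → j < B → j < k
    B≤k j<B = A≤k (ℕₚ.<-≤-trans j<B B≤A)

    rep : Fin A × Fin B → Fin n
    rep (i , j) = ix (p ⊹ (toℕ i , toℕ j)) (blockIn _ _ (A≤k (Finₚ.toℕ<n i)) (B≤k (Finₚ.toℕ<n j)))

    e-rep : ∀ ij → e (rep ij) ≡ p ⊹ (toℕ (proj₁ ij) , toℕ (proj₂ ij))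
    e-rep ij = e-ix _ _

    co : ∀ {a} → a < k → ∃[ a' ] a ℕ.+ a' ≡ K
    co a<k = let a' , ea , _ = complement a<k in a' , trans ea (cong (_∸ 1) k≡)

    at-rep : ∀ ij → ∃[ i' ] ∃[ j' ] (At (toℕ (proj₁ ij)) i' (toℕ (proj₂ ij)) j' (rep ij) × B ≤ i' × A ≤ j')
    at-rep ij@(i , j) with co (A≤k (Finₚ.toℕ<n i)) | co (B≤k (Finₚ.toℕ<n j))
    ... | i' , ei | j' , ej = i' , j' , at (e-rep ij) ei ej ,
      complement-≥ ei A+B≡k (Finₚ.toℕ<n i) , complement-≥ ej (trans (ℕₚ.+-comm B A) A+B≡k) (Finₚ.toℕ<n j)

    xs : List (Fin n)
    xs = map rep (cartesianProduct (allFin A) (allFin B))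

    moved : ∀ ij → ρ ⟨$⟩ʳ (ρ ⟨$⟩ʳ rep ij) ≢ rep ij
    moved ij@(i , j) e≡ with at-rep ij
    ... | i' , j' , a , B≤i' , A≤j' = ℕₚ.<-irrefl
      (proj₂ (⊹-injective p (trans (sym (e-rep ij)) (trans (cong e (sym e≡)) (eq (at-step (at-step a)))))))
      (ℕₚ.<-≤-trans (Finₚ.toℕ<n j) (ℕₚ.≤-trans B≤A A≤j'))

    -- The rotated images of `(i , j)` are `(j , i')`, `(i' , j')` and `(j' , i)`. From `B ≤ i'` and
    -- `B ≤ A ≤ j'`, each of them violates a bound of the domain `i < A`, `j < B`.
    orbits-disjoint : ∀ {x y} → x ≢ y → ¬ Orbit (rep x) (rep y)
    orbits-disjoint {x@(i , j)} {y@(i₂ , j₂)} x≢y o with at-rep x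
    ... | i' , j' , a , B≤i' , A≤j' = go o
      where
      meets : ∀ {u u' v v' q} → At u u' v v' q → rep y ≡ q → toℕ i₂ ≡ u × toℕ j₂ ≡ v
      meets b r = ⊹-injective p (trans (sym (e-rep y)) (trans (cong e r) (eq b)))
      go : Orbit (rep x) (rep y) → ⊥
      go (inj₁ r) = let u , v = meets a r in
        x≢y (sym (cong₂ _,_ (Finₚ.toℕ-injective u) (Finₚ.toℕ-injective v)))
      go (inj₂ (inj₁ r)) = ℕₚ.<-irrefl (proj₂ (meets (at-step a) r)) (ℕₚ.<-≤-trans (Finₚ.toℕ<n j₂) B≤i')
      go (inj₂ (inj₂ (inj₁ r))) = ℕₚ.<-irrefl (proj₂ (meets (at-step (at-step a)) r))
        (ℕₚ.<-≤-trans (Finₚ.toℕ<n j₂) (ℕₚ.≤-trans B≤A A≤j'))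
      go (inj₂ (inj₂ (inj₂ r))) = ℕₚ.<-irrefl (proj₁ (meets (at-step (at-step (at-step a))) r))
        (ℕₚ.<-≤-trans (Finₚ.toℕ<n i₂) A≤j')

    found : ∀ {i i' j j' q' q} → At i i' j j' q' → i < A → j < B → Orbit q' q → Any (λ x → Orbit x q) xs
    found {i} {i'} {j} {j'} {q'} {q} a i<A j<B o =
      Anyₚ.map⁺ (lose (∈-cartesianProduct⁺ (∈-allFin (fromℕ< i<A)) (∈-allFin (fromℕ< j<B)))
        (subst (λ x → Orbit x q) (e-inj (trans (eq a)
          (trans (cong (p ⊹_) (cong₂ _,_ (sym (Finₚ.toℕ-fromℕ< i<A)) (sym (Finₚ.toℕ-fromℕ< j<B))))
            (sym (e-rep (fromℕ< i<A , fromℕ< j<B)))))) o))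

    -- The domain i < A, j < B meets every orbit, except that of the centre.
    cover : ∀ {i i' j j' q} → At i i' j j' q → Any (λ x → Orbit x q) xs ⊎ ρ ⟨$⟩ʳ q ≡ q
    cover {i} {i'} {j} {j'} {q} a with i ℕ.<? A | j ℕ.<? B | j ℕ.<? A | i ℕ.<? B
    ... | yes i<A | yes j<B | _ | _ = inj₁ (found a i<A j<B (inj₁ refl))
    ... | no i≮A | _ | yes j<A | _ = inj₁ (found (at-step a) j<A i'<B (orbit-sym q _ (inj₂ (inj₁ refl))))
      where
      i'<B = complement-< (i+i' a) A+B≡k (ℕₚ.≮⇒≥ i≮A)
    ... | no i≮A | _ | no j≮A | _ = inj₁ (found (at-step (at-step a)) (ℕₚ.<-≤-trans i'<B B≤A) j'<B
                                      (orbit-sym q _ (inj₂ (inj₂ (inj₁ refl)))))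
      where
      i'<B = complement-< (i+i' a) A+B≡k (ℕₚ.≮⇒≥ i≮A)
      j'<B = complement-< (j+j' a) A+B≡k (ℕₚ.≮⇒≥ j≮A)
    ... | yes i<A | no j≮B | _ | yes i<B = inj₁ (found (at-step (at-step (at-step a))) j'<A i<B
                                             (orbit-sym q _ (inj₂ (inj₂ (inj₂ refl)))))
      where
      j'<A = complement-< (j+j' a) (trans (ℕₚ.+-comm B A) A+B≡k) (ℕₚ.≮⇒≥ j≮B)
    ... | yes i<A | no j≮B | no j≮A | no i≮B = inj₁ (found (at-step (at-step a)) i'<A j'<B
                                                 (orbit-sym q _ (inj₂ (inj₂ (inj₁ refl)))))
      where
      i'<A = complement-< (i+i' a) (trans (ℕₚ.+-comm B A) A+B≡k) (ℕₚ.≮⇒≥ i≮B)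
      j'<B = complement-< (j+j' a) A+B≡k (ℕₚ.≮⇒≥ j≮A)
    ... | yes i<A | no j≮B | yes j<A | no i≮B = inj₂ (e-inj (trans (eq (at-step a))
            (trans (cong (p ⊹_) (cong₂ _,_ (trans j≡B (sym i≡B)) (trans i'≡B (sym j≡B)))) (sym (eq a)))))
      where
      i≡B : i ≡ B
      i≡B = ℕₚ.≤-antisym (ℕₚ.≤-pred (ℕₚ.<-≤-trans i<A A≤1+B)) (ℕₚ.≮⇒≥ i≮B)
      j≡B : j ≡ B
      j≡B = ℕₚ.≤-antisym (ℕₚ.≤-pred (ℕₚ.<-≤-trans j<A A≤1+B)) (ℕₚ.≮⇒≥ j≮B)
      i'≡B : i' ≡ B
      i'≡B = ℕₚ.≤-antisym
        (ℕₚ.≤-pred (ℕₚ.<-≤-trans (complement-< (i+i' a) (trans (ℕₚ.+-comm B A) A+B≡k) (ℕₚ.≮⇒≥ i≮B)) A≤1+B))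
        (complement-≥ (i+i' a) A+B≡k i<A)

    rest : ∀ q → ¬ Any (λ x → Orbit x q) xs → ρ ⟨$⟩ʳ q ≡ q
    rest q ∉ = go (inBlock? k p (e q))
      where
      settled : ∀ {i i' j j'} → At i i' j j' q → ρ ⟨$⟩ʳ q ≡ q
      settled a = Sum.[ ⊥-elim ∘ ∉ , (λ f → f) ] (cover a)
      go : Dec (InBlock k p (e q)) → ρ ⟨$⟩ʳ q ≡ q
      go (no c∉) = e-inj (trans (e-ρ q) (rot-out k p (e q) c∉))
      go (yes (i , j , i<k , j<k , eq)) = settled (at eq (proj₂ (co i<k)) (proj₂ (co j<k)))

    sgn-rotation : sgn S ρ ≡ tallyℕ A (λ i → tallyℕ B (f i))
    sgn-rotation = begin
      sgn S ρ ≡⟨ sgn-four-cycles xs (Allₚ.map⁺ (All.universal moved _))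
                   (AllPairsₚ.map⁺ (AllPairs.map orbits-disjoint (cartesianProduct⁺ (allFin⁺ A) (allFin⁺ B)))) rest ⟩
      tally S xs ≡⟨ tally-map S rep (cartesianProduct (allFin A) (allFin B)) ⟩
      tally (S ∘ rep) (cartesianProduct (allFin A) (allFin B))
        ≡⟨ tally-cong (λ ij → trans (cong s (e-rep ij)) (s-block (toℕ (proj₁ ij)) (toℕ (proj₂ ij))))
             (cartesianProduct (allFin A) (allFin B)) ⟩
      tally (λ ij → f (toℕ (proj₁ ij)) (toℕ (proj₂ ij))) (cartesianProduct (allFin A) (allFin B))
        ≡⟨ tally-product (λ ij → f (toℕ (proj₁ ij)) (toℕ (proj₂ ij))) (allFin A) (allFin B) ⟩
      tally (λ i → tally (λ j → f (toℕ i) (toℕ j)) (allFin B)) (allFin A)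
        ≡⟨ tally-cong (λ i → tally-allFin B (f (toℕ i))) (allFin A) ⟩
      tally (λ i → tallyℕ B (f (toℕ i))) (allFin A) ≡⟨ tally-allFin A (λ i → tallyℕ B (f i)) ⟩
      tallyℕ A (λ i → tallyℕ B (f i)) ∎
      where open ≡-Reasoning

  module WordSign (s : Cell → Bool) (θ : Bool)
    (s-pres : ∀ p → MoveOk k F (p , true) → ∀ c → F c → s (rot k p c) ≡ s c)
    (sgn-rot : ∀ p (o : MoveOk k F (p , true)) → sgn (s ∘ e) (permOf ((p , true) ∷ []) (o ∷ [])) ≡ θ) where

    S : Fin n → Bool
    S = s ∘ e

    move-pres : ∀ m → MoveOk k F m → ∀ c → F c → s (move k m c) ≡ s c
    move-pres (p , true)  o c Fc = s-pres p o c Fc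
    move-pres (p , false) o c Fc =
      trans (s-pres p o _ (rot-stays p o _ (rot-stays p o c Fc)))
        (trans (s-pres p o _ (rot-stays p o c Fc)) (s-pres p o c Fc))

    run-pres : ∀ w → Ok k F w → ∀ c → F c → s (run k w c) ≡ s c
    run-pres []      []       c Fc = refl
    run-pres (m ∷ w) (o ∷ os) c Fc = trans (move-pres m o _ (run-stays w os c Fc)) (run-pres w os c Fc)

    perm-pres : ∀ w ok i → S (permOf w ok ⟨$⟩ʳ i) ≡ S i
    perm-pres w ok i = trans (cong s (e-permOf w ok i)) (run-pres w ok (e i) (e-in i))

    -- A counter-clockwise move is the cube of a clockwise one and therefore has the same sign.
    sgn-move : ∀ m (o : MoveOk k F m) → sgn S (permOf (m ∷ []) (o ∷ [])) ≡ θ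
    sgn-move (p , true)  o = sgn-rot p o
    sgn-move (p , false) o = begin
      sgn S (permOf ((p , false) ∷ []) (o ∷ [])) ≡⟨ sgn-cong S {permOf ((p , false) ∷ []) (o ∷ [])} {(ρ ∘ₚ ρ) ∘ₚ ρ} thrice ⟩
      sgn S ((ρ ∘ₚ ρ) ∘ₚ ρ)            ≡⟨ sgn-∘ S (ρ ∘ₚ ρ) ρ (λ i → trans (pr _) (pr i)) ⟩
      sgn S (ρ ∘ₚ ρ) xor sgn S ρ       ≡⟨ cong (_xor sgn S ρ) (sgn-∘ S ρ ρ pr) ⟩
      (sgn S ρ xor sgn S ρ) xor sgn S ρ ≡⟨ cong (_xor sgn S ρ) (Boolₚ.xor-same (sgn S ρ)) ⟩
      sgn S ρ                          ≡⟨ sgn-rot p o ⟩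
      θ                                ∎
      where
      open ≡-Reasoning
      ρ = permOf ((p , true) ∷ []) (o ∷ [])
      pr : ∀ i → S (ρ ⟨$⟩ʳ i) ≡ S i
      pr = perm-pres ((p , true) ∷ []) (o ∷ [])
      eρ : ∀ i → e (ρ ⟨$⟩ʳ i) ≡ rot k p (e i)
      eρ = e-permOf ((p , true) ∷ []) (o ∷ [])
      thrice : ∀ i → permOf ((p , false) ∷ []) (o ∷ []) ⟨$⟩ʳ i ≡ ρ ⟨$⟩ʳ (ρ ⟨$⟩ʳ (ρ ⟨$⟩ʳ i))
      thrice i = e-inj (trans (e-permOf ((p , false) ∷ []) (o ∷ []) i)
        (sym (trans (eρ _) (cong (rot k p) (trans (eρ _) (cong (rot k p) (eρ i)))))))

    sgn-word : ∀ w ok → sgn S (permOf w ok) ≡ odd (length w) ∧ θ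
    sgn-word [] [] = Alternating.sgn-id S S (λ x → x) {permOf [] []} (λ i → e-inj (e-permOf [] [] i))
    sgn-word (m ∷ w) (o ∷ os) = begin
      sgn S (permOf (m ∷ w) (o ∷ os))        ≡⟨ sgn-cong S {permOf (m ∷ w) (o ∷ os)} {permOf w os ∘ₚ permOf (m ∷ []) (o ∷ [])} split ⟩
      sgn S (permOf w os ∘ₚ permOf (m ∷ []) (o ∷ [])) ≡⟨ sgn-∘ S (permOf w os) (permOf (m ∷ []) (o ∷ [])) (perm-pres w os) ⟩
      sgn S (permOf w os) xor sgn S (permOf (m ∷ []) (o ∷ [])) ≡⟨ cong₂ _xor_ (sgn-word w os) (sgn-move m o) ⟩
      (odd (length w) ∧ θ) xor θ             ≡⟨ lemma (odd (length w)) θ ⟩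
      not (odd (length w)) ∧ θ               ∎
      where
      open ≡-Reasoning
      lemma : ∀ a b → (a ∧ b) xor b ≡ not a ∧ b
      lemma true  true  = refl
      lemma true  false = refl
      lemma false b     = refl
      split : ∀ i → permOf (m ∷ w) (o ∷ os) ⟨$⟩ʳ i ≡ permOf (m ∷ []) (o ∷ []) ⟨$⟩ʳ (permOf w os ⟨$⟩ʳ i)
      split i = e-inj (trans (e-permOf (m ∷ w) (o ∷ os) i)
        (sym (trans (e-permOf (m ∷ []) (o ∷ []) _) (cong (move k m) (e-permOf w os i)))))

    -- The sign depends on the word only through its length, so one word yields the signs on both
    -- colours together.
    sgn-G : ∀ σ → ((w , _) : G σ) → sgn S σ ≡ odd (length w) ∧ θ
    sgn-G σ (w , ok , eq) = trans (sgn-cong S {σ} {permOf w ok} (λ i → e-inj (trans (eq i) (sym (e-permOf w ok i)))))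
                              (sgn-word w ok)

-- The sign of a rotation and the groups of linked figures

module _ {n : ℕ} where

  sgn-ext : ∀ {S S' : Fin n → Bool} σ → (∀ i → S i ≡ S' i) → sgn S σ ≡ sgn S' σ
  sgn-ext {S} {S'} σ e = cong odd (trans (inversions-∑< S σ) (trans
    (∑∑-cong (λ i j → cong₂ (λ x y → bit (lt i j) ℕ.* bit (x ∧ y ∧ (lt i j xor lt (σ ⟨$⟩ʳ i) (σ ⟨$⟩ʳ j)))) (e i) (e j)))
    (sym (inversions-∑< S' σ))))

  -- The inversion count on the empty set computes to a value that does not mention the permutation,
  -- so `σ` and its square have equal signs; the square is even.
  sgn-empty : ∀ (S : Fin n → Bool) σ → (∀ i → S i ≡ false) → sgn S σ ≡ false
  sgn-empty S σ e = begin
    sgn S σ                     ≡⟨ sgn-ext {S} {λ _ → false} σ e ⟩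
    sgn (λ _ → false) σ         ≡⟨ vacuous σ (σ ∘ₚ σ) ⟩
    sgn (λ _ → false) (σ ∘ₚ σ)  ≡⟨ sgn-∘ (λ _ → false) σ σ (λ i → refl) ⟩
    sgn (λ _ → false) σ xor sgn (λ _ → false) σ ≡⟨ Boolₚ.xor-same (sgn (λ _ → false) σ) ⟩
    false                       ∎
    where
    open ≡-Reasoning
    vacuous : ∀ (σ τ : Permutation′ n) → sgn (λ _ → false) σ ≡ sgn (λ _ → false) τ
    vacuous σ τ = refl

EvenOn⇒sgn : ∀ {n} {S : Fin n → Bool} {σ} → EvenOn S σ → sgn S σ ≡ false
EvenOn⇒sgn {S = S} {σ} = %2⇒even {inversionsOn S σ}

sgn⇒EvenOn : ∀ {n} {S : Fin n → Bool} {σ} → sgn S σ ≡ false → EvenOn S σ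
sgn⇒EvenOn {S = S} {σ} = even⇒%2 {inversionsOn S σ}

tally-square : ∀ h → tallyℕ h (λ i → tallyℕ h (λ j → true)) ≡ odd h
tally-square h = trans (tallyℕ-const h _) (trans (cong (odd h ∧_) (tallyℕ-const h true)) (lemma (odd h)))
  where
  lemma : ∀ b → b ∧ (b ∧ true) ≡ b
  lemma true  = refl
  lemma false = refl

not-xor : ∀ c b → c xor not b ≡ not (c xor b)
not-xor c b = sym (Boolₚ.not-distribʳ-xor c b)

-- Here `k = 4 v + 1`: each of the `2 v + 1` rows has `v` tiles of either colour.
tally-1mod4 : ∀ c v → tallyℕ (suc (v ℕ.+ v)) (λ i → tallyℕ (v ℕ.+ v) (λ j → c xor odd (i ℕ.+ j))) ≡ odd v
tally-1mod4 c v = begin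
  tallyℕ (suc (v ℕ.+ v)) (λ i → tallyℕ (v ℕ.+ v) (λ j → c xor odd (i ℕ.+ j)))
    ≡⟨ tallyℕ-cong (suc (v ℕ.+ v)) (λ i → tallyℕ-alternating v (λ j → c xor odd (i ℕ.+ j))
         (λ j → trans (cong (λ m → c xor odd m) (ℕₚ.+-suc i j)) (not-xor c (odd (i ℕ.+ j))))) ⟩
  tallyℕ (suc (v ℕ.+ v)) (λ i → odd v)  ≡⟨ tallyℕ-const (suc (v ℕ.+ v)) (odd v) ⟩
  not (odd (v ℕ.+ v)) ∧ odd v           ≡⟨ cong (λ b → not b ∧ odd v) (trans (odd-+ v v) (Boolₚ.xor-same (odd v))) ⟩
  odd v                                 ∎
  where open ≡-Reasoning

-- Here `k = 4 v + 3`: the rows have odd length and begin with alternating colours, so their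
-- parities alternate over `2 (v + 1)` rows.
tally-3mod4 : ∀ c v → tallyℕ (suc v ℕ.+ suc v) (λ i → tallyℕ (suc (v ℕ.+ v)) (λ j → c xor odd (i ℕ.+ j))) ≡ odd (suc v)
tally-3mod4 c v = tallyℕ-alternating (suc v) g (λ i → trans (row (suc i)) (trans
    (cong (_xor odd v) (not-xor c (odd (i ℕ.+ 0)))) (trans (sym (Boolₚ.not-distribˡ-xor (c xor odd (i ℕ.+ 0)) (odd v)))
    (cong not (sym (row i))))))
  where
  g : ℕ → Bool
  g i = tallyℕ (suc (v ℕ.+ v)) (λ j → c xor odd (i ℕ.+ j))
  row : ∀ i → g i ≡ (c xor odd (i ℕ.+ 0)) xor odd v
  row i = cong ((c xor odd (i ℕ.+ 0)) xor_) (tallyℕ-alternating v (λ j → c xor odd (i ℕ.+ suc j))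
            (λ j → trans (cong (λ m → c xor odd m) (ℕₚ.+-suc i (suc j))) (not-xor c (odd (i ℕ.+ suc j)))))

module Parity (k : ℕ) (rs : List Rect) (adm : Admissible k rs) {n : ℕ} (e : Fin n → Cell)
              (e-inj : Injective _≡_ _≡_ e)
              (e-in : ∀ i → InFig k rs (e i)) (e-onto : ∀ c → InFig k rs c → ∃[ i ] e i ≡ c) where

  open Figure k rs e e-inj e-in e-onto

  a-block : ∃[ p ] MoveOk k F (p , true)
  a-block with oldest k rs adm
  ... | rect p true  , sub = p , λ i j i<k j<k → sub _ (i , j , ℕₚ.m<n⇒m<1+n i<k , j<k , refl)
  ... | rect p false , sub = p , λ i j i<k j<k → sub _ (i , j , i<k , ℕₚ.m<n⇒m<1+n j<k , refl)

  generator : Permutation′ n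
  generator = permOf ((proj₁ a-block , true) ∷ []) (proj₂ a-block ∷ [])

  -- When rotations are odd, this reduces the odd permutations to the even ones.
  G-generator : ∀ σ → G (generator ∘ₚ σ) → G σ
  G-generator σ g = G-≈ {back ∘ₚ (generator ∘ₚ σ)} {σ} (λ i → cong (σ ⟨$⟩ʳ_) (sym (cancel i)))
    (G-∘ {back} {generator ∘ₚ σ} (((p , false) ∷ []) , (o ∷ []) , e-permOf ((p , false) ∷ []) (o ∷ [])) g)
    where
    p = proj₁ a-block
    o = proj₂ a-block
    back : Permutation′ n
    back = permOf ((p , false) ∷ []) (o ∷ [])
    cancel : ∀ i → generator ⟨$⟩ʳ (back ⟨$⟩ʳ i) ≡ i
    cancel i = e-inj (trans (e-permOf ((p , true) ∷ []) (o ∷ []) _)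
      (trans (cong (rot k p) (e-permOf ((p , false) ∷ []) (o ∷ []) i)) (move-inverse k p false (e i))))

  module Even (h : ℕ) (k≡ : k ≡ suc h ℕ.+ suc h) where

    even-k : odd k ≡ false
    even-k = trans (cong odd k≡) (odd-double (suc h))

    κ-true : ∀ i → κ i ≡ true
    κ-true i rewrite even-k = refl

    open WordSign (λ _ → true) (odd (suc h)) (λ _ _ _ _ → refl)
      (λ p o → trans (Rotation.sgn-rotation (h ℕ.+ suc h) k≡ (suc h) (suc h) refl ℕₚ.≤-refl (ℕₚ.n≤1+n _) p o
                        (λ _ → true) (λ _ _ → true) (λ _ _ → refl) (λ _ _ → refl))
                     (tally-square (suc h)))

    even⇒G : LinkedFigure k rs → ∀ σ → sgn (λ _ → true) σ ≡ false → G σ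
    even⇒G linked σ ev = alt⇒G linked {σ} (Alternating.even⇒alt κ σ
      (λ i → trans (κ-true _) (sym (κ-true i)))
      (trans (sgn-ext {S = κ} {λ _ → true} σ κ-true) ev)
      (sgn-empty (not ∘ κ) σ (λ i → cong not (κ-true i))))

    all-even : LinkedFigure k rs → odd (suc h) ≡ false → ∀ σ → InG k rs e σ ⇔ IsEven σ
    all-even linked oh σ = mk⇔
      (λ g → let g' = InG⇒G {σ} g in sgn⇒EvenOn {S = λ _ → true} {σ}
               (trans (sgn-G σ g') (trans (cong (odd (length (proj₁ g')) ∧_) oh) (Boolₚ.∧-zeroʳ _))))
      (λ ev → G⇒InG {σ} (even⇒G linked σ (EvenOn⇒sgn {S = λ _ → true} {σ} ev)))

    everything : LinkedFigure k rs → odd (suc h) ≡ true → ∀ σ → InG k rs e σ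
    everything linked oh σ = G⇒InG {σ} (go (sgn (λ _ → true) σ) refl)
      where
      go : ∀ b → sgn (λ _ → true) σ ≡ b → G σ
      go false ev = even⇒G linked σ ev
      go true  od = G-generator σ (even⇒G linked (generator ∘ₚ σ)
        (trans (sgn-∘ (λ _ → true) generator σ (λ _ → refl))
          (cong₂ _xor_ (trans (sgn-move (proj₁ a-block , true) (proj₂ a-block)) oh) od)))

  module Odd (K : ℕ) (k≡ : k ≡ suc K) (A B : ℕ) (A+B≡k : A ℕ.+ B ≡ suc K) (B≤A : B ≤ A) (A≤1+B : A ≤ suc B)
             (even-K : odd K ≡ false) (θ : Bool)
             (count-θ : ∀ c → tallyℕ A (λ i → tallyℕ B (λ j → c xor odd (i ℕ.+ j))) ≡ θ) where

    odd-k : odd k ≡ true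
    odd-k = trans (cong odd k≡) (cong not even-K)

    κ-black : ∀ i → κ i ≡ black (e i)
    κ-black i rewrite odd-k = refl

    black-rot : ∀ p c → black (rot k p c) ≡ black c
    black-rot p c with inBlock? k p c
    ... | no c∉ = cong black (rot-out k p c c∉)
    ... | yes (i , j , i<k , j<k , refl) with complement i<k
    ... | i' , ei , i'<k = trans (cong black (rot-in k p ei i<k j<k)) (trans (black-⊹ p j i') (trans
            (cong (black p xor_) (trans (odd-+ j i') (trans (Boolₚ.xor-comm (odd j) (odd i'))
              (trans (cong (_xor odd j) (sym i≡i')) (sym (odd-+ i j)))))) (sym (black-⊹ p i j))))
      where
      i≡i' : odd i ≡ odd i'
      i≡i' = xor-cancel {odd i} {odd i'} (trans (sym (odd-+ i i')) (trans (cong odd (trans ei (cong (_∸ 1) k≡))) even-K))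

    module Black = WordSign black θ (λ p o c Fc → black-rot p c)
      (λ p o → trans (Rotation.sgn-rotation K k≡ A B A+B≡k B≤A A≤1+B p o black
                        (λ i j → black p xor odd (i ℕ.+ j)) (λ i j → black-⊹ p i j) (λ c _ → black-rot p c))
                     (count-θ (black p)))

    module White = WordSign (not ∘ black) θ (λ p o c Fc → cong not (black-rot p c))
      (λ p o → trans (Rotation.sgn-rotation K k≡ A B A+B≡k B≤A A≤1+B p o (not ∘ black)
                        (λ i j → not (black p) xor odd (i ℕ.+ j))
                        (λ i j → trans (cong not (black-⊹ p i j)) (Boolₚ.not-distribˡ-xor (black p) _))
                        (λ c _ → cong not (black-rot p c)))
                     (count-θ (not (black p))))

    G-colour : ∀ σ → G σ → PreservesColour e σ
    G-colour σ (w , ok , eq) i = trans (cong black (eq i)) (Black.run-pres w ok (e i) (e-in i))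

    even⇒G : LinkedFigure k rs → ∀ σ → PreservesColour e σ → sgn (black ∘ e) σ ≡ false → sgn (not ∘ black ∘ e) σ ≡ false → G σ
    even⇒G linked σ pres evB evW = alt⇒G linked {σ} (Alternating.even⇒alt κ σ
      (λ i → trans (κ-black _) (trans (pres i) (sym (κ-black i))))
      (trans (sgn-ext {S = κ} {black ∘ e} σ κ-black) evB)
      (trans (sgn-ext {S = not ∘ κ} {not ∘ black ∘ e} σ (λ i → cong not (κ-black i))) evW))

    both-even : LinkedFigure k rs → θ ≡ false → ∀ σ → InG k rs e σ ⇔
                (PreservesColour e σ × EvenOn (black ∘ e) σ × EvenOn (not ∘ black ∘ e) σ)
    both-even linked θ≡ σ = mk⇔
      (λ g → let g' = InG⇒G {σ} g ; z = λ l → trans (cong (odd l ∧_) θ≡) (Boolₚ.∧-zeroʳ (odd l)) in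
        G-colour σ g' ,
        sgn⇒EvenOn {S = black ∘ e} {σ} (trans (Black.sgn-G σ g') (z (length (proj₁ g')))) ,
        sgn⇒EvenOn {S = not ∘ black ∘ e} {σ} (trans (White.sgn-G σ g') (z (length (proj₁ g')))))
      (λ { (pres , evB , evW) → G⇒InG {σ} (even⇒G linked σ pres
             (EvenOn⇒sgn {S = black ∘ e} {σ} evB) (EvenOn⇒sgn {S = not ∘ black ∘ e} {σ} evW)) })

    not-even : ∀ S σ → sgn S σ ≡ true → ¬ EvenOn {n} S σ
    not-even S σ od ev = case trans (sym od) (EvenOn⇒sgn {S = S} {σ} ev) of λ ()

    not-even⇒ : ∀ S σ → ¬ EvenOn {n} S σ → sgn S σ ≡ true
    not-even⇒ S σ ne = go (sgn S σ) refl
      where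
      go : ∀ b → sgn S σ ≡ b → sgn S σ ≡ true
      go true  e = e
      go false e = ⊥-elim (ne (sgn⇒EvenOn {S = S} {σ} e))

    same-parity : LinkedFigure k rs → θ ≡ true → ∀ σ → InG k rs e σ ⇔
                  (PreservesColour e σ ×
                   ((EvenOn (black ∘ e) σ × EvenOn (not ∘ black ∘ e) σ) ⊎
                    (¬ EvenOn (black ∘ e) σ × ¬ EvenOn (not ∘ black ∘ e) σ)))
    same-parity linked θ≡ σ = mk⇔
      (λ g → let g' = InG⇒G {σ} g in G-colour σ g' , parity (odd (length (proj₁ g')))
               (trans (Black.sgn-G σ g') (one (length (proj₁ g')))) (trans (White.sgn-G σ g') (one (length (proj₁ g')))))
      (λ { (pres , inj₁ (evB , evW)) → G⇒InG {σ} (even⇒G linked σ pres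
             (EvenOn⇒sgn {S = black ∘ e} {σ} evB) (EvenOn⇒sgn {S = not ∘ black ∘ e} {σ} evW))
         ; (pres , inj₂ (odB , odW)) → G⇒InG {σ} (G-generator σ (even⇒G linked (generator ∘ₚ σ)
             (λ i → trans (pres _) (Black.perm-pres (m ∷ []) (o ∷ []) i))
             (trans (sgn-∘ (black ∘ e) generator σ (Black.perm-pres (m ∷ []) (o ∷ [])))
               (cong₂ _xor_ (trans (Black.sgn-move m o) θ≡) (not-even⇒ (black ∘ e) σ odB)))
             (trans (sgn-∘ (not ∘ black ∘ e) generator σ (White.perm-pres (m ∷ []) (o ∷ [])))
               (cong₂ _xor_ (trans (White.sgn-move m o) θ≡) (not-even⇒ (not ∘ black ∘ e) σ odW))))) })
      where
      m : Move
      m = proj₁ a-block , true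
      o : MoveOk k F m
      o = proj₂ a-block
      one : ∀ l → odd l ∧ θ ≡ odd l
      one l = trans (cong (odd l ∧_) θ≡) (Boolₚ.∧-identityʳ (odd l))
      parity : ∀ b → sgn (black ∘ e) σ ≡ b → sgn (not ∘ black ∘ e) σ ≡ b →
               (EvenOn (black ∘ e) σ × EvenOn (not ∘ black ∘ e) σ) ⊎ (¬ EvenOn (black ∘ e) σ × ¬ EvenOn (not ∘ black ∘ e) σ)
      parity false x y = inj₁ (sgn⇒EvenOn {S = black ∘ e} {σ} x , sgn⇒EvenOn {S = not ∘ black ∘ e} {σ} y)
      parity true  x y = inj₂ (not-even (black ∘ e) σ x , not-even (not ∘ black ∘ e) σ y)

  module Part1 (1<k : 1 < k) (linked : LinkedFigure k rs) where

    private
      q = k / 4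

    part1-0 : k % 4 ≡ 0 → ∀ σ → InG k rs e σ ⇔ IsEven σ
    part1-0 r = go q (trans (m≡m%n+[m/n]*n k 4) (cong (ℕ._+ q ℕ.* 4) r))
      where
      go : ∀ q → k ≡ q ℕ.* 4 → ∀ σ → InG k rs e σ ⇔ IsEven σ
      go zero    k≡ = case subst (1 <_) k≡ 1<k of λ ()
      go (suc q) k≡ = Even.all-even (suc (q ℕ.+ q))
        (trans k≡ (solve 1 (λ q → con 4 :+ q :* con 4 := (con 2 :+ (q :+ q)) :+ (con 2 :+ (q :+ q))) refl q))
        linked (trans (Boolₚ.not-involutive (odd (q ℕ.+ q))) (odd-double q))

    part1-2 : k % 4 ≡ 2 → ∀ σ → InG k rs e σ
    part1-2 r = Even.everything (q ℕ.+ q)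
      (trans (m≡m%n+[m/n]*n k 4) (trans (cong (ℕ._+ q ℕ.* 4) r)
        (solve 1 (λ q → con 2 :+ q :* con 4 := (con 1 :+ (q :+ q)) :+ (con 1 :+ (q :+ q))) refl q)))
      linked (cong not (odd-double q))

  module Part2 (linked : LinkedFigure k rs) where

    Result₁ Result₂ : Set
    Result₁ = ∀ σ → InG k rs e σ ⇔ (PreservesColour e σ × EvenOn (black ∘ e) σ × EvenOn (not ∘ black ∘ e) σ)
    Result₂ = ∀ σ → InG k rs e σ ⇔ (PreservesColour e σ ×
                      ((EvenOn (black ∘ e) σ × EvenOn (not ∘ black ∘ e) σ) ⊎
                       (¬ EvenOn (black ∘ e) σ × ¬ EvenOn (not ∘ black ∘ e) σ)))

    -- `k = 4 v + 1`, bracketed so that `A + B` agrees by computation. The sign is `odd v`: even for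
    -- `k = 8 q + 1`, odd for `k = 8 q + 5`.
    module Mod1 (v : ℕ) (k≡ : k ≡ suc (v ℕ.+ v ℕ.+ (v ℕ.+ v))) = Odd (v ℕ.+ v ℕ.+ (v ℕ.+ v)) k≡
      (suc (v ℕ.+ v)) (v ℕ.+ v) refl (ℕₚ.n≤1+n _) ℕₚ.≤-refl (odd-double (v ℕ.+ v)) (odd v) (λ c → tally-1mod4 c v)

    -- `k = 4 v + 3`. The sign is `odd (suc v)`: odd for `k = 8 q + 3`, even for `k = 8 q + 7`.
    module Mod3 (v : ℕ) (k≡ : k ≡ suc (v ℕ.+ suc v ℕ.+ suc (v ℕ.+ v))) = Odd (v ℕ.+ suc v ℕ.+ suc (v ℕ.+ v)) k≡
      (suc v ℕ.+ suc v) (suc (v ℕ.+ v)) refl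
      (s≤s (ℕₚ.+-monoʳ-≤ v (ℕₚ.n≤1+n v))) (ℕₚ.≤-reflexive (cong suc (ℕₚ.+-suc v v)))
      (trans (cong (λ m → odd (m ℕ.+ suc (v ℕ.+ v))) (ℕₚ.+-suc v v)) (odd-double (suc (v ℕ.+ v))))
      (odd (suc v)) (λ c → tally-3mod4 c v)

    private
      q = k / 8
      form : ∀ {r} → k % 8 ≡ r → k ≡ r ℕ.+ q ℕ.* 8
      form r = trans (m≡m%n+[m/n]*n k 8) (cong (ℕ._+ q ℕ.* 8) r)

    part2-17 : k % 8 ≡ 1 ⊎ k % 8 ≡ 7 → Result₁
    part2-17 (inj₁ r) = Mod1.both-even (q ℕ.+ q)
      (trans (form r) (solve 1 (λ q → con 1 :+ q :* con 8 :=
        con 1 :+ ((q :+ q) :+ (q :+ q) :+ ((q :+ q) :+ (q :+ q)))) refl q))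
      linked (odd-double q)
    part2-17 (inj₂ r) = Mod3.both-even (suc (q ℕ.+ q))
      (trans (form r) (solve 1 (λ q → con 7 :+ q :* con 8 :=
        con 1 :+ ((con 1 :+ (q :+ q)) :+ (con 2 :+ (q :+ q)) :+ (con 1 :+ ((con 1 :+ (q :+ q)) :+ (con 1 :+ (q :+ q)))))) refl q))
      linked (trans (Boolₚ.not-involutive _) (odd-double q))

    part2-35 : k % 8 ≡ 3 ⊎ k % 8 ≡ 5 → Result₂
    part2-35 (inj₁ r) = Mod3.same-parity (q ℕ.+ q)
      (trans (form r) (solve 1 (λ q → con 3 :+ q :* con 8 :=
        con 1 :+ ((q :+ q) :+ (con 1 :+ (q :+ q)) :+ (con 1 :+ ((q :+ q) :+ (q :+ q))))) refl q))
      linked (cong not (odd-double q))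
    part2-35 (inj₂ r) = Mod1.same-parity (suc (q ℕ.+ q))
      (trans (form r) (solve 1 (λ q → con 5 :+ q :* con 8 :=
        con 1 :+ ((con 1 :+ (q :+ q)) :+ (con 1 :+ (q :+ q)) :+ ((con 1 :+ (q :+ q)) :+ (con 1 :+ (q :+ q))))) refl q))
      linked (cong not (odd-double q))

-- Figures consisting of a single rectangle

size : ℕ → ℕ
size k = suc k ℕ.* k

coord : ∀ k → Fin (size k) → Point
coord k t = toℕ (proj₁ (remQuot {suc k} k t)) , toℕ (proj₂ (remQuot {suc k} k t))

coord-in : ∀ k t → InRect k origin (ι (coord k t))
coord-in k t = _ , _ , Finₚ.toℕ<n (proj₁ (remQuot {suc k} k t)) , Finₚ.toℕ<n (proj₂ (remQuot {suc k} k t)) , refl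

coord-injective : ∀ k {t u} → coord k t ≡ coord k u → t ≡ u
coord-injective k {t} {u} e =
  trans (sym (Finₚ.combine-remQuot {suc k} k t))
    (trans (cong₂ combine (Finₚ.toℕ-injective (cong proj₁ e)) (Finₚ.toℕ-injective (cong proj₂ e)))
           (Finₚ.combine-remQuot {suc k} k u))

coord-onto : ∀ k c → InRect k origin c → ∃[ t ] ι (coord k t) ≡ c
coord-onto k _ (i , j , i< , j< , refl) = combine (fromℕ< i<) (fromℕ< j<) ,
  cong₂ (λ x y → + x , + y)
    (trans (cong (toℕ ∘ proj₁) rq) (Finₚ.toℕ-fromℕ< i<)) (trans (cong (toℕ ∘ proj₂) rq) (Finₚ.toℕ-fromℕ< j<))
  where
  rq : remQuot {suc k} k (combine (fromℕ< i<) (fromℕ< j<)) ≡ (fromℕ< i< , fromℕ< j<)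
  rq = Finₚ.remQuot-combine (fromℕ< i<) (fromℕ< j<)

putRect-origin : ∀ r → putRect (frameOf r) origin ≡ r
putRect-origin (rect p true)  = cong (λ q → rect q true) (put-origin p true)
putRect-origin (rect p false) = cong (λ q → rect q false) (put-origin p false)

module Counting (k : ℕ) (rs : List Rect) {n : ℕ} (e : Fin n → Cell) (e-inj : Injective _≡_ _≡_ e)
                (e-in : ∀ i → InFig k rs (e i)) (e-onto : ∀ c → InFig k rs c → ∃[ i ] e i ≡ c)
                (r : Rect) (r⊆ : ∀ c → InRect k r c → InFig k rs c) where

  open Figure k rs e e-inj e-in e-onto using (F; ix; e-ix)

  cellOf : Fin (size k) → Cell
  cellOf t = put (frameOf r) (ι (coord k t))

  cellOf-in : ∀ t → InRect k r (cellOf t)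
  cellOf-in t = put-in {k} r _ (coord-in k t)

  cellOf-injective : ∀ {t u} → cellOf t ≡ cellOf u → t ≡ u
  cellOf-injective e = coord-injective k (ι-injective (put-injective (frameOf r) e))

  cellOf-onto : ∀ c → InRect k r c → ∃[ t ] cellOf t ≡ c
  cellOf-onto c c∈ =
    let t , eq = coord-onto k (unput f c) (InRect-unput f origin (unput f c)
                   (subst₂ (InRect k) (sym (putRect-origin r)) (sym (put-unput f c)) c∈))
    in t , trans (cong (put f) eq) (put-unput f c)
    where f = frameOf r

  index : Fin (size k) → Fin n
  index t = ix (cellOf t) (r⊆ _ (cellOf-in t))

  e-index : ∀ t → e (index t) ≡ cellOf t
  e-index t = e-ix _ _

  index-injective : Injective _≡_ _≡_ index
  index-injective {t} {u} eq = cellOf-injective (trans (sym (e-index t)) (trans (cong e eq) (e-index u)))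

  size≤ : size k ≤ n
  size≤ = Finₚ.injective⇒≤ index-injective

  covers⇒size : (∀ c → InFig k rs c → InRect k r c) → n ≡ size k
  covers⇒size ⊆r = ℕₚ.≤-antisym (Finₚ.injective⇒≤ {f = λ i → proj₁ (at i)} inj) size≤
    where
    at : ∀ i → ∃[ t ] cellOf t ≡ e i
    at i = cellOf-onto (e i) (⊆r _ (e-in i))
    inj : Injective _≡_ _≡_ (λ i → proj₁ (at i))
    inj {i} {j} eq = e-inj (trans (sym (proj₂ (at i))) (trans (cong cellOf eq) (proj₂ (at j))))

  -- A tile outside `r`, together with those of `r`, would give `suc (size k)` distinct tiles.
  size⇒covers : n ≡ size k → ∀ c → InFig k rs c → InRect k r c
  size⇒covers n≡ c c∈ = go (inRect? k r c)
    where
    more : ¬ InRect k r c → Fin (suc (size k)) → Fin n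
    more c∉ zero    = ix c c∈
    more c∉ (suc t) = index t
    more-injective : ∀ c∉ → Injective _≡_ _≡_ (more c∉)
    more-injective c∉ {zero}  {zero}  eq = refl
    more-injective c∉ {zero}  {suc u} eq =
      ⊥-elim (c∉ (subst (InRect k r) (trans (sym (e-index u)) (trans (cong e (sym eq)) (e-ix c c∈))) (cellOf-in u)))
    more-injective c∉ {suc t} {zero}  eq =
      ⊥-elim (c∉ (subst (InRect k r) (trans (sym (e-index t)) (trans (cong e eq) (e-ix c c∈))) (cellOf-in t)))
    more-injective c∉ {suc t} {suc u} eq = cong suc (index-injective eq)
    go : Dec (InRect k r c) → InRect k r c
    go (yes c∈r) = c∈r
    go (no c∉)   = ⊥-elim (ℕₚ.<-irrefl (sym n≡) (Finₚ.injective⇒≤ (more-injective c∉)))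

origin-block : ∀ K p → (∀ i j → i < suc K → j < suc K → InRect (suc K) origin (p ⊹ (i , j))) →
               p ≡ (0ℤ , 0ℤ) ⊎ p ≡ (+ 1 , 0ℤ)
origin-block K p@(x , y) o with o 0 0 (s≤s z≤n) (s≤s z≤n) | o K K ℕₚ.≤-refl ℕₚ.≤-refl
... | (a , b , _ , _ , eq₀) | (c , d , c< , d< , eq₁) = go a b p≡ fits-x fits-y
  where
  p≡ : p ≡ (+ a , + b)
  p≡ = trans (cong₂ _,_ (sym (ℤₚ.+-identityʳ x)) (sym (ℤₚ.+-identityʳ y))) eq₀
  corner : (+ (a ℕ.+ K) , + (b ℕ.+ K)) ≡ (+ c , + d)
  corner = trans (cong (_⊹ (K , K)) (sym p≡)) eq₁
  fits-x : a ℕ.+ K < suc (suc K)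
  fits-x = subst (_< suc (suc K)) (sym (ℤₚ.+-injective (cong proj₁ corner))) c<
  fits-y : b ℕ.+ K < suc K
  fits-y = subst (_< suc K) (sym (ℤₚ.+-injective (cong proj₂ corner))) d<
  go : ∀ a b → p ≡ (+ a , + b) → a ℕ.+ K < suc (suc K) → b ℕ.+ K < suc K → p ≡ (0ℤ , 0ℤ) ⊎ p ≡ (+ 1 , 0ℤ)
  go 0 0 e _ _ = inj₁ e
  go 1 0 e _ _ = inj₂ e
  go (suc (suc a)) b e (s≤s (s≤s lt)) _ = ⊥-elim (ℕₚ.m+n≮n a K lt)
  go 0 (suc b) e _ (s≤s lt) = ⊥-elim (ℕₚ.m+n≮n b K lt)
  go 1 (suc b) e _ (s≤s lt) = ⊥-elim (ℕₚ.m+n≮n b K lt)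

letter-of : ∀ K r m → MoveOk (suc K) (InRect (suc K) r) m → ∃[ x ] m ≡ putMove (frameOf r) (letterMove x)
letter-of K r (p , b) o with origin-block K (unput f p) local
  where
  f = frameOf r
  local : ∀ i j → i < suc K → j < suc K → InRect (suc K) origin (unput f p ⊹ (i , j))
  local i j i< j< = InRect-unput f origin _ (subst₂ (InRect (suc K)) (sym (putRect-origin r))
    (sym (trans (put-⊹ f (unput f p) (i , j)) (cong (_⊹ reflectℕ (proj₂ f) (i , j)) (put-unput f p))))
    (both (proj₂ f)))
    where
    both : ∀ o' → InRect (suc K) r (p ⊹ reflectℕ o' (i , j))
    both true  = o i j i< j<
    both false = o j i j< i<
... | inj₁ e = pick (proj₂ (frameOf r)) b
  where
  p≡ : p ≡ put (frameOf r) (0ℤ , 0ℤ)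
  p≡ = trans (sym (put-unput (frameOf r) p)) (cong (put (frameOf r)) e)
  pick : ∀ o b → ∃[ x ] (p , b) ≡ (put (frameOf r) (proj₁ (letterMove x)) , reflectBool o (proj₂ (letterMove x)))
  pick true  true  = L  , cong (_, true) p≡
  pick true  false = L⁻ , cong (_, false) p≡
  pick false true  = L⁻ , cong (_, true) p≡
  pick false false = L  , cong (_, false) p≡
... | inj₂ e = pick (proj₂ (frameOf r)) b
  where
  p≡ : p ≡ put (frameOf r) (+ 1 , 0ℤ)
  p≡ = trans (sym (put-unput (frameOf r) p)) (cong (put (frameOf r)) e)
  pick : ∀ o b → ∃[ x ] (p , b) ≡ (put (frameOf r) (proj₁ (letterMove x)) , reflectBool o (proj₂ (letterMove x)))
  pick true  true  = R  , cong (_, true) p≡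
  pick true  false = R⁻ , cong (_, false) p≡
  pick false true  = R⁻ , cong (_, true) p≡
  pick false false = R  , cong (_, false) p≡

-- Finite actions of words and their verification by evaluation

allFin? : ∀ n → (Fin n → Bool) → Bool
allFin? zero    p = true
allFin? (suc n) p = p zero ∧ allFin? n (p ∘ suc)

allFin?-sound : ∀ {n} {p : Fin n → Bool} → allFin? n p ≡ true → ∀ i → p i ≡ true
allFin?-sound {suc n} {p} e zero    = proj₁ (∧-true {p zero} e)
allFin?-sound {suc n} {p} e (suc i) = allFin?-sound {n} {p ∘ suc} (proj₂ (∧-true {p zero} e)) i

_==_ : ∀ {n} → Fin n → Fin n → Bool
i == j = toℕ i ≡ᵇ toℕ j

==-sound : ∀ {n} {i j : Fin n} → (i == j) ≡ true → i ≡ j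
==-sound {i = i} e = Finₚ.toℕ-injective (≡ᵇ-true {toℕ i} e)

allLetters : (Letter → Bool) → Bool
allLetters p = p L ∧ p L⁻ ∧ p R ∧ p R⁻

allLetters-sound : ∀ {p} → allLetters p ≡ true → ∀ x → p x ≡ true
allLetters-sound {p} e L  = proj₁ (∧-true {p L} e)
allLetters-sound {p} e L⁻ = proj₁ (∧-true {p L⁻} (proj₂ (∧-true {p L} e)))
allLetters-sound {p} e R  = proj₁ (∧-true {p R} (proj₂ (∧-true {p L⁻} (proj₂ (∧-true {p L} e)))))
allLetters-sound {p} e R⁻ = proj₂ (∧-true {p R} (proj₂ (∧-true {p L⁻} (proj₂ (∧-true {p L} e)))))

record Action (m : ℕ) : Set where
  field
    by-letter : Letter → Fin m → Fin m
    undone    : ∀ x a → by-letter (inv x) (by-letter x a) ≡ a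

  by-word : List Letter → Fin m → Fin m
  by-word []      a = a
  by-word (x ∷ u) a = by-letter x (by-word u a)

  by-++ : ∀ u v a → by-word (u ++ v) a ≡ by-word u (by-word v a)
  by-++ []      v a = refl
  by-++ (x ∷ u) v a = cong (by-letter x) (by-++ u v a)

  by-invsˡ : ∀ u a → by-word (invs u) (by-word u a) ≡ a
  by-invsˡ []      a = refl
  by-invsˡ (x ∷ u) a = trans (by-++ (invs u) _ _) (trans (cong (by-word (invs u)) (undone x _)) (by-invsˡ u a))

  by-invsʳ : ∀ u a → by-word u (by-word (invs u) a) ≡ a
  by-invsʳ []      a = refl
  by-invsʳ (x ∷ u) a = begin
    by-letter x (by-word u (by-word (invs u ++ (inv x ∷ [])) a)) ≡⟨ cong (by-letter x ∘ by-word u) (by-++ (invs u) _ a) ⟩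
    by-letter x (by-word u (by-word (invs u) (by-letter (inv x) a))) ≡⟨ cong (by-letter x) (by-invsʳ u _) ⟩
    by-letter x (by-letter (inv x) a)  ≡⟨ cong (λ y → by-letter y (by-letter (inv x) a)) (inv-inv x) ⟨
    by-letter (inv (inv x)) (by-letter (inv x) a) ≡⟨ undone (inv x) a ⟩
    a ∎
    where open ≡-Reasoning

  by-perm : List Letter → Permutation′ m
  by-perm u = permutation (by-word u) (by-word (invs u)) (by-invsʳ u) (by-invsˡ u)

open Action

-- Each point `a` of `A` carries a partition of the ordered pairs of points of `X`, whose classes
-- are the colours of `M a`. Comparing colours by `sameᵇ` makes their names immaterial. Two words
-- that agree on `X` move these partitions alike and, as distinct points carry distinct partitions,
-- agree on `A`.
record Structure {m l : ℕ} (X : Action m) (A : Action l) (M : Fin l → Fin m → Fin m → ℕ) : Set where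
  sameᵇ : Fin l → Fin m → Fin m → Fin m → Fin m → Bool
  sameᵇ a i j p q = M a i j ≡ᵇ M a p q
  field
    equivariant : ∀ x a i j p q → sameᵇ (by-letter A x a) (by-letter X x i) (by-letter X x j) (by-letter X x p) (by-letter X x q) ≡
                                  sameᵇ a i j p q
    separated   : ∀ a b → (∀ i j p q → sameᵇ a i j p q ≡ sameᵇ b i j p q) → a ≡ b

  equivariant* : ∀ u a i j p q → sameᵇ (by-word A u a) (by-word X u i) (by-word X u j) (by-word X u p) (by-word X u q) ≡
                                 sameᵇ a i j p q
  equivariant* []      a i j p q = refl
  equivariant* (x ∷ u) a i j p q = trans (equivariant x _ _ _ _ _) (equivariant* u a i j p q)

  determined : ∀ u v → (∀ i → by-word X u i ≡ by-word X v i) → ∀ a → by-word A u a ≡ by-word A v a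
  determined u v e a = separated _ _ λ i j p q → begin
    sameᵇ (by-word A u a) i j p q ≡⟨ cong₄ (sameᵇ (by-word A u a)) (back i) (back j) (back p) (back q) ⟨
    sameᵇ (by-word A u a) (U (U⁻ i)) (U (U⁻ j)) (U (U⁻ p)) (U (U⁻ q)) ≡⟨ equivariant* u a _ _ _ _ ⟩
    sameᵇ a (U⁻ i) (U⁻ j) (U⁻ p) (U⁻ q) ≡⟨ equivariant* v a _ _ _ _ ⟨
    sameᵇ (by-word A v a) (V (U⁻ i)) (V (U⁻ j)) (V (U⁻ p)) (V (U⁻ q)) ≡⟨ cong₄ (sameᵇ (by-word A v a)) (vb i) (vb j) (vb p) (vb q) ⟩
    sameᵇ (by-word A v a) i j p q ∎
    where
    open ≡-Reasoning
    U U⁻ V : Fin m → Fin m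
    U  = by-word X u
    U⁻ = by-word X (invs u)
    V  = by-word X v
    back : ∀ i → U (U⁻ i) ≡ i
    back = by-invsʳ X u
    vb : ∀ i → V (U⁻ i) ≡ i
    vb i = trans (sym (e (U⁻ i))) (back i)
    cong₄ : ∀ (f : Fin m → Fin m → Fin m → Fin m → Bool) {a a' b b' c c' d d'} →
            a ≡ a' → b ≡ b' → c ≡ c' → d ≡ d' → f a b c d ≡ f a' b' c' d'
    cong₄ f refl refl refl refl = refl

_==ᵇ_ : Bool → Bool → Bool
a ==ᵇ b = not (a xor b)

==ᵇ-sound : ∀ {a b} → (a ==ᵇ b) ≡ true → a ≡ b
==ᵇ-sound {a} e = xor-cancel {a} (Boolₚ.not-injective e)

module CheckStructure {m l : ℕ} (X : Action m) (A : Action l) (M : Fin l → Fin m → Fin m → ℕ) where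

  sameᵇ : Fin l → Fin m → Fin m → Fin m → Fin m → Bool
  sameᵇ a i j p q = M a i j ≡ᵇ M a p q

  equivariantᵇ : Letter → Fin l → Fin m → Fin m → Fin m → Fin m → Bool
  equivariantᵇ x a i j p q =
    sameᵇ (by-letter A x a) (by-letter X x i) (by-letter X x j) (by-letter X x p) (by-letter X x q) ==ᵇ sameᵇ a i j p q

  all₄ : (Fin m → Fin m → Fin m → Fin m → Bool) → Bool
  all₄ f = allFin? m λ i → allFin? m λ j → allFin? m λ p → allFin? m λ q → f i j p q

  all₄-sound : ∀ {f} → all₄ f ≡ true → ∀ i j p q → f i j p q ≡ true
  all₄-sound {f} t i j p q =
    allFin?-sound {p = f i j p}
      (allFin?-sound {p = λ p → allFin? m (f i j p)}
        (allFin?-sound {p = λ j → allFin? m λ p → allFin? m (f i j p)}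
          (allFin?-sound {p = λ i → allFin? m λ j → allFin? m λ p → allFin? m (f i j p)} t i) j) p) q

  equivariant? : Bool
  equivariant? = allLetters λ x → allFin? l λ a → all₄ (equivariantᵇ x a)

  separated? : Bool
  separated? = allFin? l λ a → allFin? l λ b →
    (a == b) Data.Bool.∨ not (all₄ λ i j p q → sameᵇ a i j p q ==ᵇ sameᵇ b i j p q)

  all₄-complete : ∀ {f} → (∀ i j p q → f i j p q ≡ true) → all₄ f ≡ true
  all₄-complete h = one λ i → one λ j → one λ p → one λ q → h i j p q
    where
    one : ∀ {n} {p : Fin n → Bool} → (∀ i → p i ≡ true) → allFin? n p ≡ true
    one {zero}  h = refl
    one {suc n} {p} h rewrite h zero = one {n} {p ∘ suc} (h ∘ suc)

  structure : equivariant? ≡ true → separated? ≡ true → Structure X A M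
  structure eq sep = record
    { equivariant = λ x a i j p q → ==ᵇ-sound (all₄-sound {equivariantᵇ x a}
        (allFin?-sound {p = λ a → all₄ (equivariantᵇ x a)}
          (allLetters-sound {λ x → allFin? l λ a → all₄ (equivariantᵇ x a)} eq x) a) i j p q)
    ; separated = λ a b same → conclude a b same (allFin?-sound {p = sepᵇ a} (allFin?-sound {p = λ a → allFin? l (sepᵇ a)} sep a) b) }
    where
    agree : Fin l → Fin l → Fin m → Fin m → Fin m → Fin m → Bool
    agree a b i j p q = sameᵇ a i j p q ==ᵇ sameᵇ b i j p q
    sepᵇ : Fin l → Fin l → Bool
    sepᵇ a b = (a == b) Data.Bool.∨ not (all₄ (agree a b))
    refl-true : ∀ {x y : Bool} → x ≡ y → (x ==ᵇ y) ≡ true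
    refl-true {x} refl = cong not (Boolₚ.xor-same x)
    conclude : ∀ a b → (∀ i j p q → sameᵇ a i j p q ≡ sameᵇ b i j p q) → sepᵇ a b ≡ true → a ≡ b
    conclude a b same s with a == b in ab
    ... | true  = ==-sound ab
    ... | false with trans (sym s) (cong not (all₄-complete {agree a b} (λ i j p q → refl-true (same i j p q))))
    ... | ()

letterDigit : ℕ → Letter
letterDigit 1 = L
letterDigit 2 = L⁻
letterDigit 3 = R
letterDigit _ = R⁻

spell : ℕ → List Letter
spell code = map letterDigit (digits 40 code)

-- The default 0 spells the empty word, which is right for the trivial swaps, whose keys are in no
-- table.
lookupCode : List (ℕ × ℕ) → ℕ → ℕ
lookupCode []              key = 0
lookupCode ((k , v) ∷ kvs) key = if k ≡ᵇ key then v else lookupCode kvs key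

module Generation {m : ℕ} (X : Action m) (codes : List (ℕ × ℕ)) where

  swapWord : Fin m → Fin m → List Letter
  swapWord i j = spell (lookupCode codes (if toℕ i ℕ.≤ᵇ toℕ j then 10 ℕ.* toℕ i ℕ.+ toℕ j else 10 ℕ.* toℕ j ℕ.+ toℕ i))

  swaps? : Bool
  swaps? = allFin? m λ i → allFin? m λ j → allFin? m λ c → by-word X (swapWord i j) c == Comp.transpose i j c

  generated : swaps? ≡ true → ∀ (ρ : Permutation′ m) → ∃[ u ] (∀ a → by-word X u a ≡ ρ ⟨$⟩ʳ a)
  generated ok ρ = let u , e = go (decompose ρ) in u , λ a → trans (e a) (eval-decompose ρ a)
    where
    swap-ok : ∀ i j c → by-word X (swapWord i j) c ≡ Comp.transpose i j c
    swap-ok i j c = ==-sound (allFin?-sound {p = λ c → by-word X (swapWord i j) c == Comp.transpose i j c}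
      (allFin?-sound {p = λ j → allFin? m λ c → by-word X (swapWord i j) c == Comp.transpose i j c}
        (allFin?-sound {p = λ i → allFin? m λ j → allFin? m λ c → by-word X (swapWord i j) c == Comp.transpose i j c} ok i) j) c)
    go : ∀ ts → ∃[ u ] (∀ a → by-word X u a ≡ eval ts ⟨$⟩ʳ a)
    go [] = [] , λ a → refl
    go ((i , j) ∷ ts) = let u , e = go ts in
      u ++ swapWord i j , λ a → trans (by-++ X u (swapWord i j) a)
        (trans (cong (by-word X u) (swap-ok i j a)) (e _))

-- Positions count from the left in a numeral padded to `len` digits, so leading zeros keep their
-- place.
digitAt : ℕ → ℕ → ℕ → ℕ
digitAt code len i = go (len ∸ suc i) code % 10
  where
  go : ℕ → ℕ → ℕ
  go zero    c = c
  go (suc i) c = go i (c / 10)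

-- The rectangles with 6 and 12 tiles


letterPoint : Letter → Point × Bool
letterPoint L  = (0 , 0) , true
letterPoint L⁻ = (0 , 0) , false
letterPoint R  = (1 , 0) , true
letterPoint R⁻ = (1 , 0) , false

ι-letter : ∀ k x c → move k (letterMove x) (ι c) ≡ ι (moveℕ k (letterPoint x) c)
ι-letter k L  c = ι-move k (0 , 0) true c
ι-letter k L⁻ c = ι-move k (0 , 0) false c
ι-letter k R  c = ι-move k (1 , 0) true c
ι-letter k R⁻ c = ι-move k (1 , 0) false c

module CheckAction {m : ℕ} (f : Letter → Fin m → Fin m) where

  undone? : Bool
  undone? = allLetters λ x → allFin? m λ a → f (inv x) (f x a) == a

  action : undone? ≡ true → Action m
  action ok = record { by-letter = f ; undone = λ x a → ==-sound
    (allFin?-sound {p = λ a → f (inv x) (f x a) == a}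
      (allLetters-sound {λ x → allFin? m λ a → f (inv x) (f x a) == a} ok x) a) }

  models? : ∀ k → (Fin m → Point) → Bool
  models? k c = allLetters λ x → allFin? m λ a →
    (proj₁ (c (f x a)) ≡ᵇ proj₁ (moveℕ k (letterPoint x) (c a))) ∧ (proj₂ (c (f x a)) ≡ᵇ proj₂ (moveℕ k (letterPoint x) (c a)))

  models : ∀ k c → models? k c ≡ true → ∀ x a → move k (letterMove x) (ι (c a)) ≡ ι (c (f x a))
  models k c ok x a = trans (ι-letter k x (c a)) (cong ι (sym (cong₂ _,_
      (≡ᵇ-true {proj₁ (c (f x a))} (proj₁ both)) (≡ᵇ-true {proj₂ (c (f x a))} (proj₂ both)))))
    where
    test : Letter → Fin m → Bool
    test x a = (proj₁ (c (f x a)) ≡ᵇ proj₁ (moveℕ k (letterPoint x) (c a))) ∧ (proj₂ (c (f x a)) ≡ᵇ proj₂ (moveℕ k (letterPoint x) (c a)))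
    both = ∧-true (allFin?-sound {p = test x} (allLetters-sound {λ x → allFin? m (test x)} ok x) a)

module SingleRect (K : ℕ) (rs : List Rect) {n : ℕ} (e : Fin n → Cell) (e-inj : Injective _≡_ _≡_ e)
                  (e-in : ∀ i → InFig (suc K) rs (e i)) (e-onto : ∀ c → InFig (suc K) rs c → ∃[ i ] e i ≡ c)
                  (r : Rect) (r⊆ : ∀ c → InRect (suc K) r c → InFig (suc K) rs c)
                  (⊆r : ∀ c → InFig (suc K) rs c → InRect (suc K) r c)
                  (X : Action (size (suc K)))
                  (X-models : ∀ x t → move (suc K) (letterMove x) (ι (coord (suc K) t)) ≡ ι (coord (suc K) (by-letter X x t))) where

  private
    k = suc K
    f = frameOf r

  open Figure k rs e e-inj e-in e-onto
  open Counting k rs e e-inj e-in e-onto r r⊆ using (cellOf; cellOf-in; cellOf-injective; cellOf-onto; index; e-index)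

  π : Fin n → Fin (size k)
  π i = proj₁ (cellOf-onto (e i) (⊆r _ (e-in i)))

  cellOf-π : ∀ i → cellOf (π i) ≡ e i
  cellOf-π i = proj₂ (cellOf-onto (e i) (⊆r _ (e-in i)))

  π-index : ∀ t → π (index t) ≡ t
  π-index t = cellOf-injective (trans (cellOf-π (index t)) (e-index t))

  index-π : ∀ i → index (π i) ≡ i
  index-π i = e-inj (trans (e-index (π i)) (cellOf-π i))

  Spells : Permutation′ n → List Letter → Set
  Spells σ u = ∀ i → π (σ ⟨$⟩ʳ i) ≡ by-word X u (π i)

  letter-acts : ∀ x t → move k (putMove f (letterMove x)) (cellOf t) ≡ cellOf (by-letter X x t)
  letter-acts x t = trans (move-put k f (letterMove x) (ι (coord k t))) (cong (put f) (X-models x t))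

  spelling : ∀ w → Ok k F w → ∃[ u ] (∀ t → run k w (cellOf t) ≡ cellOf (by-word X u t))
  spelling []      []       = [] , λ t → refl
  spelling (m ∷ w) (o ∷ os) =
    let u , eq = spelling w os
        x , m≡ = letter-of K r m (λ i j i< j< → ⊆r _ (o i j i< j<))
    in x ∷ u , λ t → trans (cong (move k m) (eq t))
         (trans (cong (λ m → move k m (cellOf (by-word X u t))) m≡) (letter-acts x (by-word X u t)))

  G⇒spells : ∀ σ → G σ → ∃[ u ] Spells σ u
  G⇒spells σ (w , ok , eq) = let u , sp = spelling w ok in
    u , λ i → cellOf-injective (trans (cellOf-π (σ ⟨$⟩ʳ i)) (trans (eq i)
          (trans (cong (run k w) (sym (cellOf-π i))) (sp (π i)))))

  letterMoves : List Letter → List Move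
  letterMoves u = map (putMove f) (letters u)

  letterMoves-run : ∀ u t → run k (letterMoves u) (cellOf t) ≡ cellOf (by-word X u t)
  letterMoves-run []      t = refl
  letterMoves-run (x ∷ u) t = trans (cong (move k (putMove f (letterMove x))) (letterMoves-run u t)) (letter-acts x _)

  letterMoves-ok : ∀ u → Ok k F (letterMoves u)
  letterMoves-ok u = Ok-put {k} {F} {InRect k origin} f (λ c c∈ → r⊆ _ (put-in {k} r c c∈)) (letters-ok {k} u)

  spells⇒G : ∀ σ u → Spells σ u → G σ
  spells⇒G σ u sp = letterMoves u , letterMoves-ok u , λ i → begin
    e (σ ⟨$⟩ʳ i)                          ≡⟨ cellOf-π (σ ⟨$⟩ʳ i) ⟨
    cellOf (π (σ ⟨$⟩ʳ i))                 ≡⟨ cong cellOf (sp i) ⟩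
    cellOf (by-word X u (π i))            ≡⟨ letterMoves-run u (π i) ⟨
    run k (letterMoves u) (cellOf (π i))  ≡⟨ cong (run k (letterMoves u)) (cellOf-π i) ⟩
    run k (letterMoves u) (e i)           ∎
    where open ≡-Reasoning

  realise : List Letter → Permutation′ n
  realise u = permutation (act-by u) (act-by (invs u))
    (λ i → trans (cong (index ∘ by-word X u) (π-index _)) (trans (cong index (by-invsʳ X u (π i))) (index-π i)))
    (λ i → trans (cong (index ∘ by-word X (invs u)) (π-index _)) (trans (cong index (by-invsˡ X u (π i))) (index-π i)))
    where
    act-by : List Letter → Fin n → Fin n
    act-by u i = index (by-word X u (π i))

  realise-spells : ∀ u → Spells (realise u) u
  realise-spells u i = π-index _

  same-word : ∀ {σ τ} u v → σ ≈ₚ τ → Spells σ u → Spells τ v → ∀ t → by-word X u t ≡ by-word X v t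
  same-word {σ} {τ} u v σ≈τ su sv t = begin
    by-word X u t                   ≡⟨ cong (by-word X u) (π-index t) ⟨
    by-word X u (π (index t))       ≡⟨ su (index t) ⟨
    π (σ ⟨$⟩ʳ index t)              ≡⟨ cong π (σ≈τ (index t)) ⟩
    π (τ ⟨$⟩ʳ index t)              ≡⟨ sv (index t) ⟩
    by-word X v (π (index t))       ≡⟨ cong (by-word X v) (π-index t) ⟩
    by-word X v t                   ∎
    where open ≡-Reasoning

  -- An element of the group goes to the action on `A` of any word spelling it. The first hypothesis
  -- makes the choice of word immaterial, the second gives injectivity and the third surjectivity.
  -- Words of a composite are concatenated in reverse, since `∘ₚ` applies its left factor first.
  iso : ∀ {m} (A : Action m) →
    (∀ u v → (∀ t → by-word X u t ≡ by-word X v t) → ∀ a → by-word A u a ≡ by-word A v a) →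
    (∀ u v → (∀ a → by-word A u a ≡ by-word A v a) → ∀ t → by-word X u t ≡ by-word X v t) →
    (∀ (ρ : Permutation′ m) → ∃[ u ] (∀ a → by-word A u a ≡ ρ ⟨$⟩ʳ a)) →
    IsoToSym (InG k rs e) m
  iso A X⇒A A⇒X gen = record
    { φ      = λ σ p → by-perm A (word σ p)
    ; φ-cong = λ σ τ p q σ≈τ → X⇒A (word σ p) (word τ q) (same-word {σ} {τ} (word σ p) (word τ q) σ≈τ (spells σ p) (spells τ q))
    ; φ-inj  = λ σ τ p q eq i → begin
        σ ⟨$⟩ʳ i                              ≡⟨ index-π _ ⟨
        index (π (σ ⟨$⟩ʳ i))                  ≡⟨ cong index (spells σ p i) ⟩
        index (by-word X (word σ p) (π i))    ≡⟨ cong index (A⇒X (word σ p) (word τ q) eq (π i)) ⟩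
        index (by-word X (word τ q) (π i))    ≡⟨ cong index (spells τ q i) ⟨
        index (π (τ ⟨$⟩ʳ i))                  ≡⟨ index-π _ ⟩
        τ ⟨$⟩ʳ i                              ∎
    ; φ-surj = λ ρ → let u , eq = gen ρ
                         σ = realise u
                         p = G⇒InG {σ} (spells⇒G σ u (realise-spells u))
                     in σ , p , λ a → trans
                          (X⇒A (word σ p) u (same-word {σ} {σ} (word σ p) u (λ i → refl) (spells σ p) (realise-spells u)) a)
                          (eq a)
    ; φ-hom  = λ σ τ p q r a → trans
        (X⇒A (word (σ ∘ₚ τ) r) (word τ q ++ word σ p)
          (same-word {σ ∘ₚ τ} {σ ∘ₚ τ} (word (σ ∘ₚ τ) r) (word τ q ++ word σ p) (λ i → refl) (spells (σ ∘ₚ τ) r)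
            (λ i → trans (spells τ q (σ ⟨$⟩ʳ i)) (trans (cong (by-word X (word τ q)) (spells σ p i))
                     (sym (by-++ X (word τ q) (word σ p) (π i)))))) a)
        (by-++ A (word τ q) (word σ p) a) }
    where
    open ≡-Reasoning
    word : ∀ σ → InG k rs e σ → List Letter
    word σ p = proj₁ (G⇒spells σ (InG⇒G {σ} p))
    spells : ∀ σ (p : InG k rs e σ) → Spells σ (word σ p)
    spells σ p = proj₂ (G⇒spells σ (InG⇒G {σ} p))

  -- On the class `b`, renumbered by `emb` and `half`, `τ` becomes a permutation `ρ` of `Fin m`; a
  -- word acting on `A` as `ρ` acts on the class as `τ`.
  projection : ∀ {m} (A : Action m) (emb : Fin m → Fin (size k)) (half : Fin (size k) → Fin m) (cls : Fin (size k) → Bool) (b : Bool) →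
    (∀ c → half (emb c) ≡ c) → (∀ t → cls t ≡ b → emb (half t) ≡ t) → (∀ c → cls (emb c) ≡ b) →
    (∀ x c → by-letter X x (emb c) ≡ emb (by-letter A x c)) →
    (∀ (ρ : Permutation′ m) → ∃[ u ] (∀ a → by-word A u a ≡ ρ ⟨$⟩ʳ a)) →
    ∀ (τ : Permutation′ n) → (∀ i → cls (π (τ ⟨$⟩ʳ i)) ≡ cls (π i)) →
    ∃[ σ ] (InG k rs e σ × (∀ i → cls (π i) ≡ b → σ ⟨$⟩ʳ i ≡ τ ⟨$⟩ʳ i))
  projection {m} A emb half cls b half-emb emb-half cls-emb commutes gen τ pres =
    σ , G⇒InG {σ} (spells⇒G σ u (realise-spells u)) , agree
    where
    open ≡-Reasoning
    restrict : (Fin n → Fin n) → Fin m → Fin m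
    restrict g c = half (π (g (index (emb c))))
    emb-restrict : ∀ g → (∀ i → cls (π (g i)) ≡ cls (π i)) → ∀ c → index (emb (restrict g c)) ≡ g (index (emb c))
    emb-restrict g gp c = trans (cong index (emb-half _ (trans (gp _) (trans (cong cls (π-index (emb c))) (cls-emb c))))) (index-π _)
    pres⁻ : ∀ i → cls (π (τ ⟨$⟩ˡ i)) ≡ cls (π i)
    pres⁻ i = trans (sym (pres (τ ⟨$⟩ˡ i))) (cong (cls ∘ π) (Perm.inverseʳ τ))
    cancels : ∀ g h → (∀ i → cls (π (g i)) ≡ cls (π i)) → (∀ i → h (g i) ≡ i) → ∀ c → restrict h (restrict g c) ≡ c
    cancels g h gp hg c = trans (cong (half ∘ π ∘ h) (emb-restrict g gp c))
      (trans (cong (half ∘ π) (hg _)) (trans (cong half (π-index (emb c))) (half-emb c)))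
    ρ : Permutation′ m
    ρ = permutation (restrict (τ ⟨$⟩ʳ_)) (restrict (τ ⟨$⟩ˡ_))
          (cancels (τ ⟨$⟩ˡ_) (τ ⟨$⟩ʳ_) pres⁻ (λ i → Perm.inverseʳ τ)) (cancels (τ ⟨$⟩ʳ_) (τ ⟨$⟩ˡ_) pres (λ i → Perm.inverseˡ τ))
    u = proj₁ (gen ρ)
    σ = realise u
    commutes* : ∀ u c → by-word X u (emb c) ≡ emb (by-word A u c)
    commutes* []      c = refl
    commutes* (x ∷ u) c = trans (cong (by-letter X x) (commutes* u c)) (commutes x _)
    agree : ∀ i → cls (π i) ≡ b → σ ⟨$⟩ʳ i ≡ τ ⟨$⟩ʳ i
    agree i ib = begin
      index (by-word X u (π i))          ≡⟨ cong (index ∘ by-word X u) (emb-half (π i) ib) ⟨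
      index (by-word X u (emb c))        ≡⟨ cong index (commutes* u c) ⟩
      index (emb (by-word A u c))        ≡⟨ cong (index ∘ emb) (proj₂ (gen ρ) c) ⟩
      index (emb (restrict (τ ⟨$⟩ʳ_) c)) ≡⟨ emb-restrict (τ ⟨$⟩ʳ_) pres c ⟩
      τ ⟨$⟩ʳ index (emb c)               ≡⟨ cong (λ t → τ ⟨$⟩ʳ index t) (emb-half (π i) ib) ⟩
      τ ⟨$⟩ʳ index (π i)                 ≡⟨ cong (τ ⟨$⟩ʳ_) (index-π i) ⟩
      τ ⟨$⟩ʳ i                           ∎
      where c = half (π i)

  tile-black : ∀ t → black (cellOf t) ≡ black (Rect.corner r) xor odd (proj₁ (coord k t) ℕ.+ proj₂ (coord k t))
  tile-black t = black-tile r (tile (proj₁ (coord k t)) 0 (proj₂ (coord k t)) 0)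

-- The digits of cL are the values at 0, …, m-1 of the permutation L, and so on.
byDigits : ∀ m .{{_ : NonZero m}} → ℕ → ℕ → ℕ → ℕ → Letter → Fin m → Fin m
byDigits m cL cL⁻ cR cR⁻ x a = digitAt (code x) m (toℕ a) mod m
  where
  code : Letter → ℕ
  code L  = cL
  code L⁻ = cL⁻
  code R  = cR
  code R⁻ = cR⁻

-- The digits of each code are the colours of the pairs (i , j), row by row.
colouring : ∀ m → List ℕ → ∀ {l} → Fin l → Fin m → Fin m → ℕ
colouring m []       a       i j = 0
colouring m (c ∷ cs) zero    i j = digitAt c (m ℕ.* m) (m ℕ.* toℕ i ℕ.+ toℕ j)
colouring m (c ∷ cs) (suc a) i j = colouring m cs a i j

-- The tile at `(x , y)` has the number `2 x + y`, as in `coord 2`; the last two codes are six-digit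
-- numerals beginning with 0.
tiles6 : Letter → Fin 6 → Fin 6
tiles6 = byDigits 6 130245 203145 13524 14253

-- The synthematic totals of the six tiles other than the one fixed by L and R.
totals5 : Letter → Fin 5 → Fin 5
totals5 = byDigits 5 42031 24130 32014 23104

-- A total splits the edges of K₆ into five perfect matchings. The matching that joins 0 and `j`
-- gets colour `j`, so every table begins with 012345.
total5-colouring : Fin 5 → Fin 6 → Fin 6 → ℕ
total5-colouring = colouring 6
  (012345105423250134341052423501534210 ∷ 012345104532240153351024435201523410 ∷
   012345105234250413324051431502543120 ∷ 012345103452230514345021451203524130 ∷
   012345104253240531325014453102531420 ∷ [])

-- The six partitions of the edges of K₅ into two pentagons.
pentagons : Fin 6 → Fin 5 → Fin 5 → ℕ
pentagons = colouring 5
  (0121210122210211220122110 ∷ 0112210212120212120122110 ∷ 0121210221220111210221120 ∷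
   0122110212220112110212120 ∷ 0112210221120122210121210 ∷ 0122110122210122210112210 ∷ [])

swaps5 : List (ℕ × ℕ)
swaps5 = (01 , 3242311) ∷ (02 , 31331) ∷ (03 , 31311) ∷ (04 , 33242) ∷ (12 , 31131) ∷ (13 , 42411) ∷
         (14 , 33131) ∷ (23 , 14241) ∷ (24 , 32423) ∷ (34 , 13131) ∷ []

opaque
  tiles6-undone : CheckAction.undone? tiles6 ≡ true
  tiles6-undone = refl

  tiles6-models : CheckAction.models? tiles6 2 (coord 2) ≡ true
  tiles6-models = refl

  totals5-undone : CheckAction.undone? totals5 ≡ true
  totals5-undone = refl

Tiles6 : Action 6
Tiles6 = CheckAction.action tiles6 tiles6-undone

Totals5 : Action 5
Totals5 = CheckAction.action totals5 totals5-undone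

opaque
  totals5-equivariant : CheckStructure.equivariant? Tiles6 Totals5 total5-colouring ≡ true
  totals5-equivariant = refl

  totals5-separated : CheckStructure.separated? Tiles6 Totals5 total5-colouring ≡ true
  totals5-separated = refl

  pentagons-equivariant : CheckStructure.equivariant? Totals5 Tiles6 pentagons ≡ true
  pentagons-equivariant = refl

  pentagons-separated : CheckStructure.separated? Totals5 Tiles6 pentagons ≡ true
  pentagons-separated = refl

  swaps5-checked : Generation.swaps? Totals5 swaps5 ≡ true
  swaps5-checked = refl

-- Chosen to make `L` the map z ↦ 2 z + 1: its fixed points ∞ and 4 label the tiles 4 and 5 outside
-- the left block, and it permutes 0, 1, 3, 2 cyclically, as `L` does with the tiles of these
-- numbers.
label : Fin 6 → P¹₅
label t = pick (toℕ t)
  where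
  pick : ℕ → P¹₅
  pick 4 = nothing
  pick 5 = just (4 mod 5)
  pick m = just (m mod 5)

tileOf : P¹₅ → Fin 6
tileOf nothing  = 4 mod 6
tileOf (just z) = (if toℕ z ≡ᵇ 4 then 5 else toℕ z) mod 6

tileOf-label : ∀ t → tileOf (label t) ≡ t
tileOf-label zero = refl
tileOf-label (suc zero) = refl
tileOf-label (suc (suc zero)) = refl
tileOf-label (suc (suc (suc zero))) = refl
tileOf-label (suc (suc (suc (suc zero)))) = refl
tileOf-label (suc (suc (suc (suc (suc zero))))) = refl

label-tileOf : ∀ z → label (tileOf z) ≡ z
label-tileOf nothing = refl
label-tileOf (just zero) = refl
label-tileOf (just (suc zero)) = refl
label-tileOf (just (suc (suc zero))) = refl
label-tileOf (just (suc (suc (suc zero)))) = refl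
label-tileOf (just (suc (suc (suc (suc zero))))) = refl

record Matrix : Set where
  constructor mat
  field a b c d : Fin 5

Regular : Matrix → Set
Regular (mat a b c d) = det≢0 a b c d

regularᵇ : Matrix → Bool
regularᵇ (mat a b c d) = not ((toℕ a ℕ.* toℕ d ℕ.+ 4 ℕ.* toℕ b ℕ.* toℕ c) % 5 ≡ᵇ 0)

moebius : Matrix → P¹₅ → P¹₅
moebius (mat a b c d) = mobius a b c d

-- `L` is z ↦ 2 z + 1 and `R` is z ↦ 2 z / (z + 1), with the matrices scaled so that the first entry
-- is 1.
letterMatrix : Letter → Matrix
letterMatrix L  = mat (1 mod 5) (3 mod 5) (0 mod 5) (3 mod 5)
letterMatrix L⁻ = mat (1 mod 5) (4 mod 5) (0 mod 5) (2 mod 5)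
letterMatrix R  = mat (1 mod 5) (0 mod 5) (3 mod 5) (3 mod 5)
letterMatrix R⁻ = mat (1 mod 5) (0 mod 5) (4 mod 5) (2 mod 5)

_·_ : Matrix → Matrix → Matrix
mat a b c d · mat a' b' c' d' = mat (a ⊗ a' ⊞ b ⊗ c') (a ⊗ b' ⊞ b ⊗ d') (c ⊗ a' ⊞ d ⊗ c') (c ⊗ b' ⊞ d ⊗ d')
  where
  infixl 7 _⊗_
  infixl 6 _⊞_
  _⊗_ : Fin 5 → Fin 5 → ℕ
  x ⊗ y = toℕ x ℕ.* toℕ y
  _⊞_ : ℕ → ℕ → Fin 5
  x ⊞ y = (x ℕ.+ y) mod 5

-- Words for z ↦ z + 1, z ↦ 2 z and z ↦ 1 / z.
translate scale invert : List Letter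
translate = spell 4133
scale     = spell 31411
invert    = spell 4132

-- The discrete logarithm modulo 5 to the base 2, which generates the units; the default covers the
-- argument 1.
log₂ : ℕ → ℕ
log₂ 2 = 1
log₂ 4 = 2
log₂ 3 = 3
log₂ _ = 0

-- For c ≠ 0, (a z + b) / (c z + d) = a / c + ((b c - a d) / c²) / (z + d / c).
matrixWord : Matrix → List Letter
matrixWord (mat a b c d) = go (toℕ a) (toℕ b) (toℕ c) (toℕ d)
  where
  go : ℕ → ℕ → ℕ → ℕ → List Letter
  go a b zero d = repeat ((b ℕ.* inv₅ d) % 5) translate ++ repeat (log₂ ((a ℕ.* inv₅ d) % 5)) scale
  go a b c@(suc _) d =
    repeat ((a ℕ.* inv₅ c) % 5) translate ++
    repeat (log₂ (((b ℕ.* c ℕ.+ 4 ℕ.* a ℕ.* d) ℕ.* (inv₅ c ℕ.* inv₅ c)) % 5)) scale ++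
    invert ++ repeat ((d ℕ.* inv₅ c) % 5) translate

allMatrices : (Matrix → Bool) → Bool
allMatrices p = allFin? 5 λ a → allFin? 5 λ b → allFin? 5 λ c → allFin? 5 λ d → p (mat a b c d)

allMatrices-sound : ∀ {p} → allMatrices p ≡ true → ∀ M → p M ≡ true
allMatrices-sound {p} t (mat a b c d) =
  allFin?-sound {p = λ d → p (mat a b c d)}
    (allFin?-sound {p = λ c → allFin? 5 λ d → p (mat a b c d)}
      (allFin?-sound {p = λ b → allFin? 5 λ c → allFin? 5 λ d → p (mat a b c d)}
        (allFin?-sound {p = λ a → allFin? 5 λ b → allFin? 5 λ c → allFin? 5 λ d → p (mat a b c d)} t a) b) c) d

-- Evaluated for every regular matrix, this takes the place of a proof that `mobius` turns matrix
-- products into composites; an induction on words uses only products with a letter.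
composesᵇ : Letter → Matrix → Bool
composesᵇ x M = not (regularᵇ M) ∨ (regularᵇ (letterMatrix x · M) ∧
  (allFin? 6 λ t → tiles6 x (tileOf (moebius M (label t))) == tileOf (moebius (letterMatrix x · M) (label t))))

spelledᵇ : Matrix → Bool
spelledᵇ M = not (regularᵇ M) ∨
  (allFin? 6 λ t → by-word Tiles6 (matrixWord M) t == tileOf (moebius M (label t)))

opaque
  composes-checked : (allLetters λ x → allMatrices (composesᵇ x)) ≡ true
  composes-checked = refl

  spelled-checked : allMatrices spelledᵇ ≡ true
  spelled-checked = refl

regular⇒ : ∀ M → Regular M → regularᵇ M ≡ true
regular⇒ (mat a b c d) ne with (toℕ a ℕ.* toℕ d ℕ.+ 4 ℕ.* toℕ b ℕ.* toℕ c) % 5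
... | zero  = ⊥-elim (ne refl)
... | suc _ = refl

⇒regular : ∀ M → regularᵇ M ≡ true → Regular M
⇒regular (mat a b c d) e z rewrite z = case e of λ ()

when-regular : ∀ {a b} → a ≡ true → not a ∨ b ≡ true → b ≡ true
when-regular refl e = e

Represents : List Letter → Matrix → Set
Represents u M = ∀ t → label (by-word Tiles6 u t) ≡ moebius M (label t)

word-moebius : ∀ u → ∃[ M ] (Regular M × Represents u M)
word-moebius [] = mat (1 mod 5) (0 mod 5) (0 mod 5) (1 mod 5) , (λ ()) , identity
  where
  identity : ∀ t → label t ≡ moebius (mat (1 mod 5) (0 mod 5) (0 mod 5) (1 mod 5)) (label t)
  identity zero = refl
  identity (suc zero) = refl
  identity (suc (suc zero)) = refl
  identity (suc (suc (suc zero))) = refl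
  identity (suc (suc (suc (suc zero)))) = refl
  identity (suc (suc (suc (suc (suc zero))))) = refl
word-moebius (x ∷ u) =
  let M , reg , rep = word-moebius u
      ok = when-regular (regular⇒ M reg)
             (allMatrices-sound {composesᵇ x} (allLetters-sound {λ x → allMatrices (composesᵇ x)} composes-checked x) M)
      reg' , step' = ∧-true {regularᵇ (letterMatrix x · M)} ok
  in letterMatrix x · M , ⇒regular (letterMatrix x · M) reg' , λ t → begin
       label (tiles6 x (by-word Tiles6 u t))                  ≡⟨ cong (label ∘ tiles6 x) (tileOf-label (by-word Tiles6 u t)) ⟨
       label (tiles6 x (tileOf (label (by-word Tiles6 u t)))) ≡⟨ cong (label ∘ tiles6 x ∘ tileOf) (rep t) ⟩
       label (tiles6 x (tileOf (moebius M (label t))))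
         ≡⟨ cong label (==-sound (allFin?-sound {p = λ t → tiles6 x (tileOf (moebius M (label t))) == tileOf (moebius (letterMatrix x · M) (label t))} step' t)) ⟩
       label (tileOf (moebius (letterMatrix x · M) (label t))) ≡⟨ label-tileOf _ ⟩
       moebius (letterMatrix x · M) (label t)                 ∎
  where open ≡-Reasoning

moebius-word : ∀ M → Regular M → Represents (matrixWord M) M
moebius-word M reg t = trans (cong label (==-sound (allFin?-sound {p = λ t → by-word Tiles6 (matrixWord M) t == tileOf (moebius M (label t))}
    (when-regular (regular⇒ M reg) (allMatrices-sound {spelledᵇ} spelled-checked M)) t)))
  (label-tileOf _)

-- The action on the 3 × 4 rectangle and its two colour classes

black6 white6 : Letter → Fin 6 → Fin 6
black6 = byDigits 6 142035 302415 14253 13524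
white6 = byDigits 6 203145 130245 025314 041352

-- All six totals of the black tiles, each at the place of its white tile; words that agree on the
-- black tiles must then agree on the white ones.
total6-colouring : Fin 6 → Fin 6 → Fin 6 → ℕ
total6-colouring = colouring 6
  (012345104253240531325014453102531420 ∷ 012345105234250413324051431502543120 ∷
   012345104532240153351024435201523410 ∷ 012345103524230451354012425103541230 ∷
   012345105423250134341052423501534210 ∷ 012345103452230514345021451203524130 ∷ [])

swaps-black swaps-white : List (ℕ × ℕ)
swaps-black =
  (01 , 1332331) ∷ (02 , 3113313) ∷ (03 , 3323311) ∷ (04 , 3311331) ∷ (05 , 3233113) ∷
  (12 , 3133113) ∷ (13 , 3311332) ∷ (14 , 3313311) ∷ (15 , 3113323) ∷ (23 , 331131411) ∷
  (24 , 331142311) ∷ (25 , 311411311) ∷ (34 , 1331331) ∷ (35 , 331141311) ∷ (45 , 331132411) ∷ []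
swaps-white =
  (01 , 331323311) ∷ (02 , 332413311) ∷ (03 , 311311311) ∷ (04 , 1331141) ∷ (05 , 1411331) ∷
  (12 , 3113113) ∷ (13 , 332313311) ∷ (14 , 3311411) ∷ (15 , 4113311) ∷ (23 , 331423311) ∷
  (24 , 3113311) ∷ (25 , 3311311) ∷ (34 , 1311331) ∷ (35 , 1331131) ∷ (45 , 3114113) ∷ []

fromBlack fromWhite : Fin 6 → Fin 12
fromBlack c = (2 ℕ.* toℕ c) mod 12
fromWhite c = (2 ℕ.* toℕ c ℕ.+ 1) mod 12

half : Fin 12 → Fin 6
half t = (toℕ t / 2) mod 6

-- The tile at `(x , y)` has the number `3 x + y`, of the same parity as `x + y`. The class is
-- relative to the corner of the rectangle, whose own colour may be either.
isWhite : Fin 12 → Bool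
isWhite t = odd (toℕ t)

tiles12 : Letter → Fin 12 → Fin 12
tiles12 x t = if isWhite t then fromWhite (white6 x (half t)) else fromBlack (black6 x (half t))

opaque
  black6-undone : CheckAction.undone? black6 ≡ true
  black6-undone = refl

  white6-undone : CheckAction.undone? white6 ≡ true
  white6-undone = refl

  tiles12-undone : CheckAction.undone? tiles12 ≡ true
  tiles12-undone = refl

  tiles12-models : CheckAction.models? tiles12 3 (coord 3) ≡ true
  tiles12-models = refl

Black6 White6 : Action 6
Black6 = CheckAction.action black6 black6-undone
White6 = CheckAction.action white6 white6-undone

Tiles12 : Action 12
Tiles12 = CheckAction.action tiles12 tiles12-undone

opaque
  swaps-black-checked : Generation.swaps? Black6 swaps-black ≡ true
  swaps-black-checked = refl

  swaps-white-checked : Generation.swaps? White6 swaps-white ≡ true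
  swaps-white-checked = refl

  totals6-equivariant : CheckStructure.equivariant? Black6 White6 total6-colouring ≡ true
  totals6-equivariant = refl

  totals6-separated : CheckStructure.separated? Black6 White6 total6-colouring ≡ true
  totals6-separated = refl

half-fromBlack : ∀ c → half (fromBlack c) ≡ c
half-fromBlack c = ==-sound (allFin?-sound {p = λ c → half (fromBlack c) == c} refl c)

half-fromWhite : ∀ c → half (fromWhite c) ≡ c
half-fromWhite c = ==-sound (allFin?-sound {p = λ c → half (fromWhite c) == c} refl c)

fromBlack-class : ∀ c → isWhite (fromBlack c) ≡ false
fromBlack-class c = Boolₚ.not-injective (allFin?-sound {p = λ c → not (isWhite (fromBlack c))} refl c)

fromWhite-class : ∀ c → isWhite (fromWhite c) ≡ true
fromWhite-class c = allFin?-sound {p = λ c → isWhite (fromWhite c)} refl c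

from-half : ∀ t → (if isWhite t then fromWhite (half t) else fromBlack (half t)) ≡ t
from-half t = ==-sound (allFin?-sound {p = λ t → (if isWhite t then fromWhite (half t) else fromBlack (half t)) == t} refl t)

fromBlack-half : ∀ t → isWhite t ≡ false → fromBlack (half t) ≡ t
fromBlack-half t e = trans (sym (cong (λ b → if b then fromWhite (half t) else fromBlack (half t)) e)) (from-half t)

fromWhite-half : ∀ t → isWhite t ≡ true → fromWhite (half t) ≡ t
fromWhite-half t e = trans (sym (cong (λ b → if b then fromWhite (half t) else fromBlack (half t)) e)) (from-half t)

black-commutes : ∀ x c → tiles12 x (fromBlack c) ≡ fromBlack (black6 x c)
black-commutes x c = trans (cong (λ b → if b then fromWhite (white6 x (half (fromBlack c))) else fromBlack (black6 x (half (fromBlack c)))) (fromBlack-class c))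
  (cong (fromBlack ∘ black6 x) (half-fromBlack c))

white-commutes : ∀ x c → tiles12 x (fromWhite c) ≡ fromWhite (white6 x c)
white-commutes x c = trans (cong (λ b → if b then fromWhite (white6 x (half (fromWhite c))) else fromBlack (black6 x (half (fromWhite c)))) (fromWhite-class c))
  (cong (fromWhite ∘ white6 x) (half-fromWhite c))

class-parity : ∀ t → isWhite t ≡ odd (proj₁ (coord 3 t) ℕ.+ proj₂ (coord 3 t))
class-parity t = xor-cancel {isWhite t} (Boolₚ.not-injective
  (allFin?-sound {p = λ t → not (isWhite t xor odd (proj₁ (coord 3 t) ℕ.+ proj₂ (coord 3 t)))} refl t))


module SixTiles (rs : List Rect) {n : ℕ} (e : Fin n → Cell) (e-inj : Injective _≡_ _≡_ e)
                (e-in : ∀ i → InFig 2 rs (e i)) (e-onto : ∀ c → InFig 2 rs c → ∃[ i ] e i ≡ c)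
                (r : Rect) (r⊆ : ∀ c → InRect 2 r c → InFig 2 rs c) (⊆r : ∀ c → InFig 2 rs c → InRect 2 r c) where

  open Figure 2 rs e e-inj e-in e-onto using (InG⇒G; G⇒InG)
  open Counting 2 rs e e-inj e-in e-onto r r⊆ using (index)
  open SingleRect 1 rs e e-inj e-in e-onto r r⊆ ⊆r Tiles6 (CheckAction.models tiles6 2 (coord 2) tiles6-models)

  ℓ : Fin n ↔ P¹₅
  ℓ = mk↔ₛ′ (label ∘ π) (index ∘ tileOf)
        (λ z → trans (cong label (π-index (tileOf z))) (label-tileOf z))
        (λ i → trans (cong index (tileOf-label (π i))) (index-π i))

  projective : ∀ σ → InG 2 rs e σ ⇔
    (∃[ a ] ∃[ b ] ∃[ c ] ∃[ d ] (det≢0 a b c d ×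
      (∀ i → Inverse.to ℓ (σ ⟨$⟩ʳ i) ≡ mobius a b c d (Inverse.to ℓ i))))
  projective σ = mk⇔ to from
    where
    to : InG 2 rs e σ → _
    to g = let u , sp = G⇒spells σ (InG⇒G {σ} g)
               mat a b c d , reg , rep = word-moebius u
           in a , b , c , d , reg , λ i → trans (cong label (sp i)) (rep (π i))
    from : _ → InG 2 rs e σ
    from (a , b , c , d , reg , eq) = G⇒InG {σ} (spells⇒G σ (matrixWord M) λ i →
        trans (sym (tileOf-label _)) (trans (cong tileOf (trans (eq i) (sym (moebius-word M reg (π i))))) (tileOf-label _)))
      where M = mat a b c d

  isomorphism : IsoToSym (InG 2 rs e) 5
  isomorphism = iso Totals5
    (Structure.determined (CheckStructure.structure Tiles6 Totals5 total5-colouring totals5-equivariant totals5-separated))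
    (Structure.determined (CheckStructure.structure Totals5 Tiles6 pentagons pentagons-equivariant pentagons-separated))
    (Generation.generated Totals5 swaps5 swaps5-checked)

black-words : ∀ u c → by-word Tiles12 u (fromBlack c) ≡ fromBlack (by-word Black6 u c)
black-words []      c = refl
black-words (x ∷ u) c = trans (cong (tiles12 x) (black-words u c)) (black-commutes x (by-word Black6 u c))

white-words : ∀ u c → by-word Tiles12 u (fromWhite c) ≡ fromWhite (by-word White6 u c)
white-words []      c = refl
white-words (x ∷ u) c = trans (cong (tiles12 x) (white-words u c)) (white-commutes x (by-word White6 u c))

module TwelveTiles (rs : List Rect) {n : ℕ} (e : Fin n → Cell) (e-inj : Injective _≡_ _≡_ e)
                   (e-in : ∀ i → InFig 3 rs (e i)) (e-onto : ∀ c → InFig 3 rs c → ∃[ i ] e i ≡ c)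
                   (r : Rect) (r⊆ : ∀ c → InRect 3 r c → InFig 3 rs c) (⊆r : ∀ c → InFig 3 rs c → InRect 3 r c) where

  open SingleRect 2 rs e e-inj e-in e-onto r r⊆ ⊆r Tiles12 (CheckAction.models tiles12 3 (coord 3) tiles12-models)

  isomorphism : IsoToSym (InG 3 rs e) 6
  isomorphism = iso Black6
    (λ u v same c → trans (sym (half-fromBlack _)) (trans (cong half (trans (sym (black-words u c))
       (trans (same (fromBlack c)) (black-words v c)))) (half-fromBlack _)))
    black⇒tiles
    (Generation.generated Black6 swaps-black swaps-black-checked)
    where
    black⇒tiles : ∀ u v → (∀ a → by-word Black6 u a ≡ by-word Black6 v a) → ∀ t → by-word Tiles12 u t ≡ by-word Tiles12 v t
    black⇒tiles u v same t = by-class (isWhite t) refl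
      where
      white : ∀ a → by-word White6 u a ≡ by-word White6 v a
      white = Structure.determined
        (CheckStructure.structure Black6 White6 total6-colouring totals6-equivariant totals6-separated) u v same
      by-class : ∀ b → isWhite t ≡ b → by-word Tiles12 u t ≡ by-word Tiles12 v t
      by-class false b = subst (λ s → by-word Tiles12 u s ≡ by-word Tiles12 v s) (fromBlack-half t b)
        (trans (black-words u (half t)) (trans (cong fromBlack (same (half t))) (sym (black-words v (half t)))))
      by-class true  b = subst (λ s → by-word Tiles12 u s ≡ by-word Tiles12 v s) (fromWhite-half t b)
        (trans (white-words u (half t)) (trans (cong fromWhite (white (half t))) (sym (white-words v (half t)))))

  black-class : ∀ i → black (e i) ≡ black (Rect.corner r) xor isWhite (π i)
  black-class i = trans (cong black (sym (cellOf-π i)))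
    (trans (tile-black (π i)) (cong (black (Rect.corner r) xor_) (sym (class-parity (π i)))))

  -- Tiles of colour `β` form the class `black (Rect.corner r) xor β`, so the corner decides whether
  -- `Black6` or `White6` acts on them.
  projections : ∀ β τ → PreservesColour e τ →
    ∃[ σ ] (InG 3 rs e σ × (∀ i → black (e i) ≡ β → σ ⟨$⟩ʳ i ≡ τ ⟨$⟩ʳ i))
  projections β τ pres = go (black (Rect.corner r) xor β) refl
    where
    cls-pres : ∀ i → isWhite (π (τ ⟨$⟩ʳ i)) ≡ isWhite (π i)
    cls-pres i = xor-cancelˡ (black (Rect.corner r))
      (trans (sym (black-class (τ ⟨$⟩ʳ i))) (trans (pres i) (black-class i)))
    class-of : ∀ b i → black (Rect.corner r) xor β ≡ b → black (e i) ≡ β → isWhite (π i) ≡ b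
    class-of b i eq ib = xor-cancelˡ (black (Rect.corner r)) (trans (sym (black-class i)) (trans ib
      (trans (sym (undone-xor (black (Rect.corner r)) β)) (cong (black (Rect.corner r) xor_) eq))))
      where
      undone-xor : ∀ a b → a xor (a xor b) ≡ b
      undone-xor true  b = Boolₚ.not-involutive b
      undone-xor false b = refl
    go : ∀ b → black (Rect.corner r) xor β ≡ b →
         ∃[ σ ] (InG 3 rs e σ × (∀ i → black (e i) ≡ β → σ ⟨$⟩ʳ i ≡ τ ⟨$⟩ʳ i))
    go false eq =
      let σ , g , agree = projection Black6 fromBlack half isWhite false half-fromBlack fromBlack-half fromBlack-class
                            black-commutes (Generation.generated Black6 swaps-black swaps-black-checked) τ cls-pres
      in σ , g , λ i ib → agree i (class-of false i eq ib)
    go true  eq =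
      let σ , g , agree = projection White6 fromWhite half isWhite true half-fromWhite fromWhite-half fromWhite-class
                            white-commutes (Generation.generated White6 swaps-white swaps-white-checked) τ cls-pres
      in σ , g , λ i ib → agree i (class-of true i eq ib)

theorem1 :
  (k : ℕ) → 1 < k →
  (rs : List Rect) → Admissible k rs →
  (n : ℕ) (e : Fin n → Cell) → Injective _≡_ _≡_ e →
  (∀ i → InFig k rs (e i)) → (∀ c → InFig k rs c → ∃[ i ] e i ≡ c) →
  -- part 1: k even
  ((k % 2 ≡ 0 → n ≢ 6 →
     (k % 4 ≡ 0 → ∀ σ → InG k rs e σ ⇔ IsEven σ) ×
     (k % 4 ≡ 2 → ∀ σ → InG k rs e σ))
  -- part 2: k odd
  × (k % 2 ≡ 1 → n ≢ 12 →
     ((k % 8 ≡ 1 ⊎ k % 8 ≡ 7) → ∀ σ →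
        InG k rs e σ ⇔ (PreservesColour e σ × EvenOn (black ∘ e) σ
                                            × EvenOn (not ∘ black ∘ e) σ)) ×
     ((k % 8 ≡ 3 ⊎ k % 8 ≡ 5) → ∀ σ →
        InG k rs e σ ⇔ (PreservesColour e σ ×
                        ((EvenOn (black ∘ e) σ × EvenOn (not ∘ black ∘ e) σ) ⊎
                         (¬ EvenOn (black ∘ e) σ × ¬ EvenOn (not ∘ black ∘ e) σ)))))
  -- part 3: n = 6
  × (n ≡ 6 →
     (Σ[ ℓ ∈ Fin n ↔ P¹₅ ] ∀ σ →
        InG k rs e σ ⇔
          (∃[ a ] ∃[ b ] ∃[ c ] ∃[ d ] (det≢0 a b c d ×
             (∀ i → Inverse.to ℓ (σ ⟨$⟩ʳ i) ≡ mobius a b c d (Inverse.to ℓ i)))))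
     × IsoToSym (InG k rs e) 5)
  -- part 3: k = 3, n = 12
  × (k ≡ 3 → n ≡ 12 →
     IsoToSym (InG k rs e) 6 ×
     (∀ τ → PreservesColour e τ →
        ∃[ σ ] (InG k rs e σ × (∀ i → black (e i) ≡ true → σ ⟨$⟩ʳ i ≡ τ ⟨$⟩ʳ i))) ×
     (∀ τ → PreservesColour e τ →
        ∃[ σ ] (InG k rs e σ × (∀ i → black (e i) ≡ false → σ ⟨$⟩ʳ i ≡ τ ⟨$⟩ʳ i)))))
theorem1 k 1<k rs adm n e e-inj e-in e-onto = part1 , part2 , part3-6 k adm 1<k e-in e-onto , part3-12 k adm e-in e-onto
  where
  -- The only obstruction to linkage is a figure covered by one rectangle with `k = 2` or `k = 3`,
  -- which has exactly 6 or 12 tiles.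
  linked : (k ≡ 2 → n ≢ 6) → (k ≡ 3 → n ≢ 12) → LinkedFigure k rs
  linked n≢6 n≢12 = conclude (linked-figure k 1<k rs adm)
    where
    conclude : LinkedFigure k rs ⊎ ((k ≡ 2 ⊎ k ≡ 3) × ∃[ r ] Covers k r rs) → LinkedFigure k rs
    conclude (inj₁ l) = l
    conclude (inj₂ (small , r , ⊆r , r⊆)) = ⊥-elim (absurd small (Counting.covers⇒size k rs e e-inj e-in e-onto r r⊆ ⊆r))
      where
      absurd : k ≡ 2 ⊎ k ≡ 3 → n ≡ size k → ⊥
      absurd (inj₁ k≡2) n≡ = n≢6 k≡2 (trans n≡ (cong size k≡2))
      absurd (inj₂ k≡3) n≡ = n≢12 k≡3 (trans n≡ (cong size k≡3))

  module P = Parity k rs adm e e-inj e-in e-onto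

  part1 : k % 2 ≡ 0 → n ≢ 6 → _
  part1 ev n≢6 = P.Part1.part1-0 1<k l , P.Part1.part1-2 1<k l
    where l = linked (λ _ → n≢6) (λ k≡3 _ → case trans (sym ev) (cong (_% 2) k≡3) of λ ())

  part2 : k % 2 ≡ 1 → n ≢ 12 → _
  part2 od n≢12 = P.Part2.part2-17 l , P.Part2.part2-35 l
    where l = linked (λ k≡2 _ → case trans (sym od) (cong (_% 2) k≡2) of λ ()) (λ _ → n≢12)

  -- Six tiles force `k = 2`: for `k ≥ 3` one rectangle already has at least 4 · 3 tiles. `k` and
  -- what depends on it are abstracted so that `k` can be matched.
  part3-6 : ∀ k → Admissible k rs → 1 < k → (∀ i → InFig k rs (e i)) → (∀ c → InFig k rs c → ∃[ i ] e i ≡ c) → n ≡ 6 →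
    (Σ[ ℓ ∈ Fin n ↔ P¹₅ ] ∀ σ → InG k rs e σ ⇔
      (∃[ a ] ∃[ b ] ∃[ c ] ∃[ d ] (det≢0 a b c d ×
        (∀ i → Inverse.to ℓ (σ ⟨$⟩ʳ i) ≡ mobius a b c d (Inverse.to ℓ i)))))
    × IsoToSym (InG k rs e) 5
  part3-6 1 _ (s≤s ())
  part3-6 2 adm _ e-in e-onto n≡6 = (S.ℓ , S.projective) , S.isomorphism
    where
    r = proj₁ (oldest 2 rs adm)
    r⊆ = proj₂ (oldest 2 rs adm)
    module S = SixTiles rs e e-inj e-in e-onto r r⊆
      (Counting.size⇒covers 2 rs e e-inj e-in e-onto r r⊆ n≡6)
  part3-6 k@(suc (suc (suc m))) adm _ e-in e-onto n≡6 = ⊥-elim (ℕₚ.<⇒≱ {6} {12} (ℕₚ.m≤m+n 7 5)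
      (ℕₚ.≤-trans (ℕₚ.*-mono-≤ (ℕₚ.m≤m+n 4 m) (ℕₚ.m≤m+n 3 m)) (subst (size k ≤_) n≡6
        (Counting.size≤ k rs e e-inj e-in e-onto (proj₁ o) (proj₂ o)))))
    where o = oldest k rs adm

  part3-12 : ∀ k → Admissible k rs → (∀ i → InFig k rs (e i)) → (∀ c → InFig k rs c → ∃[ i ] e i ≡ c) → k ≡ 3 → n ≡ 12 →
    IsoToSym (InG k rs e) 6 ×
    (∀ τ → PreservesColour e τ → ∃[ σ ] (InG k rs e σ × (∀ i → black (e i) ≡ true → σ ⟨$⟩ʳ i ≡ τ ⟨$⟩ʳ i))) ×
    (∀ τ → PreservesColour e τ → ∃[ σ ] (InG k rs e σ × (∀ i → black (e i) ≡ false → σ ⟨$⟩ʳ i ≡ τ ⟨$⟩ʳ i)))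
  part3-12 _ adm e-in e-onto refl n≡12 = T.isomorphism , T.projections true , T.projections false
    where
    r = proj₁ (oldest 3 rs adm)
    r⊆ = proj₂ (oldest 3 rs adm)
    module T = TwelveTiles rs e e-inj e-in e-onto r r⊆
      (Counting.size⇒covers 3 rs e e-inj e-in e-onto r r⊆ n≡12)
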